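{- Let $B$ be any oriented graph that admits a homomorphism $B\to\vec K_2$. Then the underlying undirected graph $\overline{B}$ (with the bipartition induced by this homomorphism) has the asymmetric forcing property if and only if $B$ has the directed forcing property.
   Context: All graphs are finite with non-empty vertex set. An oriented graph is a directed graph obtained from a simple undirected graph by orienting each edge (so there are no loops and at most one of $(x,y),(y,x)$ is an edge). $v(G)$ and $e(G)$ denote the numbers of vertices and edges of $G$. $\vec K_2$ is the oriented graph with two vertices and a single directed edge. $\overline{B}$ denotes the undirected graph obtained from $B$ by forgetting the directions of all edges. A homomorphism of oriented graphs $f:V(B)\to V(G)$ is a map such that $(f(x),f(y))\in E(G)$ whenever $(x,y)\in E(B)$. The homomorphism density $t(B,G)$ is the number of homomorphisms from $B$ to $G$ divided by $v(G)^{v(B)}$; in particular $t(\vec K_2,G)=e(G)/v(G)^2$. A bipartite undirected graph always comes with a fixed ordered bipartition of its vertex set. If $A$ is bipartite with parts $A_1\sqcup A_2$ and $H$ is bipartite with non-empty parts $U_1\sqcup U_2$, then $t_{\mathrm{bip}}(A,H)$ is the fraction of maps $f:V(A)\to V(H)$ with $f(A_1)\subset U_1$ and $f(A_2)\subset U_2$ that are homomorphisms (send edges to edges). The bipartite density of $H$ is $t_{\mathrm{bip}}(K_2,H)=|E(H)|/(|U_1||U_2|)$. If $B$ has a homomorphism to $\vec K_2$, then $\overline{B}$ is regarded as a bipartite graph whose first part is the set of vertices mapped to the tail of the edge of $\vec K_2$ and whose second part is the set of vertices mapped to the head, so that all edges of $B$ are directed from the first part to the second. For a directed graph $G$ on vertex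 set $\{1,\dots,n\}$, the associated directed graphon $W_G:[0,1]^2\to[0,1]$ is obtained by partitioning $[0,1]$ into $n$ intervals $I_1,\dots,I_n$ of equal length and setting $W_G(x,y)=1$ if $x\in I_i$, $y\in I_j$ with $(i,j)\in E(G)$, and $0$ otherwise. For a bipartite graph $H$ with parts $\{v_1,\dots,v_n\}$ and $\{w_1,\dots,w_m\}$, the associated bipartite graphon $W_H:[0,1]^2\to[0,1]$ is obtained by partitioning $[0,1]$ into $n$ equal intervals $I_1,\dots,I_n$ and also into $m$ equal intervals $J_1,\dots,J_m$, and setting $W_H(x,y)=1$ if $x\in I_i$, $y\in J_j$ with $v_iw_j\in E(H)$, and $0$ otherwise. For a bounded measurable $U:[0,1]^2\to\mathbb{R}$, the cut norm is $\|U\|_\square=\sup_{S,T}\left|\int_{S\times T}U(x,y)\,dx\,dy\right|$, the supremum over measurable $S,T\subset[0,1]$. For $q\in[0,1]$, a sequence of directed graphs (respectively, bipartite graphs) $\{G_n\}_{n\in\mathbb{N}}$ is $q$-quasirandom if the associated directed (respectively, bipartite) graphons satisfy $\lim_{n\to\infty}\|W_{G_n}-q\|_\square=0$, where $q$ denotes the constant function. An oriented graph $B$ has the directed forcing property if for every $p\in[0,1]$ and every sequence of oriented graphs $\{G_n\}_{n\in\mathbb{N}}$ with $t(\vec K_2,G_n)\to p/2$ and $t(B,G_n)\to(p/2)^{e(B)}$ as $n\to\infty$, the sequence $\{G_n\}_{n\in\mathbb{N}}$ is $(p/2)$-quasirandom. A bipartite undirected graph $A$ has the asymmetric forcing property if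 for every $p\in[0,1]$ and every sequence of bipartite undirected graphs $\{H_n\}_{n\in\mathbb{N}}$ with $t_{\mathrm{bip}}(K_2,H_n)\to p$ and $t_{\mathrm{bip}}(A,H_n)\to p^{e(A)}$ as $n\to\infty$, the sequence $\{H_n\}_{n\in\mathbb{N}}$ is $p$-quasirandom. -}

module Defs where

open import Data.Bool.Base using (Bool; true; false; T; _∨_; if_then_else_)
open import Data.Bool.Properties using (T?; ∨-comm)
open import Data.Fin.Base as Fin using (Fin; zero; suc; toℕ; finToFun; funToFin)
import Data.Fin.Properties as Fin
import Data.Integer.Base as ℤ
open import Data.List.Base using (List; _∷_; length; filter; lookup; allFin; cartesianProduct)
open import Data.List.Membership.Propositional using (_∈_)
open import Data.List.Membership.Propositional.Properties using (∈-filter⁺; ∈-allFin)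
import Data.Nat.Base as ℕ
import Data.Nat.Properties as ℕ
open import Data.Nat.Base using (ℕ; zero; suc; NonZero)
open import Data.Product.Base using (∃; ∃-syntax; _×_; _,_; proj₁; proj₂)
import Data.Rational.Base as ℚ
import Data.Rational.Properties as ℚ
import Data.Rational.Solver as ℚ
open import Data.Rational.Base using (ℚ; 0ℚ; 1ℚ; ½)
open import Data.Sum.Base using (_⊎_; inj₁; inj₂)
import Data.Vec.Functional as Vector
open import Function.Base using (id)
open import Relation.Binary.Core using (Rel)
open import Relation.Binary.Definitions using (_Respects_)
open import Relation.Binary.PropositionalEquality
open import Relation.Nullary.Decidable using (Dec; _×-dec_; _→-dec_)
open import Relation.Nullary.Negation using (¬_)
open import Relation.Unary using (Pred; _∩_; _⊆_; _∉_)
open import Level using (0ℓ)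

------------------------------------------------------------------------
-- Real numbers: Cauchy sequences of rationals, compared by _≤_ and _≈_

record ℝ : Set where
  constructor mkℝ
  field
    seq    : ℕ → ℚ
    cauchy : ∀ ε → 0ℚ ℚ.< ε → ∃[ N ] ∀ m n → N ℕ.≤ m → N ℕ.≤ n →
             ℚ.∣ seq m ℚ.- seq n ∣ ℚ.≤ ε
open ℝ public

infix  4 _≤_ _<_ _≈_
infixl 6 _+_ _-_
infixl 7 _*_
infix  8 -_
infixr 8 _^_

_≤_ _<_ _≈_ : Rel ℝ 0ℓ
x ≤ y = ∀ ε → 0ℚ ℚ.< ε → ∃[ N ] ∀ n → N ℕ.≤ n → seq x n ℚ.≤ seq y n ℚ.+ ε
x < y = ∃[ ε ] 0ℚ ℚ.< ε × ∃[ N ] ∀ n → N ℕ.≤ n → seq x n ℚ.+ ε ℚ.≤ seq y n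
x ≈ y = x ≤ y × y ≤ x

fromℚ : ℚ → ℝ
fromℚ q = mkℝ (λ _ → q) λ ε 0<ε → 0 , λ _ _ _ _ →
  subst (ℚ._≤ ε) (sym (cong ℚ.∣_∣ (ℚ.+-inverseʳ q))) (ℚ.<⇒≤ 0<ε)

0ℝ 1ℝ : ℝ
0ℝ = fromℚ 0ℚ
1ℝ = fromℚ 1ℚ

private
  ½-pos : ∀ {ε} → 0ℚ ℚ.< ε → 0ℚ ℚ.< ½ ℚ.* ε
  ½-pos {ε} 0<ε = subst (ℚ._< ½ ℚ.* ε) (ℚ.*-zeroʳ ½) (ℚ.*-monoʳ-<-pos ½ 0<ε)

  ½+½ : ∀ ε → ½ ℚ.* ε ℚ.+ ½ ℚ.* ε ≡ ε
  ½+½ ε = trans (sym (ℚ.*-distribʳ-+ ε ½ ½)) (ℚ.*-identityˡ ε)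

  +-rearrange : ∀ a b c d →
    (a ℚ.+ b) ℚ.- (c ℚ.+ d) ≡ (a ℚ.- c) ℚ.+ (b ℚ.- d)
  +-rearrange = solve 4 (λ a b c d →
    (a :+ b) :- (c :+ d) := (a :- c) :+ (b :- d)) refl
    where open ℚ.+-*-Solver

  *-rearrange : ∀ a b c d →
    (a ℚ.* b) ℚ.- (c ℚ.* d) ≡ a ℚ.* (b ℚ.- d) ℚ.+ (a ℚ.- c) ℚ.* d
  *-rearrange = solve 4 (λ a b c d →
    (a :* b) :- (c :* d) := a :* (b :- d) :+ (a :- c) :* d) refl
    where open ℚ.+-*-Solver

  neg-rearrange : ∀ a b → (ℚ.- a) ℚ.- (ℚ.- b) ≡ ℚ.- (a ℚ.- b)
  neg-rearrange a b = sym (ℚ.neg-distrib-+ a (ℚ.- b))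

  cancel : ∀ a b → (a ℚ.- b) ℚ.+ b ≡ a
  cancel = solve 2 (λ a b → (a :- b) :+ b := a) refl
    where open ℚ.+-*-Solver

  open ℚ.≤-Reasoning

  ∣∣-bound : ∀ a b → ℚ.∣ a ∣ ℚ.≤ ℚ.∣ a ℚ.- b ∣ ℚ.+ ℚ.∣ b ∣
  ∣∣-bound a b = subst (λ c → ℚ.∣ c ∣ ℚ.≤ ℚ.∣ a ℚ.- b ∣ ℚ.+ ℚ.∣ b ∣) (cancel a b)
    (ℚ.∣p+q∣≤∣p∣+∣q∣ (a ℚ.- b) b)

  shift : ∀ a b c → a ℚ.≤ b ℚ.+ c → a ℚ.- c ℚ.≤ b
  shift a b c a≤b+c = begin
    a ℚ.- c           ≤⟨ ℚ.+-monoˡ-≤ (ℚ.- c) a≤b+c ⟩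
    (b ℚ.+ c) ℚ.- c   ≡⟨ solve 2 (λ b c → (b :+ c) :- c := b) refl b c ⟩
    b                 ∎
    where open ℚ.+-*-Solver

  ∣∣∣-∣∣∣≤ : ∀ a b → ℚ.∣ ℚ.∣ a ∣ ℚ.- ℚ.∣ b ∣ ∣ ℚ.≤ ℚ.∣ a ℚ.- b ∣
  ∣∣∣-∣∣∣≤ a b with ℚ.∣p∣≡p∨∣p∣≡-p (ℚ.∣ a ∣ ℚ.- ℚ.∣ b ∣)
  ... | inj₁ eq = subst (ℚ._≤ ℚ.∣ a ℚ.- b ∣) (sym eq)
                    (shift _ _ _ (∣∣-bound a b))
  ... | inj₂ eq = begin
    ℚ.∣ ℚ.∣ a ∣ ℚ.- ℚ.∣ b ∣ ∣    ≡⟨ eq ⟩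
    ℚ.- (ℚ.∣ a ∣ ℚ.- ℚ.∣ b ∣)    ≡⟨ swap ℚ.∣ a ∣ ℚ.∣ b ∣ ⟩
    ℚ.∣ b ∣ ℚ.- ℚ.∣ a ∣          ≤⟨ shift _ _ _ (∣∣-bound b a) ⟩
    ℚ.∣ b ℚ.- a ∣                ≡⟨ cong ℚ.∣_∣ (swap a b) ⟨
    ℚ.∣ ℚ.- (a ℚ.- b) ∣          ≡⟨ ℚ.∣-p∣≡∣p∣ (a ℚ.- b) ⟩
    ℚ.∣ a ℚ.- b ∣                ∎
    where
    open ℚ.+-*-Solver
    swap : ∀ a b → ℚ.- (a ℚ.- b) ≡ b ℚ.- a
    swap = solve 2 (λ a b → :- (a :- b) := b :- a) refl

  bounded : ∀ x → ∃[ K ] 0ℚ ℚ.< K × ∃[ N ] ∀ n → N ℕ.≤ n → ℚ.∣ seq x n ∣ ℚ.≤ K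
  bounded x with cauchy x 1ℚ (ℚ.positive⁻¹ 1ℚ)
  ... | N , close = 1ℚ ℚ.+ ℚ.∣ seq x N ∣ ,
    ℚ.+-mono-<-≤ (ℚ.positive⁻¹ 1ℚ) (ℚ.0≤∣p∣ (seq x N)) ,
    N , λ n N≤n → begin
      ℚ.∣ seq x n ∣                                     ≤⟨ ∣∣-bound (seq x n) (seq x N) ⟩
      ℚ.∣ seq x n ℚ.- seq x N ∣ ℚ.+ ℚ.∣ seq x N ∣       ≤⟨ ℚ.+-monoˡ-≤ _ (close n N N≤n ℕ.≤-refl) ⟩
      1ℚ ℚ.+ ℚ.∣ seq x N ∣                              ∎

  *-mono-≤ : ∀ {a b c d} → 0ℚ ℚ.≤ c → 0ℚ ℚ.≤ b → a ℚ.≤ b → c ℚ.≤ d → a ℚ.* c ℚ.≤ b ℚ.* d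
  *-mono-≤ {a} {b} {c} {d} 0≤c 0≤b a≤b c≤d = begin
    a ℚ.* c ≤⟨ ℚ.*-monoʳ-≤-nonNeg c {{ℚ.nonNegative 0≤c}} a≤b ⟩
    b ℚ.* c ≤⟨ ℚ.*-monoˡ-≤-nonNeg b {{ℚ.nonNegative 0≤b}} c≤d ⟩
    b ℚ.* d ∎

  -- the number δ = ε / K
  quot : ∀ K ε → 0ℚ ℚ.< K → 0ℚ ℚ.< ε → ∃[ δ ] 0ℚ ℚ.< δ × K ℚ.* δ ≡ ε
  quot K ε 0<K 0<ε = 1/K ℚ.* ε , 0<δ , K*δ≡ε
    where
    instance
      K⁺ : ℚ.Positive K
      K⁺ = ℚ.positive 0<K
      K≢0 : ℚ.NonZero K
      K≢0 = ℚ.pos⇒nonZero K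
    1/K : ℚ
    1/K = ℚ.1/ K
    instance
      1/K⁺ : ℚ.Positive 1/K
      1/K⁺ = ℚ.1/pos⇒pos K
    0<δ : 0ℚ ℚ.< 1/K ℚ.* ε
    0<δ = subst (ℚ._< 1/K ℚ.* ε) (ℚ.*-zeroʳ 1/K) (ℚ.*-monoʳ-<-pos 1/K 0<ε)
    K*δ≡ε : K ℚ.* (1/K ℚ.* ε) ≡ ε
    K*δ≡ε = trans (sym (ℚ.*-assoc K 1/K ε))
      (trans (cong (ℚ._* ε) (ℚ.*-inverseʳ K)) (ℚ.*-identityˡ ε))

_+_ : ℝ → ℝ → ℝ
x + y = mkℝ (λ n → seq x n ℚ.+ seq y n) λ ε 0<ε →
  let (M , cx) = cauchy x (½ ℚ.* ε) (½-pos 0<ε)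
      (N , cy) = cauchy y (½ ℚ.* ε) (½-pos 0<ε)
  in M ℕ.⊔ N , λ m n p q → begin
    ℚ.∣ (seq x m ℚ.+ seq y m) ℚ.- (seq x n ℚ.+ seq y n) ∣
      ≡⟨ cong ℚ.∣_∣ (+-rearrange (seq x m) (seq y m) (seq x n) (seq y n)) ⟩
    ℚ.∣ (seq x m ℚ.- seq x n) ℚ.+ (seq y m ℚ.- seq y n) ∣
      ≤⟨ ℚ.∣p+q∣≤∣p∣+∣q∣ (seq x m ℚ.- seq x n) (seq y m ℚ.- seq y n) ⟩
    ℚ.∣ seq x m ℚ.- seq x n ∣ ℚ.+ ℚ.∣ seq y m ℚ.- seq y n ∣
      ≤⟨ ℚ.+-mono-≤ (cx m n (ℕ.m⊔n≤o⇒m≤o M N p) (ℕ.m⊔n≤o⇒m≤o M N q))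
                    (cy m n (ℕ.m⊔n≤o⇒n≤o M N p) (ℕ.m⊔n≤o⇒n≤o M N q)) ⟩
    ½ ℚ.* ε ℚ.+ ½ ℚ.* ε
      ≡⟨ ½+½ ε ⟩
    ε ∎

-_ : ℝ → ℝ
- x = mkℝ (λ n → ℚ.- seq x n) λ ε 0<ε →
  let (N , cx) = cauchy x ε 0<ε
  in N , λ m n p q → begin
    ℚ.∣ (ℚ.- seq x m) ℚ.- (ℚ.- seq x n) ∣  ≡⟨ cong ℚ.∣_∣ (neg-rearrange (seq x m) (seq x n)) ⟩
    ℚ.∣ ℚ.- (seq x m ℚ.- seq x n) ∣        ≡⟨ ℚ.∣-p∣≡∣p∣ (seq x m ℚ.- seq x n) ⟩
    ℚ.∣ seq x m ℚ.- seq x n ∣              ≤⟨ cx m n p q ⟩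
    ε                                      ∎

_-_ : ℝ → ℝ → ℝ
x - y = x + (- y)

∣_∣ : ℝ → ℝ
∣ x ∣ = mkℝ (λ n → ℚ.∣ seq x n ∣) λ ε 0<ε →
  let (N , cx) = cauchy x ε 0<ε
  in N , λ m n p q → ℚ.≤-trans (∣∣∣-∣∣∣≤ (seq x m) (seq x n)) (cx m n p q)

_*_ : ℝ → ℝ → ℝ
x * y = mkℝ (λ n → seq x n ℚ.* seq y n) λ ε 0<ε →
  let (K , 0<K , M , bx) = bounded x
      (L , 0<L , N , by) = bounded y
      (δ , 0<δ , eq)     = quot (K ℚ.+ L) ε (ℚ.+-mono-< 0<K 0<L) 0<ε
      (P , cx)           = cauchy x δ 0<δ
      (Q , cy)           = cauchy y δ 0<δ
  in (M ℕ.⊔ N) ℕ.⊔ (P ℕ.⊔ Q) , λ m n p q →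
  let MN≤m = ℕ.m⊔n≤o⇒m≤o (M ℕ.⊔ N) (P ℕ.⊔ Q) p
      PQ≤m = ℕ.m⊔n≤o⇒n≤o (M ℕ.⊔ N) (P ℕ.⊔ Q) p
      MN≤n = ℕ.m⊔n≤o⇒m≤o (M ℕ.⊔ N) (P ℕ.⊔ Q) q
      PQ≤n = ℕ.m⊔n≤o⇒n≤o (M ℕ.⊔ N) (P ℕ.⊔ Q) q
      dx   = seq x m ℚ.- seq x n
      dy   = seq y m ℚ.- seq y n
  in begin
    ℚ.∣ (seq x m ℚ.* seq y m) ℚ.- (seq x n ℚ.* seq y n) ∣
      ≡⟨ cong ℚ.∣_∣ (*-rearrange (seq x m) (seq y m) (seq x n) (seq y n)) ⟩
    ℚ.∣ seq x m ℚ.* dy ℚ.+ dx ℚ.* seq y n ∣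
      ≤⟨ ℚ.∣p+q∣≤∣p∣+∣q∣ (seq x m ℚ.* dy) (dx ℚ.* seq y n) ⟩
    ℚ.∣ seq x m ℚ.* dy ∣ ℚ.+ ℚ.∣ dx ℚ.* seq y n ∣
      ≡⟨ cong₂ ℚ._+_ (ℚ.∣p*q∣≡∣p∣*∣q∣ (seq x m) dy) (ℚ.∣p*q∣≡∣p∣*∣q∣ dx (seq y n)) ⟩
    ℚ.∣ seq x m ∣ ℚ.* ℚ.∣ dy ∣ ℚ.+ ℚ.∣ dx ∣ ℚ.* ℚ.∣ seq y n ∣
      ≤⟨ ℚ.+-mono-≤
           (*-mono-≤ (ℚ.0≤∣p∣ dy) (ℚ.<⇒≤ 0<K) (bx m (ℕ.m⊔n≤o⇒m≤o M N MN≤m))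
             (cy m n (ℕ.m⊔n≤o⇒n≤o P Q PQ≤m) (ℕ.m⊔n≤o⇒n≤o P Q PQ≤n)))
           (*-mono-≤ (ℚ.0≤∣p∣ (seq y n)) (ℚ.<⇒≤ 0<δ)
             (cx m n (ℕ.m⊔n≤o⇒m≤o P Q PQ≤m) (ℕ.m⊔n≤o⇒m≤o P Q PQ≤n))
             (by n (ℕ.m⊔n≤o⇒n≤o M N MN≤n))) ⟩
    K ℚ.* δ ℚ.+ δ ℚ.* L
      ≡⟨ cong (K ℚ.* δ ℚ.+_) (ℚ.*-comm δ L) ⟩
    K ℚ.* δ ℚ.+ L ℚ.* δ
      ≡⟨ ℚ.*-distribʳ-+ δ K L ⟨
    (K ℚ.+ L) ℚ.* δ
      ≡⟨ eq ⟩
    ε ∎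

_^_ : ℝ → ℕ → ℝ
x ^ zero  = 1ℝ
x ^ suc n = x * x ^ n

half : ℝ → ℝ
half x = fromℚ ½ * x

∑ : ∀ {n} → (Fin n → ℝ) → ℝ
∑ = Vector.foldr _+_ 0ℝ

infix 4 _⟶_

_⟶_ : (ℕ → ℚ) → ℝ → Set
a ⟶ x = ∀ ε → 0ℚ ℚ.< ε → ∃[ N ] ∀ n → N ℕ.≤ n → ∣ fromℚ (a n) - x ∣ ≤ fromℚ ε

------------------------------------------------------------------------
-- Lebesgue measure on [0,1]

[0,1] : Pred ℝ 0ℓ
[0,1] x = 0ℝ ≤ x × x ≤ 1ℝ

-- The pair (a , b) stands for the open interval from a to b, empty if b ≤ a.
Interval : Set
Interval = ℚ × ℚ

_∈ᴵ_ : ℝ → Interval → Set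
x ∈ᴵ (a , b) = fromℚ a < x × x < fromℚ b

∣_∣ᴵ : Interval → ℚ
∣ a , b ∣ᴵ = 0ℚ ℚ.⊔ (b ℚ.- a)

totalLength : (ℕ → Interval) → ℕ → ℚ
totalLength J zero    = 0ℚ
totalLength J (suc k) = totalLength J k ℚ.+ ∣ J k ∣ᴵ

-- The Lebesgue outer measure λ*(S) is at most m.  The lengths of a cover are
-- required to have a sum ℓ, rather than just bounded partial sums: it is
-- constructively consistent that intervals with bounded partial sums below 1
-- cover [0,1].
OuterMeasure≤ : Pred ℝ 0ℓ → ℝ → Set
OuterMeasure≤ S m = ∀ ε → 0ℚ ℚ.< ε → ∃[ J ] ∃[ ℓ ]
  (∀ x → S x → ∃[ k ] x ∈ᴵ J k) ×
  totalLength J ⟶ ℓ × ℓ ≤ m + fromℚ ε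

-- For S ⊆ [0,1]: S is Lebesgue measurable with measure m.  This is Lebesgue's
-- criterion λ*(S) = m and λ*([0,1] ∖ S) = 1 - m; the two inequalities suffice
-- because λ*(S) + λ*([0,1] ∖ S) ≥ 1 always holds.
HasMeasure : Pred ℝ 0ℓ → ℝ → Set
HasMeasure S m =
  OuterMeasure≤ S m × OuterMeasure≤ (λ x → [0,1] x × x ∉ S) (1ℝ - m)

record Measurable (S : Pred ℝ 0ℓ) : Set where
  field
    ⊆[0,1]     : S ⊆ [0,1]
    respects   : S Respects _≈_
    measure    : ℝ
    hasMeasure : HasMeasure S measure

------------------------------------------------------------------------
-- Step functions on [0,1]² and the cut norm

-- The i-th interval of the partition of [0,1] into n intervals of equal
-- length: half-open, except that the last one contains 1.
cell : (n : ℕ) .{{_ : NonZero n}} → Fin n → Pred ℝ 0ℓ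
cell n i x = fromℚ (ℤ.+ toℕ i ℚ./ n) ≤ x ×
  (x < fromℚ (ℤ.+ suc (toℕ i) ℚ./ n) ⊎ (suc (toℕ i) ≡ n × x ≤ 1ℝ))

-- The function on [0,1]² with value  value i j  on cell rows i × cell cols j.
record StepFunction : Set where
  field
    rows cols        : ℕ
    .{{rows-nonZero}} : NonZero rows
    .{{cols-nonZero}} : NonZero cols
    value            : Fin rows → Fin cols → ℝ

_-const_ : StepFunction → ℝ → StepFunction
W -const q = record { value = λ i j → value i j - q }
  where open StepFunction W

-- v is the integral of U over S × T, i.e. the sum of
-- value i j · λ(S ∩ Iᵢ) · λ(T ∩ Jⱼ) over all cells Iᵢ and Jⱼ.
IsIntegral : StepFunction → (S T : Pred ℝ 0ℓ) → ℝ → Set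
IsIntegral U S T v =
  ∃ λ (s : Fin rows → ℝ) → ∃ λ (t : Fin cols → ℝ) →
  (∀ i → HasMeasure (S ∩ cell rows i) (s i)) ×
  (∀ j → HasMeasure (T ∩ cell cols j) (t j)) ×
  v ≈ ∑ λ i → ∑ λ j → value i j * (s i * t j)
  where open StepFunction U

-- ‖ U ‖□ ≤ c: the supremum is bounded by c, i.e. c is an upper bound.
CutNorm≤ : StepFunction → ℝ → Set₁
CutNorm≤ U c = ∀ {S T} → Measurable S → Measurable T →
  ∀ {v} → IsIntegral U S T v → ∣ v ∣ ≤ c

Quasirandom : ℝ → (ℕ → StepFunction) → Set₁
Quasirandom q W = ∀ ε → 0ℚ ℚ.< ε → ∃[ N ] ∀ n → N ℕ.≤ n →
  CutNorm≤ (W n -const q) (fromℚ ε)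

------------------------------------------------------------------------
-- Counting

private
  ∈⇒nonZero : ∀ {A : Set} {x : A} {xs} → x ∈ xs → NonZero (length xs)
  ∈⇒nonZero {xs = _ ∷ _} _ = _

-- The number of f : Fin m → Fin n satisfying P.
#maps : ∀ {m n} {P : (Fin m → Fin n) → Set} → (∀ f → Dec (P f)) → ℕ
#maps {m} {n} P? = length (filter (λ k → P? (finToFun k)) (allFin (n ℕ.^ m)))

#pairs : ∀ {n} {P : Fin n × Fin n → Set} → (∀ e → Dec (P e)) → ℕ
#pairs {n} P? = length (filter P? (cartesianProduct (allFin n) (allFin n)))

Relation : ℕ → Set
Relation n = Fin n → Fin n → Bool

IsHom : ∀ {m n} → Relation m → Relation n → (Fin m → Fin n) → Set
IsHom R S f = ∀ x y → T (R x y) → T (S (f x) (f y))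

isHom? : ∀ {m n} (R : Relation m) (S : Relation n) f → Dec (IsHom R S f)
isHom? R S f = Fin.all? λ x → Fin.all? λ y → T? (R x y) →-dec T? (S (f x) (f y))

------------------------------------------------------------------------
-- Oriented graphs

record OrientedGraph : Set where
  field
    size         : ℕ
    .{{nonEmpty}} : NonZero size
    edge         : Relation size
    -- taking x = y excludes loops
    asymmetric   : ∀ x y → T (edge x y) → ¬ T (edge y x)

module _ (G : OrientedGraph) where
  open OrientedGraph G

  e⃗ : ℕ
  e⃗ = #pairs {size} λ (x , y) → T? (edge x y)

  directedGraphon : StepFunction
  directedGraphon = record
    { rows  = size
    ; cols  = size
    ; value = λ i j → if edge i j then 1ℝ else 0ℝ
    }

t : OrientedGraph → OrientedGraph → ℚ
t B G = ℤ.+ #maps (isHom? B.edge G.edge) ℚ./ (G.size ℕ.^ B.size)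
  where
  module B = OrientedGraph B
  module G = OrientedGraph G
  instance _ = ℕ.m^n≢0 G.size B.size

K⃗₂ : OrientedGraph
K⃗₂ = record { size = 2 ; edge = edge ; asymmetric = asymmetric }
  where
  edge : Relation 2
  edge zero (suc zero) = true
  edge _    _          = false

  asymmetric : ∀ x y → T (edge x y) → ¬ T (edge y x)
  asymmetric zero (suc zero) _ ()

------------------------------------------------------------------------
-- Bipartite graphs

record BipartiteGraph : Set where
  field
    size         : ℕ
    .{{nonEmpty}} : NonZero size
    adj          : Relation size
    symmetric    : ∀ x y → adj x y ≡ adj y x
    part         : Fin size → Fin 2
    crossing     : ∀ x y → T (adj x y) → part x ≢ part y

  vertices : Fin 2 → List (Fin size)
  vertices s = filter (λ v → part v Fin.≟ s) (allFin size)

  NonEmptyParts : Set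
  NonEmptyParts = ∀ s → ∃[ v ] part v ≡ s

  e : ℕ
  e = #pairs {size} λ (x , y) → (x Fin.<? y) ×-dec T? (adj x y)

module _ (H : BipartiteGraph) (ne : BipartiteGraph.NonEmptyParts H) where
  open BipartiteGraph H

  private
    vertices-nonZero : ∀ s → NonZero (length (vertices s))
    vertices-nonZero s = let (v , v∈s) = ne s in
      ∈⇒nonZero (∈-filter⁺ (λ v → part v Fin.≟ s) (∈-allFin v) v∈s)

  bipartiteGraphon : StepFunction
  bipartiteGraphon = record
    { rows         = length U₁
    ; cols         = length U₂
    ; rows-nonZero = vertices-nonZero zero
    ; cols-nonZero = vertices-nonZero (suc zero)
    ; value        = λ i j → if adj (lookup U₁ i) (lookup U₂ j) then 1ℝ else 0ℝ
    }
    where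
    U₁ = vertices zero
    U₂ = vertices (suc zero)

module _ (A H : BipartiteGraph) where
  private
    module A = BipartiteGraph A
    module H = BipartiteGraph H

  RespectsParts : (Fin A.size → Fin H.size) → Set
  RespectsParts f = ∀ v → H.part (f v) ≡ A.part v

  respectsParts? : ∀ f → Dec (RespectsParts f)
  respectsParts? f = Fin.all? λ v → H.part (f v) Fin.≟ A.part v

  #respectsParts-nonZero : H.NonEmptyParts → NonZero (#maps respectsParts?)
  #respectsParts-nonZero ne = ∈⇒nonZero
    (∈-filter⁺ (λ k → respectsParts? (finToFun k)) (∈-allFin (funToFin f))
      λ v → trans (cong H.part (Fin.finToFun-funToFin f v)) (proj₂ (ne (A.part v))))
    where
    f : Fin A.size → Fin H.size
    f v = proj₁ (ne (A.part v))

  t-bip : H.NonEmptyParts → ℚ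
  t-bip ne = ℤ.+ #maps (λ f → respectsParts? f ×-dec isHom? A.adj H.adj f)
             ℚ./ #maps respectsParts?
    where instance _ = #respectsParts-nonZero ne

Hom-K⃗₂ : (B : OrientedGraph) → (Fin (OrientedGraph.size B) → Fin 2) → Set
Hom-K⃗₂ B = IsHom (OrientedGraph.edge B) (OrientedGraph.edge K⃗₂)

underlying : (B : OrientedGraph) → ∃ (Hom-K⃗₂ B) → BipartiteGraph
underlying B (h , h-hom) = record
  { size      = size
  ; adj       = λ x y → edge x y ∨ edge y x
  ; symmetric = λ x y → ∨-comm (edge x y) (edge y x)
  ; part      = h
  ; crossing  = crossing
  }
  where
  open OrientedGraph B

  K⃗₂-loopless : ∀ a → ¬ T (OrientedGraph.edge K⃗₂ a a)
  K⃗₂-loopless zero       ()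
  K⃗₂-loopless (suc zero) ()

  crossing : ∀ x y → T (edge x y ∨ edge y x) → h x ≢ h y
  crossing x y xy hx≡hy with edge x y in p | edge y x in q
  ... | true  | _     = K⃗₂-loopless (h y)
    (subst (λ a → T (OrientedGraph.edge K⃗₂ a (h y))) hx≡hy
      (h-hom x y (subst T (sym p) _)))
  ... | false | true  = K⃗₂-loopless (h x)
    (subst (λ a → T (OrientedGraph.edge K⃗₂ a (h x))) (sym hx≡hy)
      (h-hom y x (subst T (sym q) _)))

K₂ : BipartiteGraph
K₂ = underlying K⃗₂ (id , λ _ _ → id)

------------------------------------------------------------------------
-- Forcing

DirectedForcing : OrientedGraph → Set₁
DirectedForcing B =
  ∀ p → 0ℝ ≤ p → p ≤ 1ℝ → (G : ℕ → OrientedGraph) →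
  (λ n → t K⃗₂ (G n)) ⟶ half p →
  (λ n → t B (G n)) ⟶ half p ^ e⃗ B →
  Quasirandom (half p) (λ n → directedGraphon (G n))

AsymmetricForcing : BipartiteGraph → Set₁
AsymmetricForcing A =
  ∀ p → 0ℝ ≤ p → p ≤ 1ℝ →
  (H : ℕ → BipartiteGraph) (ne : ∀ n → BipartiteGraph.NonEmptyParts (H n)) →
  (λ n → t-bip K₂ (H n) (ne n)) ⟶ p →
  (λ n → t-bip A (H n) (ne n)) ⟶ p ^ BipartiteGraph.e A →
  Quasirandom p (λ n → bipartiteGraphon (H n) (ne n))

-- Given G, the bipartite double cover of G (two copies of V(G), with x in the
-- first joined to y in the second if (x,y) is an edge) has the same densities
-- as G and the same graphon, so asymmetric forcing implies directed forcing.
--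
-- Conversely, given H with parts U₁ and U₂ and a quasirandom tournament T, let
-- ((u,w),a) → ((u′,w′),a′) in U₁ × U₂ × T if uw′ is an edge of H and a → a′ in
-- T.  Then t(B,G) = t-bip(B̄,H) t(B,T) with t(B,T) close to 2^-e(B), and p/2-
-- quasirandomness of G, tested on sets depending only on u and only on w′,
-- gives p-quasirandomness of H.  For T take the vertices (a,φ) with a < M and
-- φ a vector of M bits; the edge between positions a < b is oriented by the
-- bit a of the vertex at b.  A homomorphism from B that has distinct positions
-- constrains e(B) distinct bits, and positions coincide with probability
-- O(1/M).
--
-- The cut norm is compared with its discrete version, over unions of cells.
-- One direction needs that these unions have the expected measure, the other
-- that the intersection of a measurable set with a cell of length w has
-- measure O(w), which follows from a constructive Heine–Borel argument, and
-- that a bilinear form with bounded weights is controlled by weights in {0,1}.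
module Submission where

open import Algebra.Bundles using (CommutativeRing)
import Algebra.Properties.Semiring.Exp as Exp
import Algebra.Properties.Semiring.Sum as Sum
open import Data.Bool.Base using (Bool; true; false; T; _∧_; _∨_; not; if_then_else_)
import Data.Bool.ListAction as Bool
open import Data.Bool.Properties as Bool using (T?)
open import Data.Empty using (⊥)
open import Data.Fin.Base as Fin using (Fin; zero; suc; toℕ; _↑ˡ_; _↑ʳ_; combine; remQuot; finToFun; opposite)
import Data.Fin.Properties as Fin
import Data.Integer.Base as ℤ
import Data.Integer.Properties as ℤ
open import Data.List.Base as List using (List; []; _∷_)
open import Data.List.Membership.Propositional using (_∈_)
import Data.List.Membership.Propositional.Properties as ∈
import Data.List.Properties as List
open import Data.List.Relation.Unary.All as All using (All; []; _∷_)
import Data.List.Relation.Unary.All.Properties as All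
import Data.List.Relation.Unary.AllPairs as AllPairs
open import Data.List.Relation.Unary.Any as Any using (Any; here; there)
import Data.List.Relation.Unary.Any.Properties as Any
open import Data.List.Relation.Unary.Unique.Propositional using (Unique)
import Data.List.Relation.Unary.Unique.Propositional.Properties as Unique
open import Data.Nat.Base as ℕ using (ℕ; zero; suc; NonZero)
import Data.Nat.Properties as ℕ
open import Data.Product.Base using (∃; ∃-syntax; Σ; _×_; _,_; proj₁; proj₂; uncurry)
import Data.Product.Properties as Product
open import Data.Rational.Base as ℚ using (ℚ; 0ℚ; 1ℚ; ½; _≤_; _<_; _+_; _-_; _*_; -_; ∣_∣; _⊔_; _⊓_; _/_)
import Data.Rational.Properties as ℚ
import Data.Rational.Unnormalised.Base as ℚᵘ
import Data.Rational.Unnormalised.Properties as ℚᵘ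
open import Data.Sum.Base using (_⊎_; inj₁; inj₂; [_,_]′)
open import Data.Unit.Base using (tt)
import Data.Vec.Functional as Vector
import Data.Vec.Functional.Properties as Vector
open import Function.Base using (id; _∘_)
open import Function.Bundles using (_⇔_; mk⇔; module Equivalence)
open import Function.Definitions using (Injective)
open import Level using (0ℓ)
open import Relation.Binary.Definitions using (tri<; tri≈; tri>)
open import Relation.Binary.PropositionalEquality
open import Relation.Nullary.Decidable using (Dec; yes; no; does; dec⇒maybe; _×-dec_; does-⇔; dec-true; dec-false)
open import Relation.Nullary.Negation using (¬_; contradiction)
open import Relation.Unary using (Pred; _∩_; _⊆_; _∉_)
open import Tactic.RingSolver using (solve-∀)
open import Tactic.RingSolver.Core.AlmostCommutativeRing using (AlmostCommutativeRing; fromCommutativeRing)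
import Defs as Real
open import Defs hiding (module ℝ; _≤_; _<_; _≈_; _+_; _-_; _*_; -_; _^_; ∣_∣)
open Exp (CommutativeRing.semiring ℚ.+-*-commutativeRing) using (_^_)
open Sum (CommutativeRing.semiring ℚ.+-*-commutativeRing)
  using (sum; sum-cong-≗; ∑-distrib-+; ∑-comm; *-distribˡ-sum)

-- Rational inequalities and null sequences

-- An oriented graph has neither loops nor edges in both directions, so its edge density is at most
-- 1/2, while bipartite densities go up to 1; T restores asymmetry at the price of exactly this
-- factor. The product U₁ × U₂ makes two parts of possibly different sizes uniform images of a
-- single vertex set. Since every edge of B leaves the first part and enters the second, each vertex
-- of B is read through only one of the two coordinates, so the homomorphism counts are not
-- distorted. The coordinate in T is invisible to the test sets and averages out, hence T enters
-- only through t(B,T) and t(K⃗₂,T). An explicit T stands in for a random tournament so that t(B,T)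
-- can be evaluated edge by edge, each edge being decided by a fair bit of its own.
--
-- The order of the reals is undecidable, which shapes the analytic side. The real density is
-- replaced in the n-th graph by its n-th rational approximation, and choices are made only between
-- rationals or between overlapping alternatives. For the same reason the measure inside a cell of
-- width w is bounded by 2w rather than w, which is enough because the cut norm may lose a constant
-- factor.

ring : AlmostCommutativeRing 0ℓ 0ℓ
ring = fromCommutativeRing ℚ.+-*-commutativeRing λ x → dec⇒maybe (0ℚ ℚ.≟ x)

-- Linear inequalities reduce to ring identities by comparing differences.
≤-byDifference : ∀ {x y a b} → x ≤ y → y - x ≡ b - a → a ≤ b
≤-byDifference {x} {y} {a} {b} x≤y eq = begin
  a                ≡⟨ ring₁ x a ⟩
  x - x + a        ≤⟨ ℚ.+-monoˡ-≤ a (ℚ.+-monoˡ-≤ (- x) x≤y) ⟩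
  y - x + a        ≡⟨ cong (_+ a) eq ⟩
  b - a + a        ≡⟨ ring₂ b a ⟩
  b                ∎
  where
  open ℚ.≤-Reasoning
  ring₁ : ∀ x a → a ≡ x - x + a
  ring₁ = solve-∀ ring
  ring₂ : ∀ b a → b - a + a ≡ b
  ring₂ = solve-∀ ring

0≤⇒≤ : ∀ {a b} → 0ℚ ≤ b - a → a ≤ b
0≤⇒≤ {a} {b} p = ≤-byDifference p (lemma a b)
  where
  lemma : ∀ a b → b - a - 0ℚ ≡ b - a
  lemma = solve-∀ ring

≤⇒0≤ : ∀ {a b} → a ≤ b → 0ℚ ≤ b - a
≤⇒0≤ {a} {b} p = ≤-byDifference p (lemma a b)
  where
  lemma : ∀ a b → b - a ≡ b - a - 0ℚ
  lemma = solve-∀ ring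

0<1 : 0ℚ < 1ℚ
0<1 = ℚ.positive⁻¹ 1ℚ

0≤1 : 0ℚ ≤ 1ℚ
0≤1 = ℚ.<⇒≤ 0<1

*-nonNeg : ∀ {a b} → 0ℚ ≤ a → 0ℚ ≤ b → 0ℚ ≤ a * b
*-nonNeg {a} {b} 0≤a 0≤b = subst (_≤ a * b) (ℚ.*-zeroˡ b)
  (ℚ.*-monoʳ-≤-nonNeg b {{ℚ.nonNegative 0≤b}} 0≤a)

*-pos : ∀ {a b} → 0ℚ < a → 0ℚ < b → 0ℚ < a * b
*-pos {a} {b} 0<a 0<b = subst (_< a * b) (ℚ.*-zeroˡ b)
  (ℚ.*-monoˡ-<-pos b {{ℚ.positive 0<b}} 0<a)

+-nonNeg : ∀ {a b} → 0ℚ ≤ a → 0ℚ ≤ b → 0ℚ ≤ a + b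
+-nonNeg = ℚ.+-mono-≤ {0ℚ} {_} {0ℚ}

*-monoˡ : ∀ {a b} c → 0ℚ ≤ c → a ≤ b → c * a ≤ c * b
*-monoˡ c 0≤c = ℚ.*-monoˡ-≤-nonNeg c {{ℚ.nonNegative 0≤c}}

*-mono : ∀ {a b c d} → 0ℚ ≤ c → 0ℚ ≤ b → a ≤ b → c ≤ d → a * c ≤ b * d
*-mono {a} {b} {c} {d} 0≤c 0≤b a≤b c≤d = ℚ.≤-trans
  (ℚ.*-monoʳ-≤-nonNeg c {{ℚ.nonNegative 0≤c}} a≤b) (*-monoˡ b 0≤b c≤d)

½*-pos : ∀ {ε} → 0ℚ < ε → 0ℚ < ½ * ε
½*-pos = *-pos (ℚ.positive⁻¹ ½)

a≤∣a∣ : ∀ a → a ≤ ∣ a ∣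
a≤∣a∣ a with ℚ.≤-total 0ℚ a
... | inj₁ 0≤a = ℚ.≤-reflexive (sym (ℚ.0≤p⇒∣p∣≡p 0≤a))
... | inj₂ a≤0 = ℚ.≤-trans a≤0 (ℚ.0≤∣p∣ a)

-a≤∣a∣ : ∀ a → - a ≤ ∣ a ∣
-a≤∣a∣ a = subst (- a ≤_) (ℚ.∣-p∣≡∣p∣ a) (a≤∣a∣ (- a))

∣∣-≤ : ∀ {a c} → a ≤ c → - a ≤ c → ∣ a ∣ ≤ c
∣∣-≤ {a} p q with ℚ.∣p∣≡p∨∣p∣≡-p a
... | inj₁ eq = subst (_≤ _) (sym eq) p
... | inj₂ eq = subst (_≤ _) (sym eq) q

∣∣-triangle : ∀ a b c → ∣ a - c ∣ ≤ ∣ a - b ∣ + ∣ b - c ∣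
∣∣-triangle a b c = subst (λ d → ∣ d ∣ ≤ ∣ a - b ∣ + ∣ b - c ∣) (lemma a b c)
  (ℚ.∣p+q∣≤∣p∣+∣q∣ (a - b) (b - c))
  where
  lemma : ∀ a b c → a - b + (b - c) ≡ a - c
  lemma = solve-∀ ring

Ev : (ℕ → Set) → Set
Ev P = ∃[ N ] ∀ n → N ℕ.≤ n → P n

Ev-map : ∀ {P Q : ℕ → Set} → (∀ n → P n → Q n) → Ev P → Ev Q
Ev-map f (N , p) = N , λ n N≤n → f n (p n N≤n)

Ev-zip : ∀ {P Q R : ℕ → Set} → (∀ n → P n → Q n → R n) → Ev P → Ev Q → Ev R
Ev-zip f (M , p) (N , q) = M ℕ.⊔ N , λ n MN≤n →
  f n (p n (ℕ.m⊔n≤o⇒m≤o M N MN≤n)) (q n (ℕ.m⊔n≤o⇒n≤o M N MN≤n))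

Ev-∃ : ∀ {P : ℕ → Set} → Ev P → ∃ P
Ev-∃ (N , p) = N , p N ℕ.≤-refl

Null : (ℕ → ℚ) → Set
Null a = ∀ ε → 0ℚ < ε → Ev λ n → ∣ a n ∣ ≤ ε

Null-cong : ∀ {a b} → (∀ n → a n ≡ b n) → Null a → Null b
Null-cong eq α ε 0<ε = Ev-map (λ n → subst (λ c → ∣ c ∣ ≤ ε) (eq n)) (α ε 0<ε)

Null-≤ : ∀ {a b} → (∀ n → ∣ b n ∣ ≤ ∣ a n ∣) → Null a → Null b
Null-≤ b≤a α ε 0<ε = Ev-map (λ n → ℚ.≤-trans (b≤a n)) (α ε 0<ε)

½+½ : ∀ ε → ½ * ε + ½ * ε ≡ ε
½+½ = solve-∀ ring

Null-+ : ∀ {a b} → Null a → Null b → Null λ n → a n + b n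
Null-+ {a} {b} α β ε 0<ε = Ev-zip
  (λ n p q → ℚ.≤-trans (ℚ.∣p+q∣≤∣p∣+∣q∣ (a n) (b n))
    (ℚ.≤-trans (ℚ.+-mono-≤ p q) (ℚ.≤-reflexive (½+½ ε))))
  (α (½ * ε) (½*-pos 0<ε)) (β (½ * ε) (½*-pos 0<ε))

divideBy : ∀ K ε → 0ℚ < K → 0ℚ < ε → ∃[ δ ] 0ℚ < δ × K * δ ≡ ε
divideBy K ε 0<K 0<ε = ℚ.1/ K * ε , *-pos (ℚ.positive⁻¹ (ℚ.1/ K) {{ℚ.1/pos⇒pos K}}) 0<ε ,
  trans (sym (ℚ.*-assoc K (ℚ.1/ K) ε)) (trans (cong (_* ε) (ℚ.*-inverseʳ K)) (ℚ.*-identityˡ ε))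
  where
  instance
    K⁺ : ℚ.Positive K
    K⁺ = ℚ.positive 0<K
    K≢0 : ℚ.NonZero K
    K≢0 = ℚ.pos⇒nonZero K

Bounded : (ℕ → ℚ) → Set
Bounded a = ∃[ K ] 0ℚ < K × Ev λ n → ∣ a n ∣ ≤ K

Null-* : ∀ {a b} → Bounded b → Null a → Null λ n → b n * a n
Null-* {a} {b} (K , 0<K , β) α ε 0<ε =
  let δ , 0<δ , Kδ≡ε = divideBy K ε 0<K 0<ε in Ev-zip
  (λ n p q → ℚ.≤-trans (ℚ.≤-reflexive (ℚ.∣p*q∣≡∣p∣*∣q∣ (b n) (a n)))
    (ℚ.≤-trans (*-mono (ℚ.0≤∣p∣ (a n)) (ℚ.<⇒≤ 0<K) p q) (ℚ.≤-reflexive Kδ≡ε)))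
  β (α δ 0<δ)

constBounded : ∀ {a} K → 0ℚ < K → (∀ n → ∣ a n ∣ ≤ K) → Bounded a
constBounded K 0<K p = K , 0<K , 0 , λ n _ → p n

Null-scale : ∀ {a} K → Null a → Null λ n → K * a n
Null-scale K = Null-* (constBounded (∣ K ∣ + 1ℚ)
  (ℚ.+-mono-≤-< (ℚ.0≤∣p∣ K) 0<1)
  (λ _ → ≤-byDifference 0≤1 (lemma ∣ K ∣)))
  where
  lemma : ∀ k → 1ℚ - 0ℚ ≡ k + 1ℚ - k
  lemma = solve-∀ ring

cauchy-bounded : ∀ x → Bounded (seq x)
cauchy-bounded x with cauchy x 1ℚ 0<1
... | N , close = 1ℚ + ∣ seq x N ∣ , ℚ.+-mono-<-≤ 0<1 (ℚ.0≤∣p∣ (seq x N)) , N , λ n N≤n →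
  subst (_≤ 1ℚ + ∣ seq x N ∣) (cong ∣_∣ (lemma₁ (seq x n))) (ℚ.≤-trans
    (∣∣-triangle (seq x n) (seq x N) 0ℚ)
    (ℚ.+-mono-≤ (close n N N≤n ℕ.≤-refl) (ℚ.≤-reflexive (cong ∣_∣ (lemma₁ (seq x N))))))
  where
  lemma₁ : ∀ a → a - 0ℚ ≡ a
  lemma₁ = solve-∀ ring

-- The diagonal difference with `seq x n` replaces the real limit, so that limits become statements
-- about rationals. For given `n` some late `k` has `a n` within ε/3 of `seq x k`, up to a slack of
-- another ε/3, and `seq x k` is within ε/3 of `seq x n`.
⟶⇒Null : ∀ {a x} → a ⟶ x → Null λ n → a n - seq x n
⟶⇒Null {a} {x} a⟶x ε 0<ε =
  let δ    = (ℤ.+ 1 / 3) * ε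
      0<δ  = *-pos (ℚ.positive⁻¹ (ℤ.+ 1 / 3)) 0<ε
      M , cx = cauchy x δ 0<δ
  in Ev-zip
    (λ n M≤n close →
      let k , M≤k , p = Ev-∃ (Ev-zip {λ k → M ℕ.≤ k} (λ k → _,_) (M , λ _ → id) (close δ 0<δ))
      in ℚ.≤-trans (∣∣-triangle (a n) (seq x k) (seq x n))
           (ℚ.≤-trans (ℚ.+-mono-≤ p (cx k n M≤k M≤n)) (ℚ.≤-reflexive (lemma ε))))
    (M , λ _ → id) (a⟶x δ 0<δ)
  where
  lemma : ∀ ε → (ℤ.+ 1 / 3) * ε + (ℤ.+ 1 / 3) * ε + (ℤ.+ 1 / 3) * ε ≡ ε
  lemma = solve-∀ ring

Null⇒⟶ : ∀ {a x} → Null (λ n → a n - seq x n) → a ⟶ x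
Null⇒⟶ {a} {x} α ε 0<ε =
  let M , cx = cauchy x (½ * ε) (½*-pos 0<ε) in Ev-zip
  (λ n M≤n p ε′ 0<ε′ → M , λ k M≤k →
    ℚ.≤-trans (∣∣-triangle (a n) (seq x n) (seq x k))
      (ℚ.≤-trans (ℚ.+-mono-≤ p (cx n k M≤n M≤k)) (ℚ.≤-trans (ℚ.≤-reflexive (½+½ ε))
        (≤-byDifference (ℚ.<⇒≤ 0<ε′) (lemma ε ε′)))))
  (M , λ _ → id) (α (½ * ε) (½*-pos 0<ε))
  where
  lemma : ∀ ε ε′ → ε′ - 0ℚ ≡ ε + ε′ - ε
  lemma = solve-∀ ring

seq-^ : ∀ x e n → seq (x Real.^ e) n ≡ seq x n ^ e
seq-^ x zero    n = refl
seq-^ x (suc e) n = cong (seq x n *_) (seq-^ x e n)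

-- Otherwise ι n and 1/ι n would be normalised to their reduced fractions.
opaque
  ι : ℕ → ℚ
  ι n = ℤ.+ n / 1

  1/ι : ∀ n .{{_ : NonZero n}} → ℚ
  1/ι n = ℤ.+ 1 / n

  ι-0 : ι 0 ≡ 0ℚ
  ι-0 = refl

  ι-1 : ι 1 ≡ 1ℚ
  ι-1 = refl

  ι-suc : ∀ n → ι (suc n) ≡ 1ℚ + ι n
  ι-suc n = ℚ.toℚᵘ-injective (begin
    ℚ.toℚᵘ (ι (suc n))               ≈⟨ ℚ.toℚᵘ-fromℚᵘ (ℚᵘ.mkℚᵘ (ℤ.+ suc n) 0) ⟩
    ℚᵘ.mkℚᵘ (ℤ.+ suc n) 0            ≈⟨ ℚᵘ.*≡* (cong (λ k → (ℤ.1ℤ ℤ.+ k) ℤ.* ℤ.1ℤ) (sym (ℤ.*-identityʳ (ℤ.+ n))))  ⟩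
    ℚᵘ.1ℚᵘ ℚᵘ.+ ℚᵘ.mkℚᵘ (ℤ.+ n) 0    ≈⟨ ℚᵘ.+-congʳ ℚᵘ.1ℚᵘ (ℚ.toℚᵘ-fromℚᵘ (ℚᵘ.mkℚᵘ (ℤ.+ n) 0)) ⟨
    ℚᵘ.1ℚᵘ ℚᵘ.+ ℚ.toℚᵘ (ι n)         ≈⟨ ℚ.toℚᵘ-homo-+ 1ℚ (ι n) ⟨
    ℚ.toℚᵘ (1ℚ + ι n)                ∎)
    where open ℚᵘ.≃-Reasoning

  /-* : ∀ m n .{{_ : NonZero n}} → (ℤ.+ m / n) * ι n ≡ ι m
  /-* m n@(suc n-1) = ℚ.toℚᵘ-injective (begin
    ℚ.toℚᵘ ((ℤ.+ m / n) * ι n)                        ≈⟨ ℚ.toℚᵘ-homo-* (ℤ.+ m / n) (ι n) ⟩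
    ℚ.toℚᵘ (ℤ.+ m / n) ℚᵘ.* ℚ.toℚᵘ (ι n)              ≈⟨ ℚᵘ.*-cong (ℚ.toℚᵘ-fromℚᵘ (ℚᵘ.mkℚᵘ (ℤ.+ m) n-1))
                                                           (ℚ.toℚᵘ-fromℚᵘ (ℚᵘ.mkℚᵘ (ℤ.+ n) 0)) ⟩
    ℚᵘ.mkℚᵘ (ℤ.+ m) n-1 ℚᵘ.* ℚᵘ.mkℚᵘ (ℤ.+ n) 0        ≈⟨ ℚᵘ.*≡* (trans (ℤ.*-identityʳ _) (cong (λ k → ℤ.+ m ℤ.* ℤ.+ k) (sym (ℕ.*-identityʳ n)))) ⟩
    ℚᵘ.mkℚᵘ (ℤ.+ m) 0                                 ≈⟨ ℚ.toℚᵘ-fromℚᵘ (ℚᵘ.mkℚᵘ (ℤ.+ m) 0) ⟨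
    ℚ.toℚᵘ (ι m)                                      ∎)
    where open ℚᵘ.≃-Reasoning

  1/ι-* : ∀ n .{{_ : NonZero n}} → 1/ι n * ι n ≡ 1ℚ
  1/ι-* n = /-* 1 n

  1/ι-pos : ∀ n .{{_ : NonZero n}} → 0ℚ < 1/ι n
  1/ι-pos n = ℚ.positive⁻¹ (1/ι n) {{ℚ.normalize-pos 1 n}}

ι-+ : ∀ m n → ι (m ℕ.+ n) ≡ ι m + ι n
ι-+ zero    n = sym (trans (cong (_+ ι n) ι-0) (ℚ.+-identityˡ (ι n)))
ι-+ (suc m) n = begin
  ι (suc (m ℕ.+ n))    ≡⟨ ι-suc (m ℕ.+ n) ⟩
  1ℚ + ι (m ℕ.+ n)     ≡⟨ cong (1ℚ +_) (ι-+ m n) ⟩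
  1ℚ + (ι m + ι n)     ≡⟨ ℚ.+-assoc 1ℚ (ι m) (ι n) ⟨
  1ℚ + ι m + ι n       ≡⟨ cong (_+ ι n) (ι-suc m) ⟨
  ι (suc m) + ι n      ∎
  where open ≡-Reasoning

ι-* : ∀ m n → ι (m ℕ.* n) ≡ ι m * ι n
ι-* zero    n = trans ι-0 (sym (trans (cong (_* ι n) ι-0) (ℚ.*-zeroˡ (ι n))))
ι-* (suc m) n = begin
  ι (n ℕ.+ m ℕ.* n)        ≡⟨ ι-+ n (m ℕ.* n) ⟩
  ι n + ι (m ℕ.* n)        ≡⟨ cong (ι n +_) (ι-* m n) ⟩
  ι n + ι m * ι n          ≡⟨ lemma (ι n) (ι m) ⟩
  (1ℚ + ι m) * ι n         ≡⟨ cong (_* ι n) (ι-suc m) ⟨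
  ι (suc m) * ι n          ∎
  where
  open ≡-Reasoning
  lemma : ∀ n m → n + m * n ≡ (1ℚ + m) * n
  lemma = solve-∀ ring

ι-nonNeg : ∀ n → 0ℚ ≤ ι n
ι-nonNeg zero    = ℚ.≤-reflexive (sym ι-0)
ι-nonNeg (suc n) = subst (0ℚ ≤_) (sym (ι-suc n)) (+-nonNeg 0≤1 (ι-nonNeg n))

ι-pos : ∀ n .{{_ : NonZero n}} → 0ℚ < ι n
ι-pos (suc n) = subst (0ℚ <_) (sym (ι-suc n)) (ℚ.+-mono-<-≤ 0<1 (ι-nonNeg n))

ι-mono : ∀ {m n} → m ℕ.≤ n → ι m ≤ ι n
ι-mono {m} {n} m≤n = subst (λ k → ι m ≤ ι k) (ℕ.m+[n∸m]≡n m≤n)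
  (subst (ι m ≤_) (sym (ι-+ m (n ℕ.∸ m)))
    (≤-byDifference (ι-nonNeg (n ℕ.∸ m)) (lemma (ι m) (ι (n ℕ.∸ m)))))
  where
  lemma : ∀ m k → k - 0ℚ ≡ m + k - m
  lemma = solve-∀ ring

*-cancelʳ : ∀ {a b} c → 0ℚ < c → a * c ≡ b * c → a ≡ b
*-cancelʳ {a} {b} c 0<c eq = ℚ.≤-antisym
  (ℚ.*-cancelʳ-≤-pos c (ℚ.≤-reflexive eq)) (ℚ.*-cancelʳ-≤-pos c (ℚ.≤-reflexive (sym eq)))
  where instance _ = ℚ.positive 0<c

*-cancelʳ-≤ : ∀ {a b} c → 0ℚ < c → a * c ≤ b * c → a ≤ b
*-cancelʳ-≤ c 0<c = ℚ.*-cancelʳ-≤-pos c {{ℚ.positive 0<c}}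

/≡ : ∀ m n .{{_ : NonZero n}} → ℤ.+ m / n ≡ ι m * 1/ι n
/≡ m n = *-cancelʳ (ι n) (ι-pos n) (begin
  (ℤ.+ m / n) * ι n       ≡⟨ /-* m n ⟩
  ι m                     ≡⟨ ℚ.*-identityʳ (ι m) ⟨
  ι m * 1ℚ                ≡⟨ cong (ι m *_) (1/ι-* n) ⟨
  ι m * (1/ι n * ι n)     ≡⟨ ℚ.*-assoc (ι m) (1/ι n) (ι n) ⟨
  ι m * 1/ι n * ι n       ∎)
  where open ≡-Reasoning

-- The denominator of ε is the witness, because a positive fraction has numerator at least 1. The
-- field `d` stores the denominator minus one, whence `suc n`.
archimedean : ∀ ε → 0ℚ < ε → ∃[ n ] 1ℚ ≤ ε * ι (suc n)
archimedean ε 0<ε with ε | ℚ.positive 0<ε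
... | ε@(ℚ.mkℚ (ℤ.+ suc p) d _) | _ = d ,
  subst₂ _≤_ ι-1 (trans (sym (/-* (suc p) (suc d))) (cong (_* ι (suc d)) (ℚ.↥p/↧p≡p ε)))
    (ι-mono (ℕ.s≤s ℕ.z≤n))

1/ι-Null : Null λ n → 1/ι (suc n)
1/ι-Null ε 0<ε = let d , p = archimedean ε 0<ε in d , λ n d≤n →
  subst (_≤ ε) (sym (ℚ.0≤p⇒∣p∣≡p (ℚ.<⇒≤ (1/ι-pos (suc n)))))
    (*-cancelʳ-≤ (ι (suc n)) (ι-pos (suc n))
      (ℚ.≤-trans (ℚ.≤-reflexive (1/ι-* (suc n)))
        (ℚ.≤-trans p (*-monoˡ ε (ℚ.<⇒≤ 0<ε) (ι-mono (ℕ.s≤s d≤n))))))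

½^-pos : ∀ n → 0ℚ < ½ ^ n
½^-pos zero    = 0<1
½^-pos (suc n) = ½*-pos (½^-pos n)

½^-bound : ∀ n → ½ ^ n * ι (suc n) ≤ 1ℚ
½^-bound zero    = ℚ.≤-reflexive (trans (ℚ.*-identityˡ (ι 1)) ι-1)
½^-bound (suc n) = begin
  ½ * ½ ^ n * ι (suc (suc n))                ≡⟨ cong (½ * ½ ^ n *_) (ι-suc (suc n)) ⟩
  ½ * ½ ^ n * (1ℚ + ι (suc n))               ≤⟨ *-monoˡ (½ * ½ ^ n) (ℚ.<⇒≤ (½^-pos (suc n)))
                                                  (ℚ.+-monoˡ-≤ (ι (suc n)) (subst (_≤ ι (suc n)) ι-1 (ι-mono (ℕ.s≤s ℕ.z≤n)))) ⟩
  ½ * ½ ^ n * (ι (suc n) + ι (suc n))        ≡⟨ lemma (½ ^ n) (ι (suc n)) ⟩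
  ½ ^ n * ι (suc n)                          ≤⟨ ½^-bound n ⟩
  1ℚ                                         ∎
  where
  open ℚ.≤-Reasoning
  lemma : ∀ h i → ½ * h * (i + i) ≡ h * i
  lemma = solve-∀ ring

½^-Null : Null (½ ^_)
½^-Null = Null-≤ (λ n → subst₂ _≤_
  (sym (ℚ.0≤p⇒∣p∣≡p (ℚ.<⇒≤ (½^-pos n)))) (sym (ℚ.0≤p⇒∣p∣≡p (ℚ.<⇒≤ (1/ι-pos (suc n)))))
  (*-cancelʳ-≤ (ι (suc n)) (ι-pos (suc n))
    (ℚ.≤-trans (½^-bound n) (ℚ.≤-reflexive (sym (1/ι-* (suc n))))))) 1/ι-Null

-- Covers of [0,1]

-- portion J b - portion J a is the length of the part of J between a and b.
portion : Interval → ℚ → ℚ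
portion (c , d) x = 0ℚ ⊔ (d ⊓ x - c)

portion-mono : ∀ J {x y} → x ≤ y → portion J x ≤ portion J y
portion-mono (c , d) x≤y = ℚ.⊔-monoʳ-≤ 0ℚ (ℚ.+-monoˡ-≤ (- c) (ℚ.⊓-monoʳ-≤ d x≤y))

portion-nonNeg : ∀ J x → 0ℚ ≤ portion J x
portion-nonNeg (c , d) x = ℚ.p≤p⊔q 0ℚ (d ⊓ x - c)

portion≤length : ∀ J x → portion J x ≤ ∣ J ∣ᴵ
portion≤length (c , d) x = ℚ.⊔-monoʳ-≤ 0ℚ (ℚ.+-monoˡ-≤ (- c) (ℚ.p⊓q≤p d x))

portion-inside : ∀ {c d x} → c ≤ x → x ≤ d → portion (c , d) x ≡ x - c
portion-inside {c} {d} {x} c≤x x≤d =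
  trans (cong (λ y → 0ℚ ⊔ (y - c)) (ℚ.p≥q⇒p⊓q≡q x≤d)) (ℚ.p≤q⇒p⊔q≡q (≤⇒0≤ c≤x))

length-nonNeg : ∀ J → 0ℚ ≤ ∣ J ∣ᴵ
length-nonNeg (c , d) = ℚ.p≤p⊔q 0ℚ (d - c)

SmallTails : (ℕ → Interval) → Set
SmallTails J = ∀ ε → 0ℚ < ε → ∃[ N ] ∀ n → N ℕ.≤ n → totalLength J n - totalLength J N ≤ ε

module Uncovered (J : ℕ → Interval) where

  -- A primitive of 1 minus the sum of the indicators of the first `n` intervals. Overlaps are
  -- subtracted repeatedly, so gaps may be negative, but gaps over adjacent intervals add up, which
  -- is what the bisection needs.
  free : ℕ → ℚ → ℚ
  free zero    x = x
  free (suc n) x = free n x - portion (J n) x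

  -- The length of [a,b] minus the lengths of its intersections with the first
  -- n intervals.
  gap : ℕ → ℚ → ℚ → ℚ
  gap n a b = free n b - free n a

  private
    L = totalLength J

    induct : (R : ℕ → ℕ → Set) → (∀ n → R n n) →
             (∀ m n → R m n → R m (suc n)) → ∀ {m n} → m ℕ.≤ n → R m n
    induct R r s {m} {n} m≤n = go n (ℕ.≤⇒≤′ m≤n)
      where
      go : ∀ n → m ℕ.≤′ n → R m n
      go n       (ℕ.≤′-reflexive refl) = r n
      go (suc n) (ℕ.≤′-step m≤n)       = s m n (go n m≤n)

  gap-antitone : ∀ {a b} → a ≤ b → ∀ {m n} → m ℕ.≤ n → gap n a b ≤ gap m a b
  gap-antitone {a} {b} a≤b = induct (λ m n → gap n a b ≤ gap m a b) (λ _ → ℚ.≤-refl)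
    λ m n → ℚ.≤-trans (≤-byDifference (portion-mono (J n) a≤b)
      (lemma (free n b) (free n a) (portion (J n) b) (portion (J n) a)))
    where
    lemma : ∀ f f′ o o′ → o - o′ ≡ (f - f′) - ((f - o) - (f′ - o′))
    lemma = solve-∀ ring

  gap-tail : ∀ a b {m n} → m ℕ.≤ n → gap m a b ≤ gap n a b + (L n - L m)
  gap-tail a b = induct (λ m n → gap m a b ≤ gap n a b + (L n - L m))
    (λ n → ≤-byDifference (ℚ.≤-refl {0ℚ}) (lemma₁ (gap n a b) (L n)))
    λ m n p → ℚ.≤-trans p (≤-byDifference
      (ℚ.+-mono-≤ (portion≤length (J n) b) (portion-nonNeg (J n) a))
      (lemma₂ (free n b) (free n a) (portion (J n) b) (portion (J n) a) (L n) (L m) ∣ J n ∣ᴵ))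
    where
    lemma₁ : ∀ g l → 0ℚ - 0ℚ ≡ g + (l - l) - g
    lemma₁ = solve-∀ ring
    lemma₂ : ∀ f f′ o o′ l l′ j →
      (j + o′) - (o + 0ℚ) ≡ (f - o - (f′ - o′) + (l + j - l′)) - (f - f′ + (l - l′))
    lemma₂ = solve-∀ ring

  -- The interval `J k` alone already removes all of `b - a`, and the earlier ones can only have
  -- lowered the gap before.
  gap-inside : ∀ {a b} → a ≤ b → ∀ {k} → proj₁ (J k) ≤ a → b ≤ proj₂ (J k) → gap (suc k) a b ≤ 0ℚ
  gap-inside {a} {b} a≤b {k} c≤a b≤d = ≤-byDifference (gap-antitone a≤b {0} {k} ℕ.z≤n)
    (trans (lemma (free k b) (free k a) b a (proj₁ (J k)))
      (cong₂ (λ o o′ → 0ℚ - (free k b - o - (free k a - o′)))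
        (sym (portion-inside (ℚ.≤-trans c≤a a≤b) b≤d))
        (sym (portion-inside c≤a (ℚ.≤-trans a≤b b≤d)))))
    where
    lemma : ∀ f f′ b a c → (b - a) - (f - f′) ≡ 0ℚ - (f - (b - c) - (f′ - (a - c)))
    lemma = solve-∀ ring

  module _ (tail : SmallTails J) where

    -- The invariant of the bisection. The margin δ is uniform in `n`, so it survives every finite
    -- part of the cover.
    record Stage : Set where
      field
        a b δ : ℚ
        0<δ   : 0ℚ < δ
        δ≤gap : ∀ n → δ ≤ gap n a b

      a≤b : a ≤ b
      a≤b = 0≤⇒≤ (ℚ.≤-trans (ℚ.<⇒≤ 0<δ) (δ≤gap 0))

    open Stage

    private
      a≤mid : ∀ {a b} → a ≤ b → a ≤ ½ * (a + b)
      a≤mid {a} {b} a≤b = ≤-byDifference (*-monoˡ ½ (ℚ.<⇒≤ (ℚ.positive⁻¹ ½)) a≤b) (lemma a b)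
        where
        lemma : ∀ a b → ½ * b - ½ * a ≡ ½ * (a + b) - a
        lemma = solve-∀ ring

      mid≤b : ∀ {a b} → a ≤ b → ½ * (a + b) ≤ b
      mid≤b {a} {b} a≤b = ≤-byDifference (*-monoˡ ½ (ℚ.<⇒≤ (ℚ.positive⁻¹ ½)) a≤b) (lemma a b)
        where
        lemma : ∀ a b → ½ * b - ½ * a ≡ b - ½ * (a + b)
        lemma = solve-∀ ring

    -- Up to time `N` the bound holds because gaps decrease; beyond `N` at most δ/4 is lost, and δ/2
    -- - δ/4 = δ/4 remains.
    refine : ∀ {δ} → 0ℚ < δ → ∀ {a b} → a ≤ b → ∀ N → (∀ n → N ℕ.≤ n → L n - L N ≤ ½ * (½ * δ)) →
             ½ * δ ≤ gap N a b → ∀ n → ½ * (½ * δ) ≤ gap n a b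
    refine {δ} 0<δ {a} {b} a≤b N short p n with ℕ.≤-total n N
    ... | inj₁ n≤N = ℚ.≤-trans (≤-byDifference (ℚ.<⇒≤ (½*-pos (½*-pos 0<δ))) (lemma δ))
            (ℚ.≤-trans p (gap-antitone a≤b n≤N))
      where
      lemma : ∀ δ → ½ * (½ * δ) - 0ℚ ≡ ½ * δ - ½ * (½ * δ)
      lemma = solve-∀ ring
    ... | inj₂ N≤n = ≤-byDifference
            (ℚ.+-mono-≤ (ℚ.+-mono-≤ p (gap-tail a b N≤n)) (short n N≤n))
            (lemma δ (gap N a b) (gap n a b) (L n - L N))
      where
      lemma : ∀ δ g g′ l → g + (g′ + l) + ½ * (½ * δ) - (½ * δ + g + l) ≡ g′ - ½ * (½ * δ)
      lemma = solve-∀ ring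

    -- One of the two halves retains half of the uncovered length at a time N
    -- after which at most a quarter of it can still be covered.
    bisect : (s : Stage) → Σ Stage λ s′ → a s ≤ a s′ × b s′ ≤ b s × b s′ - a s′ ≡ ½ * (b s - a s)
    bisect s with tail (½ * (½ * δ s)) (½*-pos (½*-pos (0<δ s)))
    -- Looking only at time `N` makes the choice of a half a comparison of two rationals. The gap
    -- over all times would be a real number, which cannot be compared.
    ... | N , short with ℚ.≤-total (½ * δ s) (gap N (a s) (½ * (a s + b s)))
    ...   | inj₁ p = record
              { a = a s ; b = ½ * (a s + b s) ; δ = ½ * (½ * δ s) ; 0<δ = ½*-pos (½*-pos (0<δ s))
              ; δ≤gap = refine (0<δ s) (a≤mid (a≤b s)) N short p
              } , ℚ.≤-refl , mid≤b (a≤b s) , lemma (a s) (b s)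
      where
      lemma : ∀ a b → ½ * (a + b) - a ≡ ½ * (b - a)
      lemma = solve-∀ ring
    ...   | inj₂ p = record
              { a = ½ * (a s + b s) ; b = b s ; δ = ½ * (½ * δ s) ; 0<δ = ½*-pos (½*-pos (0<δ s))
              ; δ≤gap = refine (0<δ s) (mid≤b (a≤b s)) N short
                  (≤-byDifference (ℚ.+-mono-≤ (δ≤gap s N) p)
                    (lemma′ (δ s) (free N (b s)) (free N (a s)) (free N (½ * (a s + b s)))))
              } , a≤mid (a≤b s) , ℚ.≤-refl , lemma (a s) (b s)
      where
      lemma : ∀ a b → b - ½ * (a + b) ≡ ½ * (b - a)
      lemma = solve-∀ ring
      lemma′ : ∀ δ b a m → (b - a + ½ * δ) - (δ + (m - a)) ≡ (b - m) - ½ * δ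
      lemma′ = solve-∀ ring

    module Limit (start : Stage) (width : b start - a start ≡ 1ℚ) where

      stage : ℕ → Stage
      stage zero    = start
      stage (suc n) = proj₁ (bisect (stage n))

      a-mono : ∀ {m n} → m ℕ.≤ n → a (stage m) ≤ a (stage n)
      a-mono = induct (λ m n → a (stage m) ≤ a (stage n)) (λ _ → ℚ.≤-refl)
        λ m n p → ℚ.≤-trans p (proj₁ (proj₂ (bisect (stage n))))

      b-antitone : ∀ {m n} → m ℕ.≤ n → b (stage n) ≤ b (stage m)
      b-antitone = induct (λ m n → b (stage n) ≤ b (stage m)) (λ _ → ℚ.≤-refl)
        λ m n p → ℚ.≤-trans (proj₁ (proj₂ (proj₂ (bisect (stage n))))) p

      stage-width : ∀ n → b (stage n) - a (stage n) ≡ ½ ^ n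
      stage-width zero    = width
      stage-width (suc n) = trans (proj₂ (proj₂ (proj₂ (bisect (stage n))))) (cong (½ *_) (stage-width n))

      within : ∀ {N m n} → N ℕ.≤ m → N ℕ.≤ n → a (stage m) - a (stage n) ≤ ½ ^ N
      within {N} {m} {n} N≤m N≤n = subst (a (stage m) - a (stage n) ≤_) (stage-width N)
        (ℚ.+-mono-≤ (ℚ.≤-trans (a≤b (stage m)) (b-antitone N≤m)) (ℚ.neg-antimono-≤ (a-mono N≤n)))

      limit : ℝ
      limit = mkℝ (λ n → a (stage n)) λ ε 0<ε →
        let N , small = ½^-Null ε 0<ε
            ½^N≤ε     = ℚ.≤-trans (a≤∣a∣ (½ ^ N)) (small N ℕ.≤-refl)
        in N , λ m n N≤m N≤n → ∣∣-≤ (ℚ.≤-trans (within N≤m N≤n) ½^N≤ε)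
          (subst (_≤ ε) (lemma (a (stage n)) (a (stage m))) (ℚ.≤-trans (within N≤n N≤m) ½^N≤ε))
        where
        lemma : ∀ x y → x - y ≡ - (y - x)
        lemma = solve-∀ ring

      -- Membership in the open interval `J k` comes with positive margins, so a sufficiently short
      -- stage lies inside `J k` as a whole. Its gap is then at most 0, against the invariant.
      limit-∉ : ∀ k → ¬ limit ∈ᴵ J k
      limit-∉ k ((ε , 0<ε , below) , (ε′ , 0<ε′ , above)) =
        let n , (c+ε≤a , a+ε′≤d) , ½^n≤ε′ = Ev-∃ (Ev-zip (λ _ → _,_) (Ev-zip (λ _ → _,_) below above)
                                      (½^-Null ε′ 0<ε′))
            s = stage n
            c≤a = ℚ.≤-trans (≤-byDifference (ℚ.<⇒≤ 0<ε) (lemma (proj₁ (J k)) ε)) c+ε≤a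
            b≤d = ≤-byDifference (ℚ.+-mono-≤ a+ε′≤d
                    (subst (_≤ ε′) (sym (stage-width n)) (ℚ.≤-trans (a≤∣a∣ (½ ^ n)) ½^n≤ε′)))
                    (lemma′ (a s) (b s) (proj₂ (J k)) ε′)
        in ℚ.<-irrefl refl (ℚ.<-≤-trans (0<δ s)
             (ℚ.≤-trans (δ≤gap s (suc k)) (gap-inside (a≤b s) {k} c≤a b≤d)))
        where
        lemma : ∀ c ε → ε - 0ℚ ≡ c + ε - c
        lemma = solve-∀ ring
        lemma′ : ∀ a b d ε → d + ε - (a + ε + (b - a)) ≡ d - b
        lemma′ = solve-∀ ring

-- This is where a cover is required to have a sum: convergence makes the partial sums Cauchy, which
-- bisection needs in order to know when to look.
totalLength-tail : ∀ J ℓ → totalLength J ⟶ ℓ → SmallTails J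
totalLength-tail J ℓ J⟶ℓ ε 0<ε =
  let δ       = (ℤ.+ 1 / 3) * ε
      0<δ     = *-pos (ℚ.positive⁻¹ (ℤ.+ 1 / 3)) 0<ε
      M , cx  = cauchy ℓ δ 0<δ
      N , lim = ⟶⇒Null {totalLength J} {ℓ} J⟶ℓ δ 0<δ
      K       = M ℕ.⊔ N
      N≤K     = ℕ.m≤n⊔m M N
  in K , λ n K≤n → ≤-byDifference
    (ℚ.+-mono-≤ (ℚ.+-mono-≤
      (ℚ.≤-trans (a≤∣a∣ _) (lim n (ℕ.≤-trans N≤K K≤n)))
      (ℚ.≤-trans (a≤∣a∣ _) (cx n K (ℕ.≤-trans (ℕ.m≤m⊔n M N) K≤n) (ℕ.m≤m⊔n M N))))
      (ℚ.≤-trans (-a≤∣a∣ _) (lim K N≤K)))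
    (lemma ε (totalLength J n) (seq ℓ n) (totalLength J K) (seq ℓ K))
  where
  lemma : ∀ ε t l t′ l′ → (ℤ.+ 1 / 3) * ε + (ℤ.+ 1 / 3) * ε + (ℤ.+ 1 / 3) * ε - ((t - l) + (l - l′) + (- (t′ - l′)))
        ≡ ε - (t - t′)
  lemma = solve-∀ ring

-- If the lengths added up to less than 1, the bisection would converge to a
-- point that no interval contains.
cover-length : ∀ J → SmallTails J → (∀ x → [0,1] x → ∃[ k ] x ∈ᴵ J k) →
               ∀ δ → 0ℚ < δ → ¬ (∀ n → totalLength J n ≤ 1ℚ - δ)
cover-length J tail covers δ 0<δ short = let k , x∈J = covers limit (0≤limit , limit≤1) in limit-∉ k x∈J
  where
  open Uncovered J

  start : Stage tail
  start = record
    { a = 0ℚ ; b = 1ℚ ; δ = δ ; 0<δ = 0<δ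
    ; δ≤gap = λ n → ≤-byDifference
        (ℚ.+-mono-≤ (gap-tail 0ℚ 1ℚ {0} {n} ℕ.z≤n) (short n))
        (lemma (gap n 0ℚ 1ℚ) (totalLength J n) δ)
    }
    where
    lemma : ∀ g l δ → g + (l - 0ℚ) + (1ℚ - δ) - (1ℚ - 0ℚ + l) ≡ g - δ
    lemma = solve-∀ ring

  open Limit tail start refl

  0≤limit : 0ℝ Real.≤ limit
  0≤limit ε 0<ε = 0 , λ n _ → ℚ.≤-trans (a-mono {0} {n} ℕ.z≤n)
    (≤-byDifference (ℚ.<⇒≤ 0<ε) (lemma (Stage.a (stage n)) ε))
    where
    lemma : ∀ a ε → ε - 0ℚ ≡ a + ε - a
    lemma = solve-∀ ring

  limit≤1 : limit Real.≤ 1ℝ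
  limit≤1 ε 0<ε = 0 , λ n _ → ℚ.≤-trans (Stage.a≤b (stage n)) (ℚ.≤-trans (b-antitone {0} {n} ℕ.z≤n)
    (≤-byDifference (ℚ.<⇒≤ 0<ε) (lemma ε)))
    where
    lemma : ∀ ε → ε - 0ℚ ≡ 1ℚ + ε - 1ℚ
    lemma = solve-∀ ring

-- Order on the real numbers

≤-transʳ : ∀ x y z → x Real.≤ y → y Real.≤ z → x Real.≤ z
≤-transʳ x y z p q ε 0<ε = Ev-zip
  (λ n p q → ≤-byDifference (ℚ.+-mono-≤ p q) (lemma (seq x n) (seq y n) (seq z n) ε))
  (p (½ * ε) (½*-pos 0<ε)) (q (½ * ε) (½*-pos 0<ε))
  where
  lemma : ∀ x y z ε → y + ½ * ε + (z + ½ * ε) - (x + y) ≡ z + ε - x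
  lemma = solve-∀ ring

<-≤-transʳ : ∀ x y z → x Real.< y → y Real.≤ z → x Real.< z
<-≤-transʳ x y z (ε , 0<ε , p) q = ½ * ε , ½*-pos 0<ε , Ev-zip
  (λ n p q → ≤-byDifference (ℚ.+-mono-≤ p q) (lemma (seq x n) (seq y n) (seq z n) ε))
  p (q (½ * ε) (½*-pos 0<ε))
  where
  lemma : ∀ x y z ε → y + (z + ½ * ε) - (x + ε + y) ≡ z - (x + ½ * ε)
  lemma = solve-∀ ring

≤-<-transʳ : ∀ x y z → x Real.≤ y → y Real.< z → x Real.< z
≤-<-transʳ x y z p (ε , 0<ε , q) = ½ * ε , ½*-pos 0<ε , Ev-zip
  (λ n p q → ≤-byDifference (ℚ.+-mono-≤ p q) (lemma (seq x n) (seq y n) (seq z n) ε))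
  (p (½ * ε) (½*-pos 0<ε)) q
  where
  lemma : ∀ x y z ε → y + ½ * ε + z - (x + (y + ε)) ≡ z - (x + ½ * ε)
  lemma = solve-∀ ring

<⇒≤ʳ : ∀ x y → x Real.< y → x Real.≤ y
<⇒≤ʳ x y (ε , 0<ε , p) ε′ 0<ε′ = Ev-map
  (λ n p → ≤-byDifference (ℚ.+-mono-≤ (ℚ.+-mono-≤ p (ℚ.<⇒≤ 0<ε)) (ℚ.<⇒≤ 0<ε′)) (lemma (seq x n) (seq y n) ε ε′)) p
  where
  lemma : ∀ x y ε ε′ → y + ε + ε′ - (x + ε + 0ℚ + 0ℚ) ≡ y + ε′ - x
  lemma = solve-∀ ring

fromℚ-cancel-< : ∀ a b → fromℚ a Real.< fromℚ b → a < b
fromℚ-cancel-< a b (ε , 0<ε , p) = ℚ.<-≤-trans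
  (subst (_< a + ε) (ℚ.+-identityʳ a) (ℚ.+-monoʳ-< a 0<ε)) (proj₂ (Ev-∃ p))

fromℚ-mono-≤ : ∀ a b → a ≤ b → fromℚ a Real.≤ fromℚ b
fromℚ-mono-≤ a b a≤b ε 0<ε = 0 , λ _ _ → ≤-byDifference (ℚ.+-mono-≤ a≤b (ℚ.<⇒≤ 0<ε)) (lemma a b ε)
  where
  lemma : ∀ a b ε → b + ε - (a + 0ℚ) ≡ b + ε - a
  lemma = solve-∀ ring

fromℚ-mono-< : ∀ a b → a < b → fromℚ a Real.< fromℚ b
fromℚ-mono-< a b a<b = b - a , 0<b-a , 0 , λ _ _ → ℚ.≤-reflexive (lemma a b)
  where
  lemma : ∀ a b → a + (b - a) ≡ b
  lemma = solve-∀ ring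
  0<b-a : 0ℚ < b - a
  0<b-a = subst (_< b - a) (ℚ.+-inverseʳ a) (ℚ.+-monoˡ-< (- a) a<b)

-- The constructive substitute for trichotomy: the two alternatives overlap on an interval of length
-- δ. An approximation of `x` within δ/4 is compared with the midpoint of that interval.
locate : ∀ x a δ → 0ℚ < δ → x Real.< fromℚ (a + δ) ⊎ fromℚ a Real.< x
locate x a δ 0<δ with cauchy x (½ * (½ * δ)) (½*-pos (½*-pos 0<δ))
... | N , close with ℚ.≤-total (seq x N) (a + ½ * δ)
...   | inj₁ p = inj₁ (½ * (½ * δ) , ½*-pos (½*-pos 0<δ) , N , λ n N≤n →
          ≤-byDifference (ℚ.+-mono-≤ p (ℚ.≤-trans (a≤∣a∣ _) (close n N N≤n ℕ.≤-refl)))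
            (lemma (seq x n) (seq x N) a δ))
  where
  lemma : ∀ x x′ a δ → a + ½ * δ + ½ * (½ * δ) - (x′ + (x - x′)) ≡ a + δ - (x + ½ * (½ * δ))
  lemma = solve-∀ ring
...   | inj₂ p = inj₂ (½ * (½ * δ) , ½*-pos (½*-pos 0<δ) , N , λ n N≤n →
          ≤-byDifference (ℚ.+-mono-≤ p (ℚ.≤-trans (a≤∣a∣ _) (close N n ℕ.≤-refl N≤n)))
            (lemma (seq x n) (seq x N) a δ))
  where
  lemma : ∀ x x′ a δ → x′ + ½ * (½ * δ) - (a + ½ * δ + (x′ - x)) ≡ x - (a + ½ * (½ * δ))
  lemma = solve-∀ ring

-- The partition of [0,1] into N cells

module Grid (N : ℕ) .{{_ : NonZero N}} where

  w : ℚ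
  w = 1/ι N

  0<w : 0ℚ < w
  0<w = 1/ι-pos N

  grid : ℕ → ℚ
  grid k = ι k * w

  grid-0 : grid 0 ≡ 0ℚ
  grid-0 = trans (cong (_* w) ι-0) (ℚ.*-zeroˡ w)

  grid-N : grid N ≡ 1ℚ
  grid-N = trans (ℚ.*-comm (ι N) w) (1/ι-* N)

  grid-suc : ∀ k → grid (suc k) ≡ grid k + w
  grid-suc k = trans (cong (_* w) (ι-suc k)) (lemma (ι k) w)
    where
    lemma : ∀ k w → (1ℚ + k) * w ≡ k * w + w
    lemma = solve-∀ ring

  grid-mono : ∀ {j k} → j ℕ.≤ k → grid j ≤ grid k
  grid-mono j≤k = *-mono (ℚ.<⇒≤ 0<w) (ι-nonNeg _) (ι-mono j≤k) ℚ.≤-refl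

  grid-cancel : ∀ {j k} → grid j < grid k → j ℕ.< k
  grid-cancel {j} {k} p with j ℕ.<? k
  ... | yes j<k = j<k
  ... | no  j≮k = contradiction (ℚ.<-≤-trans p (grid-mono (ℕ.≮⇒≥ j≮k))) (ℚ.<-irrefl refl)

  InCell : Fin N → ℝ → Set
  InCell i x = fromℚ (grid (toℕ i)) Real.≤ x ×
    (x Real.< fromℚ (grid (suc (toℕ i))) ⊎ (suc (toℕ i) ≡ N × x Real.≤ 1ℝ))

  cell⇒InCell : ∀ i x → cell N i x → InCell i x
  cell⇒InCell i x = subst₂ (λ a b → fromℚ a Real.≤ x × (x Real.< fromℚ b ⊎ (suc (toℕ i) ≡ N × x Real.≤ 1ℝ)))
    (/≡ (toℕ i) N) (/≡ (suc (toℕ i)) N)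

  InCell⇒cell : ∀ i x → InCell i x → cell N i x
  InCell⇒cell i x = subst₂ (λ a b → fromℚ a Real.≤ x × (x Real.< fromℚ b ⊎ (suc (toℕ i) ≡ N × x Real.≤ 1ℝ)))
    (sym (/≡ (toℕ i) N)) (sym (/≡ (suc (toℕ i)) N))

  -- The open cell. It cannot be decided whether a point is an endpoint of a cell, so sets are
  -- described on open cells and the endpoints are absorbed into short intervals.
  Inside : Fin N → ℝ → Set
  Inside i x = fromℚ (grid (toℕ i)) Real.< x × x Real.< fromℚ (grid (suc (toℕ i)))

  Inside⇒cell : ∀ i x → Inside i x → cell N i x
  Inside⇒cell i x (p , q) = InCell⇒cell i x (<⇒≤ʳ (fromℚ (grid (toℕ i))) x p , inj₁ q)

  Inside-unique : ∀ i j x → Inside i x → cell N j x → i ≡ j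
  Inside-unique i j x (i<x , x<1+i) x∈j = Fin.toℕ-injective (ℕ.≤-antisym
    (ℕ.≤-pred (grid-cancel {toℕ i} {suc (toℕ j)} (i<1+j (proj₂ (cell⇒InCell j x x∈j)))))
    (ℕ.≤-pred (grid-cancel {toℕ j} {suc (toℕ i)} (fromℚ-cancel-< (grid (toℕ j)) (grid (suc (toℕ i))) (≤-<-transʳ (fromℚ (grid (toℕ j))) x (fromℚ (grid (suc (toℕ i))))
      (proj₁ (cell⇒InCell j x x∈j)) x<1+i)))))
    where
    i<1+j : x Real.< fromℚ (grid (suc (toℕ j))) ⊎ (suc (toℕ j) ≡ N × x Real.≤ 1ℝ) →
            grid (toℕ i) < grid (suc (toℕ j))
    i<1+j (inj₁ x<1+j)       = fromℚ-cancel-< (grid (toℕ i)) (grid (suc (toℕ j)))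
      (<-≤-transʳ (fromℚ (grid (toℕ i))) x (fromℚ (grid (suc (toℕ j)))) i<x
        (<⇒≤ʳ x (fromℚ (grid (suc (toℕ j)))) x<1+j))
    i<1+j (inj₂ (eq , x≤1)) = subst (grid (toℕ i) <_) (sym (trans (cong grid eq) grid-N))
      (fromℚ-cancel-< (grid (toℕ i)) 1ℚ (<-≤-transʳ (fromℚ (grid (toℕ i))) x 1ℝ i<x x≤1))

  cell⊆[0,1] : ∀ i x → cell N i x → [0,1] x
  cell⊆[0,1] i x x∈i = ≤-transʳ 0ℝ (fromℚ (grid (toℕ i))) x
      (fromℚ-mono-≤ 0ℚ (grid (toℕ i)) (*-nonNeg (ι-nonNeg (toℕ i)) (ℚ.<⇒≤ 0<w))) (proj₁ (cell⇒InCell i x x∈i)) ,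
    x≤1 (proj₂ (cell⇒InCell i x x∈i))
    where
    x≤1 : x Real.< fromℚ (grid (suc (toℕ i))) ⊎ (suc (toℕ i) ≡ N × x Real.≤ 1ℝ) → x Real.≤ 1ℝ
    x≤1 (inj₁ x<1+i) = ≤-transʳ x (fromℚ (grid (suc (toℕ i)))) 1ℝ (<⇒≤ʳ x (fromℚ (grid (suc (toℕ i)))) x<1+i)
      (fromℚ-mono-≤ (grid (suc (toℕ i))) 1ℚ (subst (grid (suc (toℕ i)) ≤_) grid-N (grid-mono (Fin.toℕ<n i))))
    x≤1 (inj₂ (_ , p)) = p

  cell-respects : ∀ i x y → x Real.≈ y → cell N i x → cell N i y
  cell-respects i x y (x≤y , y≤x) (p , q) = ≤-transʳ (fromℚ (ℤ.+ toℕ i / N)) x y p x≤y , [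
    (λ x<b → inj₁ (≤-<-transʳ y x (fromℚ (ℤ.+ suc (toℕ i) / N)) y≤x x<b)) ,
    (λ (eq , x≤1) → inj₂ (eq , ≤-transʳ y x 1ℝ y≤x x≤1)) ]′ q

  near : ℚ → ℕ → Interval
  near δ j = grid j - δ , grid j + δ

  -- A sweep over the grid points from left to right: `x` is caught in the cell before a point or in
  -- its neighbourhood, or else the point is certified to lie to the left of `x`. At the last point,
  -- 1, this certificate contradicts x ≤ 1.
  locate-cell : ∀ δ → 0ℚ < δ → ∀ x → [0,1] x →
                (∃[ j ] j ℕ.≤ N × x ∈ᴵ near δ j) ⊎ ∃ λ i → Inside i x
  locate-cell δ 0<δ x (0≤x , x≤1) = [ id , (λ 1<x → contradiction
      (fromℚ-cancel-< (grid N) 1ℚ (<-≤-transʳ (fromℚ (grid N)) x 1ℝ 1<x x≤1))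
      (ℚ.<-irrefl grid-N)) ]′ (go N ℕ.≤-refl)
    where
    Found : Set
    Found = (∃[ j ] j ℕ.≤ N × x ∈ᴵ near δ j) ⊎ ∃ λ i → Inside i x

    a-δ<a : ∀ a → a - δ < a
    a-δ<a a = subst (a - δ <_) (ℚ.+-identityʳ a) (ℚ.+-monoʳ-< a (ℚ.neg-antimono-< 0<δ))

    boundary : ∀ j → j ℕ.≤ N → fromℚ (grid j - δ) Real.< x → Found ⊎ fromℚ (grid j) Real.< x
    boundary j j≤N p = [ (λ q → inj₁ (inj₁ (j , j≤N , p , q))) , inj₂ ]′ (locate x (grid j) δ 0<δ)

    go : ∀ k → k ℕ.≤ N → Found ⊎ fromℚ (grid k) Real.< x
    go zero    _   = boundary 0 ℕ.z≤n (<-≤-transʳ (fromℚ (grid 0 - δ)) 0ℝ x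
      (fromℚ-mono-< (grid 0 - δ) 0ℚ (subst (grid 0 - δ <_) grid-0 (a-δ<a (grid 0)))) 0≤x)
    go (suc k) k<N = [ inj₁ , (λ k<x → [
        (λ q → inj₁ (inj₂ (Fin.fromℕ< k<N ,
          subst (λ i → fromℚ (grid i) Real.< x × x Real.< fromℚ (grid (suc i))) (sym (Fin.toℕ-fromℕ< k<N))
            (k<x , subst (λ a → x Real.< fromℚ a) (lemma (grid (suc k)) δ) q)))) ,
        boundary (suc k) k<N ]′ (locate x (grid (suc k) - δ) δ 0<δ)) ]′ (go k (ℕ.<⇒≤ k<N))
      where
      lemma : ∀ a δ → a - δ + δ ≡ a
      lemma = solve-∀ ring

-- Finite covers and outer measure

infixr 5 _▸_

_▸_ : Interval → (ℕ → Interval) → ℕ → Interval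
(I ▸ J) zero    = I
(I ▸ J) (suc k) = J k

totalLength-▸ : ∀ I J n → totalLength (I ▸ J) (suc n) ≡ ∣ I ∣ᴵ + totalLength J n
totalLength-▸ I J zero    = ℚ.+-comm 0ℚ ∣ I ∣ᴵ
totalLength-▸ I J (suc n) = trans (cong (_+ ∣ J n ∣ᴵ) (totalLength-▸ I J n))
  (ℚ.+-assoc ∣ I ∣ᴵ (totalLength J n) ∣ J n ∣ᴵ)

SmallTails-▸ : ∀ I J → SmallTails J → SmallTails (I ▸ J)
SmallTails-▸ I J tail ε 0<ε with tail ε 0<ε
... | N , p = suc N , λ { (suc n) (ℕ.s≤s N≤n) → subst (_≤ ε)
    (trans (lemma ∣ I ∣ᴵ (totalLength J n) (totalLength J N))
      (sym (cong₂ _-_ (totalLength-▸ I J n) (totalLength-▸ I J N)))) (p n N≤n) }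
  where
  lemma : ∀ i l l′ → l - l′ ≡ i + l - (i + l′)
  lemma = solve-∀ ring

totalLength-mono : ∀ J n k → totalLength J n ≤ totalLength J (n ℕ.+ k)
totalLength-mono J n zero    = ℚ.≤-reflexive (cong (totalLength J) (sym (ℕ.+-identityʳ n)))
totalLength-mono J n (suc k) = subst (λ m → totalLength J n ≤ totalLength J m) (sym (ℕ.+-suc n k))
  (ℚ.≤-trans (totalLength-mono J n k) (≤-byDifference (length-nonNeg (J (n ℕ.+ k)))
    (lemma (totalLength J (n ℕ.+ k)) ∣ J (n ℕ.+ k) ∣ᴵ)))
  where
  lemma : ∀ l j → j - 0ℚ ≡ l + j - l
  lemma = solve-∀ ring

totalLength-nonNeg : ∀ J n → 0ℚ ≤ totalLength J n
totalLength-nonNeg J = totalLength-mono J 0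

extend : List Interval → ℕ → Interval
-- An empty interval of length 0 pads the list to a sequence.
extend []       _ = 0ℚ , 0ℚ
extend (J ∷ Js)   = J ▸ extend Js

listLength : List Interval → ℚ
listLength = List.foldr (λ J → ∣ J ∣ᴵ +_) 0ℚ

totalLength-extend : ∀ Js k → totalLength (extend Js) (List.length Js ℕ.+ k) ≡ listLength Js
totalLength-extend []       zero    = refl
totalLength-extend []       (suc k) = trans (ℚ.+-identityʳ _) (totalLength-extend [] k)
totalLength-extend (J ∷ Js) k       =
  trans (totalLength-▸ J (extend Js) (List.length Js ℕ.+ k)) (cong (∣ J ∣ᴵ +_) (totalLength-extend Js k))

extend-covers : ∀ x {Js} → Any (x ∈ᴵ_) Js → ∃[ k ] x ∈ᴵ extend Js k
extend-covers x (here p)  = 0 , p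
extend-covers x (there p) = let k , q = extend-covers x p in suc k , q

finiteCover⇒outerMeasure : ∀ {P m} →
  (∀ ε → 0ℚ < ε → ∃[ Js ] (∀ x → P x → Any (x ∈ᴵ_) Js) × listLength Js ≤ m + ε) →
  OuterMeasure≤ P (fromℚ m)
finiteCover⇒outerMeasure {P} {m} cover ε 0<ε with cover ε 0<ε
... | Js , covers , short = extend Js , fromℚ ℓ , (λ x Px → extend-covers x {Js} (covers x Px)) ,
  Null⇒⟶ {totalLength (extend Js)} {fromℚ ℓ} (λ ε 0<ε → List.length Js , λ n N≤n →
    subst (λ n → ∣ totalLength (extend Js) n - ℓ ∣ ≤ ε) (ℕ.m+[n∸m]≡n N≤n)
      (ℚ.≤-trans (ℚ.≤-reflexive (cong ∣_∣ (trans (cong (_- ℓ) (totalLength-extend Js (n ℕ.∸ List.length Js)))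
        (ℚ.+-inverseʳ ℓ)))) (ℚ.<⇒≤ 0<ε))) ,
  λ ε′ 0<ε′ → 0 , λ _ _ → ≤-byDifference (ℚ.+-mono-≤ short (ℚ.<⇒≤ 0<ε′)) (lemma ℓ (m + ε) ε′)
  where
  ℓ = listLength Js
  lemma : ∀ l m ε → m + ε - (l + 0ℚ) ≡ m + ε - l
  lemma = solve-∀ ring

outerMeasure-cong : ∀ P m m′ → (∀ n → seq m n ≡ seq m′ n) → OuterMeasure≤ P m → OuterMeasure≤ P m′
outerMeasure-cong P m m′ eq p ε 0<ε = let J , ℓ , covers , J⟶ℓ , ℓ≤ = p ε 0<ε in
  J , ℓ , covers , J⟶ℓ , λ ε′ 0<ε′ → Ev-map (λ n → subst (λ a → seq ℓ n ≤ a + ε + ε′) (eq n)) (ℓ≤ ε′ 0<ε′)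

hasMeasure-cong : ∀ P m m′ → (∀ n → seq m n ≡ seq m′ n) → HasMeasure P m → HasMeasure P m′
hasMeasure-cong P m m′ eq (outer , inner) = outerMeasure-cong P m m′ eq outer ,
  outerMeasure-cong (λ x → [0,1] x × x ∉ P) (1ℝ Real.- m) (1ℝ Real.- m′) (λ n → cong (λ a → 1ℚ - a) (eq n)) inner

listLength-++ : ∀ Is Js → listLength (Is List.++ Js) ≡ listLength Is + listLength Js
listLength-++ []       Js = sym (ℚ.+-identityˡ (listLength Js))
listLength-++ (I ∷ Is) Js = trans (cong (∣ I ∣ᴵ +_) (listLength-++ Is Js))
  (sym (ℚ.+-assoc ∣ I ∣ᴵ (listLength Is) (listLength Js)))

listLength-applyUpTo : ∀ {c} J → (∀ k → ∣ J k ∣ᴵ ≡ c) → ∀ n → listLength (List.applyUpTo J n) ≡ ι n * c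
listLength-applyUpTo {c} J eq zero    = sym (trans (cong (_* c) ι-0) (ℚ.*-zeroˡ c))
listLength-applyUpTo {c} J eq (suc n) = begin
  ∣ J 0 ∣ᴵ + listLength (List.applyUpTo (J ∘ suc) n)  ≡⟨ cong₂ _+_ (eq 0) (listLength-applyUpTo (J ∘ suc) (eq ∘ suc) n) ⟩
  c + ι n * c                                         ≡⟨ lemma c (ι n) ⟩
  (1ℚ + ι n) * c                                      ≡⟨ cong (_* c) (ι-suc n) ⟨
  ι (suc n) * c                                       ∎
  where
  open ≡-Reasoning
  lemma : ∀ c n → c + n * c ≡ (1ℚ + n) * c
  lemma = solve-∀ ring

listLength-tabulate : ∀ {n} (J : Fin n → Interval) → listLength (List.tabulate J) ≡ sum (λ i → ∣ J i ∣ᴵ)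
listLength-tabulate {zero}  J = refl
listLength-tabulate {suc n} J = cong (∣ J zero ∣ᴵ +_) (listLength-tabulate (J ∘ suc))

-- Indicators, finite sums and the measure of unions of cells

⟦_⟧ : Bool → ℚ
⟦ true ⟧  = 1ℚ
⟦ false ⟧ = 0ℚ

⟦not⟧ : ∀ b → ⟦ not b ⟧ ≡ 1ℚ - ⟦ b ⟧
⟦not⟧ true  = refl
⟦not⟧ false = refl

sum-const : ∀ n c → sum {n} (λ _ → c) ≡ ι n * c
sum-const zero    c = sym (trans (cong (_* c) ι-0) (ℚ.*-zeroˡ c))
sum-const (suc n) c = trans (cong (c +_) (sum-const n c))
  (trans (lemma c (ι n)) (cong (_* c) (sym (ι-suc n))))
  where
  lemma : ∀ c n → c + n * c ≡ (1ℚ + n) * c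
  lemma = solve-∀ ring

sum-neg : ∀ {n} (f : Fin n → ℚ) → sum (λ i → - f i) ≡ - sum f
sum-neg {zero}  f = refl
sum-neg {suc n} f = trans (cong (- f zero +_) (sum-neg (f ∘ suc))) (sym (ℚ.neg-distrib-+ (f zero) (sum (f ∘ suc))))

sum-minus : ∀ {n} (f g : Fin n → ℚ) → sum (λ i → f i - g i) ≡ sum f - sum g
sum-minus f g = trans (∑-distrib-+ f (λ i → - g i)) (cong (sum f +_) (sum-neg g))

sum-zero : ∀ {n} (f : Fin n → ℚ) → (∀ i → f i ≡ 0ℚ) → sum f ≡ 0ℚ
sum-zero {n} f eq = trans (sum-cong-≗ eq) (trans (sum-const n 0ℚ) (ℚ.*-zeroʳ (ι n)))

sum-single : ∀ {n} (f : Fin n → ℚ) i → (∀ j → j ≢ i → f j ≡ 0ℚ) → sum f ≡ f i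
sum-single f zero    off = trans (cong (f zero +_) (sum-zero (f ∘ suc) (λ j → off (suc j) λ ())))
  (ℚ.+-identityʳ (f zero))
sum-single f (suc i) off = trans (cong₂ _+_ (off zero λ ())
  (sum-single (f ∘ suc) i (λ j j≢i → off (suc j) (j≢i ∘ Fin.suc-injective)))) (ℚ.+-identityˡ (f (suc i)))

module CellMeasure (N : ℕ) .{{_ : NonZero N}} where
  open Grid N

  volume : (Fin N → Bool) → ℚ
  volume I = sum λ i → ⟦ I i ⟧ * w

  volume-not : ∀ I → volume (not ∘ I) ≡ 1ℚ - volume I
  volume-not I = begin
    sum (λ i → ⟦ not (I i) ⟧ * w)              ≡⟨ sum-cong-≗ (λ i → trans (cong (_* w) (⟦not⟧ (I i))) (lemma ⟦ I i ⟧ w)) ⟩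
    sum (λ i → w - ⟦ I i ⟧ * w)                ≡⟨ sum-minus (λ _ → w) (λ i → ⟦ I i ⟧ * w) ⟩
    sum {N} (λ _ → w) - volume I               ≡⟨ cong (_- volume I) (trans (sum-const N w) grid-N) ⟩
    1ℚ - volume I                              ∎
    where
    open ≡-Reasoning
    lemma : ∀ b w → (1ℚ - b) * w ≡ w - b * w
    lemma = solve-∀ ring

  pick : (Fin N → Bool) → Fin N → Interval
  pick I i = if I i then (grid (toℕ i) , grid (suc (toℕ i))) else (0ℚ , 0ℚ)

  pick-length : ∀ I i → ∣ pick I i ∣ᴵ ≡ ⟦ I i ⟧ * w
  pick-length I i with I i
  ... | true  = trans (cong (0ℚ ⊔_) (trans (cong (_- grid (toℕ i)) (grid-suc (toℕ i))) (lemma (grid (toℕ i)) w)))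
                  (trans (ℚ.p≤q⇒p⊔q≡q (ℚ.<⇒≤ 0<w)) (sym (ℚ.*-identityˡ w)))
    where
    lemma : ∀ g w → g + w - g ≡ w
    lemma = solve-∀ ring
  ... | false = sym (ℚ.*-zeroˡ w)

  near-length : ∀ δ → 0ℚ < δ → ∀ j → ∣ near δ j ∣ᴵ ≡ δ + δ
  near-length δ 0<δ j = trans (cong (0ℚ ⊔_) (lemma (grid j) δ))
    (ℚ.p≤q⇒p⊔q≡q (+-nonNeg (ℚ.<⇒≤ 0<δ) (ℚ.<⇒≤ 0<δ)))
    where
    lemma : ∀ g δ → (g + δ) - (g - δ) ≡ δ + δ
    lemma = solve-∀ ring

  outerMeasure-cells : ∀ (P : Pred ℝ 0ℓ) I → P ⊆ [0,1] →
    (∀ i x → Inside i x → P x → I i ≡ true) → OuterMeasure≤ P (fromℚ (volume I))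
  outerMeasure-cells P I P⊆[0,1] indicates = finiteCover⇒outerMeasure {P} {volume I} λ ε 0<ε →
    -- The neighbourhoods of the N + 1 grid points catch the points not located in an open cell.
    -- They have length 2δ each, so δ = ε / 2(N + 1) makes them cost ε altogether.
    let K             = ι (suc N) + ι (suc N)
        δ , 0<δ , Kδ≡ε = divideBy K ε (ℚ.+-mono-< (ι-pos (suc N)) (ι-pos (suc N))) 0<ε
        boundaries    = List.applyUpTo (near δ) (suc N)
    in boundaries List.++ List.tabulate (pick I) ,
       (λ x Px → [
         (λ (j , j≤N , p) → Any.++⁺ˡ (Any.applyUpTo⁺ (near δ) p (ℕ.s≤s j≤N))) ,
         (λ (i , p) → Any.++⁺ʳ boundaries (Any.tabulate⁺ {f = pick I} i (picked i x p (indicates i x p Px)))) ]′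
         (locate-cell δ 0<δ x (P⊆[0,1] {x} Px))) ,
       ℚ.≤-reflexive (begin
         listLength (boundaries List.++ List.tabulate (pick I))
           ≡⟨ listLength-++ boundaries (List.tabulate (pick I)) ⟩
         listLength boundaries + listLength (List.tabulate (pick I))
           ≡⟨ cong₂ _+_ (listLength-applyUpTo (near δ) (near-length δ 0<δ) (suc N))
                (trans (listLength-tabulate (pick I)) (sum-cong-≗ (pick-length I))) ⟩
         ι (suc N) * (δ + δ) + volume I
           ≡⟨ lemma (ι (suc N)) δ (volume I) ⟩
         volume I + (ι (suc N) + ι (suc N)) * δ
           ≡⟨ cong (volume I +_) Kδ≡ε ⟩
         volume I + ε ∎)
    where
    open ≡-Reasoning
    lemma : ∀ n δ v → n * (δ + δ) + v ≡ v + (n + n) * δ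
    lemma = solve-∀ ring
    picked : ∀ i x → Inside i x → I i ≡ true → x ∈ᴵ pick I i
    picked i x p eq rewrite eq = p

  -- The complement is treated like the set itself, with the complementary family of cells:
  -- `complete` keeps it away from the open cells of `I`, and `volume-not` turns its volume into 1
  -- minus that of `I`.
  hasMeasure-cells : ∀ (P : Pred ℝ 0ℓ) I → P ⊆ [0,1] →
    (∀ i x → Inside i x → P x → I i ≡ true) →
    (∀ i x → Inside i x → I i ≡ true → P x) → HasMeasure P (fromℚ (volume I))
  hasMeasure-cells P I P⊆[0,1] sound complete = outerMeasure-cells P I P⊆[0,1] sound ,
    outerMeasure-cong (λ x → [0,1] x × x ∉ P) (fromℚ (volume (not ∘ I))) (1ℝ Real.- fromℚ (volume I)) (λ _ → volume-not I)
      (outerMeasure-cells (λ x → [0,1] x × x ∉ P) (not ∘ I) proj₁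
        λ i x p (_ , x∉P) → not-true (I i) (x∉P ∘ complete i x p))
    where
    not-true : ∀ b → b ≢ true → not b ≡ true
    not-true true  b≢true = contradiction refl b≢true
    not-true false _      = refl

  cells : (Fin N → Bool) → Pred ℝ 0ℓ
  cells I x = ∃ λ i → I i ≡ true × cell N i x

  cells-measurable : ∀ I → Measurable (cells I)
  cells-measurable I = record
    { ⊆[0,1]     = λ {x} → sub x
    ; respects   = λ {x} {y} x≈y (i , Ii , x∈i) → i , Ii , cell-respects i x y x≈y x∈i
    ; measure    = fromℚ (volume I)
    ; hasMeasure = hasMeasure-cells (cells I) I (λ {x} → sub x)
        (λ i x p (j , Ij , x∈j) → subst (λ i → I i ≡ true) (sym (Inside-unique i j x p x∈j)) Ij)
        (λ i x p Ii → i , Ii , Inside⇒cell i x p)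
    }
    where
    sub : ∀ x → cells I x → [0,1] x
    sub x (i , _ , x∈i) = cell⊆[0,1] i x x∈i

  cells∩cell : ∀ I i → HasMeasure (cells I ∩ cell N i) (fromℚ (⟦ I i ⟧ * w))
  cells∩cell I i = hasMeasure-cong (cells I ∩ cell N i) (fromℚ (volume I′)) (fromℚ (⟦ I i ⟧ * w)) (λ _ → volume-I′)
    (hasMeasure-cells (cells I ∩ cell N i) I′ (λ {x} (_ , x∈i) → cell⊆[0,1] i x x∈i) sound complete)
    where
    -- Up to endpoints the intersection is again a union of cells: of the single cell `i` if `I i`
    -- holds, and of none otherwise.
    I′ : Fin N → Bool
    I′ j = I i ∧ does (j Fin.≟ i)

    I′-off : ∀ j → j ≢ i → I′ j ≡ false
    I′-off j j≢i with I i | j Fin.≟ i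
    ... | _     | yes j≡i = contradiction j≡i j≢i
    ... | true  | no  _   = refl
    ... | false | no  _   = refl

    I′-on : I′ i ≡ I i
    I′-on with I i | i Fin.≟ i
    ... | true  | yes _   = refl
    ... | false | yes _   = refl
    ... | _     | no  i≢i = contradiction refl i≢i

    volume-I′ : volume I′ ≡ ⟦ I i ⟧ * w
    volume-I′ = trans (sum-single (λ j → ⟦ I′ j ⟧ * w) i
        (λ j j≢i → trans (cong (λ b → ⟦ b ⟧ * w) (I′-off j j≢i)) (ℚ.*-zeroˡ w)))
      (cong (λ b → ⟦ b ⟧ * w) I′-on)

    I′-intro : ∀ {j} → j ≡ i → I i ≡ true → I′ j ≡ true
    I′-intro refl Ii = trans I′-on Ii

    I′-elim : ∀ {j} → I′ j ≡ true → j ≡ i × I i ≡ true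
    I′-elim {j} eq with I i | j Fin.≟ i
    ... | true | yes j≡i = j≡i , refl

    sound : ∀ j x → Inside j x → (cells I ∩ cell N i) x → I′ j ≡ true
    sound j x p ((k , Ik , x∈k) , x∈i) = I′-intro j≡i
      (subst (λ k → I k ≡ true) (trans (sym (Inside-unique j k x p x∈k)) j≡i) Ik)
      where
      j≡i : j ≡ i
      j≡i = Inside-unique j i x p x∈i

    complete : ∀ j x → Inside j x → I′ j ≡ true → (cells I ∩ cell N i) x
    complete j x p eq = let j≡i , Ii = I′-elim eq
                            x∈i      = subst (λ k → cell N k x) j≡i (Inside⇒cell j x p)
                        in (i , Ii , x∈i) , x∈i

-- Finite means

record IsLinear {X : Set} (E : (X → ℚ) → ℚ) : Set where
  field
    E-cong : ∀ {f g} → (∀ x → f x ≡ g x) → E f ≡ E g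
    E-+    : ∀ f g → E (λ x → f x + g x) ≡ E f + E g
    E-*    : ∀ c f → E (λ x → c * f x) ≡ c * E f

-- E-comm expresses that E is a finite linear combination of evaluations; it
-- yields Fubini.
record Mean (X : Set) : Set₁ where
  field
    E        : (X → ℚ) → ℚ
    isLinear : IsLinear E
    E-mono   : ∀ {f g} → (∀ x → f x ≤ g x) → E f ≤ E g
    E-1      : E (λ _ → 1ℚ) ≡ 1ℚ
    E-comm   : ∀ {Y : Set} {L : (Y → ℚ) → ℚ} → IsLinear L → (f : X → Y → ℚ) →
               E (λ x → L (f x)) ≡ L (λ y → E (λ x → f x y))

  open IsLinear isLinear public

  E-const : ∀ c → E (λ _ → c) ≡ c
  E-const c = begin
    E (λ _ → c)         ≡⟨ E-cong (λ _ → sym (ℚ.*-identityʳ c)) ⟩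
    E (λ _ → c * 1ℚ)    ≡⟨ E-* c (λ _ → 1ℚ) ⟩
    c * E (λ _ → 1ℚ)    ≡⟨ cong (c *_) E-1 ⟩
    c * 1ℚ              ≡⟨ ℚ.*-identityʳ c ⟩
    c                   ∎
    where open ≡-Reasoning

  E-*ʳ : ∀ c f → E (λ x → f x * c) ≡ E f * c
  E-*ʳ c f = trans (E-cong (λ x → ℚ.*-comm (f x) c)) (trans (E-* c f) (ℚ.*-comm c (E f)))

  E-minus : ∀ f g → E (λ x → f x - g x) ≡ E f - E g
  E-minus f g = begin
    E (λ x → f x - g x)              ≡⟨ E-cong (λ x → lemma (f x) (g x)) ⟩
    E (λ x → f x + - 1ℚ * g x)       ≡⟨ E-+ f (λ x → - 1ℚ * g x) ⟩
    E f + E (λ x → - 1ℚ * g x)       ≡⟨ cong (E f +_) (E-* (- 1ℚ) g) ⟩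
    E f + - 1ℚ * E g                 ≡⟨ lemma (E f) (E g) ⟨
    E f - E g                        ∎
    where
    open ≡-Reasoning
    lemma : ∀ a b → a - b ≡ a + - 1ℚ * b
    lemma = solve-∀ ring

  E-≤ : ∀ {f} c → (∀ x → f x ≤ c) → E f ≤ c
  E-≤ c p = ℚ.≤-trans (E-mono p) (ℚ.≤-reflexive (E-const c))

  E-nonNeg : ∀ {f} → (∀ x → 0ℚ ≤ f x) → 0ℚ ≤ E f
  E-nonNeg p = ℚ.≤-trans (ℚ.≤-reflexive (sym (E-const 0ℚ))) (E-mono p)

  ∣E∣≤ : ∀ f g → (∀ x → ∣ f x ∣ ≤ g x) → ∣ E f ∣ ≤ E g
  ∣E∣≤ f g p = ∣∣-≤ (E-mono λ x → ℚ.≤-trans (a≤∣a∣ (f x)) (p x))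
    (ℚ.≤-trans (ℚ.≤-reflexive (trans (lemma (E f)) (trans (sym (E-* (- 1ℚ) f)) (E-cong (sym ∘ lemma ∘ f)))))
      (E-mono λ x → ℚ.≤-trans (-a≤∣a∣ (f x)) (p x)))
    where
    lemma : ∀ a → - a ≡ - 1ℚ * a
    lemma = solve-∀ ring

open Mean

infix 4 _≋_

_≋_ : ∀ {X} → Mean X → Mean X → Set
M ≋ M′ = ∀ f → E M f ≡ E M′ f

uniform : ∀ n .{{_ : NonZero n}} → Mean (Fin n)
uniform n = record
  { E        = λ f → w * sum f
  ; isLinear = record
    { E-cong = λ eq → cong (w *_) (sum-cong-≗ eq)
    ; E-+    = λ f g → trans (cong (w *_) (∑-distrib-+ f g)) (ℚ.*-distribˡ-+ w (sum f) (sum g))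
    ; E-*    = λ c f → trans (cong (w *_) (sym (*-distribˡ-sum c f))) (lemma w c (sum f))
    }
  ; E-mono   = λ p → *-monoˡ w (ℚ.<⇒≤ 0<w) (sum-mono p)
  ; E-1      = trans (cong (w *_) (sum-const n 1ℚ)) (trans (cong (w *_) (ℚ.*-identityʳ (ι n))) (1/ι-* n))
  ; E-comm   = λ lin f → trans (cong (w *_) (sum-comm lin f)) (sym (IsLinear.E-* lin w _))
  }
  where
  open Grid n using (w; 0<w)
  lemma : ∀ w c s → w * (c * s) ≡ c * (w * s)
  lemma = solve-∀ ring
  sum-comm : ∀ {n} {Y : Set} {L : (Y → ℚ) → ℚ} → IsLinear L → (f : Fin n → Y → ℚ) →
             sum (λ x → L (f x)) ≡ L (λ y → sum (λ x → f x y))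
  sum-comm {zero}  {L = L} lin f = sym (trans (IsLinear.E-* lin 0ℚ (λ _ → 0ℚ)) (ℚ.*-zeroˡ (L (λ _ → 0ℚ))))
  sum-comm {suc n} {L = L} lin f = trans (cong (L (f zero) +_) (sum-comm lin (f ∘ suc)))
    (sym (IsLinear.E-+ lin (f zero) _))
  sum-mono : ∀ {n} {f g : Fin n → ℚ} → (∀ i → f i ≤ g i) → sum f ≤ sum g
  sum-mono {zero}  p = ℚ.≤-refl
  sum-mono {suc n} p = ℚ.+-mono-≤ (p zero) (sum-mono (p ∘ suc))

infixr 5 _⊗_

_⊗_ : ∀ {X Y} → Mean X → Mean Y → Mean (X × Y)
M ⊗ M′ = record
  { E        = λ f → E M λ x → E M′ λ y → f (x , y)
  ; isLinear = record
    { E-cong = λ eq → E-cong M λ x → E-cong M′ λ y → eq (x , y)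
    ; E-+    = λ f g → trans (E-cong M λ x → E-+ M′ _ _) (E-+ M _ _)
    ; E-*    = λ c f → trans (E-cong M λ x → E-* M′ c _) (E-* M c _)
    }
  ; E-mono   = λ p → E-mono M λ x → E-mono M′ λ y → p (x , y)
  ; E-1      = trans (E-cong M λ _ → E-1 M′) (E-1 M)
  ; E-comm   = λ lin f → trans (E-cong M λ x → E-comm M′ lin (λ y → f (x , y))) (E-comm M lin _)
  }

push : ∀ {X Y} → (X → Y) → Mean X → Mean Y
push φ M = record
  { E        = λ f → E M (f ∘ φ)
  ; isLinear = record
    { E-cong = λ eq → E-cong M (eq ∘ φ)
    ; E-+    = λ f g → E-+ M (f ∘ φ) (g ∘ φ)
    ; E-*    = λ c f → E-* M c (f ∘ φ)
    }
  ; E-mono   = λ p → E-mono M (p ∘ φ)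
  ; E-1      = E-1 M
  ; E-comm   = λ lin f → E-comm M lin (f ∘ φ)
  }

-- The factors may differ, because a vertex of B is drawn from the part of the bipartite graph that
-- its image in `K⃗₂` prescribes.
Π : ∀ {m X} → (Fin m → Mean X) → Mean (Fin m → X)
Π {zero}  M = record
  { E        = λ f → f λ ()
  ; isLinear = record
    { E-cong = λ eq → eq λ ()
    ; E-+    = λ f g → refl
    ; E-*    = λ c f → refl
    }
  ; E-mono   = λ p → p λ ()
  ; E-1      = refl
  ; E-comm   = λ lin f → refl
  }
Π {suc m} M = push (uncurry Vector._∷_) (M zero ⊗ Π (M ∘ suc))

-- Vectors are functions, and a vector rebuilt from its coordinates agrees with the original one
-- only pointwise; functionals therefore have to respect pointwise equality.
Extensional : ∀ {m} {X : Set} → ((Fin m → X) → ℚ) → Set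
Extensional F = ∀ {f g} → (∀ i → f i ≡ g i) → F f ≡ F g

∷-cong : ∀ {m} {X : Set} (x : X) {f g : Fin m → X} → (∀ i → f i ≡ g i) →
         ∀ i → (x Vector.∷ f) i ≡ (x Vector.∷ g) i
∷-cong x eq zero    = refl
∷-cong x eq (suc i) = eq i

Π-cong : ∀ {m X} {M M′ : Fin m → Mean X} → (∀ v → M v ≋ M′ v) → Π M ≋ Π M′
Π-cong {zero}            eq F = refl
Π-cong {suc m} {M′ = M′} eq F = trans (eq zero _)
  (E-cong (M′ zero) λ x → Π-cong (eq ∘ suc) λ f → F (x Vector.∷ f))

Π-push : ∀ {m} {X Y : Set} (φ : Fin m → X → Y) (M : Fin m → Mean X) {F} → Extensional F →
         E (Π (λ v → push (φ v) (M v))) F ≡ E (Π M) (λ f → F (λ v → φ v (f v)))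
Π-push {zero}  φ M ext = ext λ ()
Π-push {suc m} φ M ext = E-cong (M zero) λ x →
  trans (Π-push (φ ∘ suc) (M ∘ suc) (ext ∘ ∷-cong (φ zero x)))
    (E-cong (Π (M ∘ suc)) λ f → ext λ { zero → refl ; (suc i) → refl })

Π-⊗ : ∀ {m X Y} (M : Fin m → Mean X) (M′ : Fin m → Mean Y) {F} → Extensional F →
      E (Π (λ v → M v ⊗ M′ v)) F ≡ E (Π M) (λ f → E (Π M′) λ g → F (λ v → f v , g v))
Π-⊗ {zero}  M M′ ext = ext λ ()
Π-⊗ {suc m} M M′ {F} ext = begin
  E (M zero) (λ x → E (M′ zero) λ y → E (Π (λ v → M (suc v) ⊗ M′ (suc v))) λ h → F ((x , y) Vector.∷ h))
    ≡⟨ E-cong (M zero) (λ x → E-cong (M′ zero) λ y →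
      trans (Π-⊗ (M ∘ suc) (M′ ∘ suc) (ext ∘ ∷-cong (x , y)))
        (E-cong (Π (M ∘ suc)) λ f → E-cong (Π (M′ ∘ suc)) λ g → ext λ { zero → refl ; (suc i) → refl })) ⟩
  E (M zero) (λ x → E (M′ zero) λ y → E (Π (M ∘ suc)) λ f → E (Π (M′ ∘ suc)) λ g →
    F (λ v → (x Vector.∷ f) v , (y Vector.∷ g) v))
    ≡⟨ E-cong (M zero) (λ x → E-comm (M′ zero) (isLinear (Π (M ∘ suc))) _) ⟩
  E (M zero) (λ x → E (Π (M ∘ suc)) λ f → E (M′ zero) λ y → E (Π (M′ ∘ suc)) λ g →
    F (λ v → (x Vector.∷ f) v , (y Vector.∷ g) v)) ∎
  where open ≡-Reasoning

Π-marginal : ∀ {m X} (M : Fin m → Mean X) v f → E (Π M) (λ g → f (g v)) ≡ E (M v) f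
Π-marginal M zero    f = E-cong (M zero) λ x → E-const (Π (M ∘ suc)) (f x)
Π-marginal M (suc v) f = trans (E-const (M zero) _) (Π-marginal (M ∘ suc) v f)

-- Cut norm and discrepancy

⅓ ⅛ : ℚ
⅓ = ℤ.+ 1 / 3
⅛ = ℤ.+ 1 / 8

outerMeasure-nonNeg : ∀ P m → OuterMeasure≤ P m → ∀ ε → 0ℚ < ε → Ev λ k → - ε ≤ seq m k
outerMeasure-nonNeg P m outer ε 0<ε =
  let δ   = ⅓ * ε
      0<δ = *-pos (ℚ.positive⁻¹ ⅓) 0<ε
      J , ℓ , _ , J⟶ℓ , ℓ≤m+δ = outer δ 0<δ
  in Ev-zip
    (λ k p q → ≤-byDifference
      (ℚ.+-mono-≤ (ℚ.+-mono-≤ (totalLength-nonNeg J k) (ℚ.≤-trans (a≤∣a∣ _) p)) q)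
      (lemma ε (totalLength J k) (seq ℓ k) (seq m k)))
    (⟶⇒Null {totalLength J} {ℓ} J⟶ℓ δ 0<δ) (ℓ≤m+δ δ 0<δ)
  where
  lemma : ∀ ε t l m → t + ⅓ * ε + (m + ⅓ * ε + ⅓ * ε) - (0ℚ + (t - l) + l) ≡ m - - ε
  lemma = solve-∀ ring

module CellBound (N : ℕ) .{{_ : NonZero N}} where
  open Grid N

  -- The second `w` in the bound `w + w` below pays for 8η. The errors take 6η: 2η for the enlarged
  -- cell, 2η for the outer measure and the real inequality in which it is stated, and η for each of
  -- the two approximations of reals by rationals. The remaining 2η is the amount by which the cover
  -- falls short of length 1.
  η : ℚ
  η = ⅛ * w

  0<η : 0ℚ < η
  0<η = *-pos (ℚ.positive⁻¹ ⅛) 0<w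

  fat : Fin N → Interval
  fat i = grid (toℕ i) - η , grid (suc (toℕ i)) + η

  fat-length : ∀ i → ∣ fat i ∣ᴵ ≡ w + (η + η)
  fat-length i = trans
    (cong (0ℚ ⊔_) (trans (cong (λ g → g + η - (grid (toℕ i) - η)) (grid-suc (toℕ i))) (lemma (grid (toℕ i)) w η)))
    (ℚ.p≤q⇒p⊔q≡q (+-nonNeg (ℚ.<⇒≤ 0<w) (+-nonNeg (ℚ.<⇒≤ 0<η) (ℚ.<⇒≤ 0<η))))
    where
    lemma : ∀ g w η → g + w + η - (g - η) ≡ w + (η + η)
    lemma = solve-∀ ring

  -- The margin η makes the alternatives overlap, so that `locate` can decide between them;
  -- membership in the cell itself is undecidable.
  fat-or-outside : ∀ i x → x ∈ᴵ fat i ⊎ ¬ cell N i x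
  fat-or-outside i x = [ (λ x<a → inj₂ (left x<a)) , (λ a-η<x → [
      (λ x<b+η → inj₁ (a-η<x , x<b+η)) , (λ b<x → inj₂ (right b<x)) ]′ (locate x b η 0<η)) ]′
    (locate x (a - η) η 0<η)
    where
    a = grid (toℕ i)
    b = grid (suc (toℕ i))
    lemma : ∀ a η → a - η + η ≡ a
    lemma = solve-∀ ring
    left : x Real.< fromℚ (a - η + η) → ¬ cell N i x
    left x<a x∈i = ℚ.<-irrefl (sym (lemma a η)) (fromℚ-cancel-< a (a - η + η)
      (≤-<-transʳ (fromℚ a) x (fromℚ (a - η + η)) (proj₁ (cell⇒InCell i x x∈i)) x<a))
    right : fromℚ b Real.< x → ¬ cell N i x
    right b<x x∈i = [
      (λ x<b → ℚ.<-irrefl refl (fromℚ-cancel-< b b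
        (<-≤-transʳ (fromℚ b) x (fromℚ b) b<x (<⇒≤ʳ x (fromℚ b) x<b)))) ,
      (λ (eq , x≤1) → ℚ.<-irrefl (trans (cong grid eq) grid-N) (fromℚ-cancel-< b 1ℚ
        (<-≤-transʳ (fromℚ b) x 1ℝ b<x x≤1))) ]′ (proj₂ (cell⇒InCell i x x∈i))

  -- A slightly enlarged cell together with a cover of the complement of the
  -- cell covers [0,1].
  cell-measure-≤ : ∀ S i m → HasMeasure (S ∩ cell N i) m → Ev λ k → seq m k ≤ w + w
  cell-measure-≤ S i m (_ , complement) =
    let J , ℓ , covers , J⟶ℓ , ℓ≤ = complement η 0<η
        M , cm = cauchy m η 0<η
    in Ev-map
      -- `seq m k` and `w + w` are rationals, so the bound may be proved by contradiction: its
      -- failure yields a cover of [0,1] of length below 1.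
      (λ k (M≤k , _) → ℚ.≮⇒≥ λ 2w<m → cover-length (fat i ▸ J)
        (SmallTails-▸ (fat i) J (totalLength-tail J ℓ J⟶ℓ))
        (λ x x∈[0,1] → [ (λ p → 0 , p) ,
          (λ x∉i → let k , p = covers x (x∈[0,1] , λ (_ , x∈i) → x∉i x∈i) in suc k , p) ]′ (fat-or-outside i x))
        (η + η) (ℚ.+-mono-< 0<η 0<η)
        (short J ℓ k 2w<m (Ev-zip (λ _ → _,_) (M , λ k′ M≤k′ → cm k k′ M≤k M≤k′)
          (Ev-zip (λ _ → _,_) (⟶⇒Null {totalLength J} {ℓ} J⟶ℓ η 0<η) (ℓ≤ η 0<η)))))
      (M , λ k M≤k → M≤k , tt)
    where
    short : ∀ J ℓ k → w + w < seq m k →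
      Ev (λ k′ → ∣ seq m k - seq m k′ ∣ ≤ η × ∣ totalLength J k′ - seq ℓ k′ ∣ ≤ η ×
                 seq ℓ k′ ≤ 1ℚ - seq m k′ + η + η) →
      ∀ n → totalLength (fat i ▸ J) n ≤ 1ℚ - (η + η)
    short J ℓ k 2w<m (M , close) n = let p , q , r = close (n ℕ.+ M) (ℕ.m≤n+m M n) in begin
      totalLength (fat i ▸ J) n                      ≤⟨ totalLength-mono (fat i ▸ J) n (suc M) ⟩
      totalLength (fat i ▸ J) (n ℕ.+ suc M)          ≡⟨ cong (totalLength (fat i ▸ J)) (ℕ.+-suc n M) ⟩
      totalLength (fat i ▸ J) (suc (n ℕ.+ M))        ≡⟨ totalLength-▸ (fat i) J (n ℕ.+ M) ⟩
      ∣ fat i ∣ᴵ + totalLength J (n ℕ.+ M)           ≡⟨ cong (_+ totalLength J (n ℕ.+ M)) (fat-length i) ⟩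
      w + (η + η) + totalLength J (n ℕ.+ M)          ≤⟨ ≤-byDifference
        (ℚ.+-mono-≤ (ℚ.+-mono-≤ (ℚ.<⇒≤ 2w<m) (ℚ.≤-trans (a≤∣a∣ _) p))
          (ℚ.+-mono-≤ (ℚ.≤-trans (a≤∣a∣ _) q) r))
        (lemma w (seq m k) (seq m (n ℕ.+ M)) (totalLength J (n ℕ.+ M)) (seq ℓ (n ℕ.+ M))) ⟩
      1ℚ - (η + η)                                   ∎
      where
      open ℚ.≤-Reasoning
      lemma : ∀ w m m′ t l →
        m + ⅛ * w + (⅛ * w + (1ℚ - m′ + ⅛ * w + ⅛ * w)) - (w + w + (m - m′) + (t - l + l)) ≡
        1ℚ - (⅛ * w + ⅛ * w) - (w + (⅛ * w + ⅛ * w) + t)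
      lemma = solve-∀ ring

  cell-measure-bounded : ∀ S i m → HasMeasure (S ∩ cell N i) m → Ev λ k → ∣ seq m k ∣ ≤ w + w
  cell-measure-bounded S i m hm = Ev-zip
    (λ k p q → ∣∣-≤ p (ℚ.≤-trans (≤-byDifference q (lemma w (seq m k))) ℚ.≤-refl))
    (cell-measure-≤ S i m hm)
    (outerMeasure-nonNeg (S ∩ cell N i) m (proj₁ hm) (w + w) (ℚ.+-mono-< 0<w 0<w))
    where
    lemma : ∀ w m → m - - (w + w) ≡ w + w - - m
    lemma = solve-∀ ring

-- The loss in passing from subsets to weights in one variable: a factor 2 because weights are
-- bounded by 2, and a factor 2 for the positive and the negative part.
fourfold : ℚ → ℚ
fourfold c = c + c + (c + c)

sign : ∀ a → ∃[ b ] ∣ a ∣ ≡ a * ⟦ b ⟧ - a * ⟦ not b ⟧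
sign a with ℚ.≤-total 0ℚ a
... | inj₁ 0≤a = true , trans (ℚ.0≤p⇒∣p∣≡p 0≤a) (lemma a)
  where
  lemma : ∀ a → a ≡ a * 1ℚ - a * 0ℚ
  lemma = solve-∀ ring
... | inj₂ a≤0 = false ,
    trans (sym (ℚ.∣-p∣≡∣p∣ a)) (trans (ℚ.0≤p⇒∣p∣≡p (ℚ.neg-antimono-≤ a≤0)) (lemma a))
  where
  lemma : ∀ a → - a ≡ a * 0ℚ - a * 1ℚ
  lemma = solve-∀ ring

-- E ∣ y ∣ is the difference of the sums of y over the two subsets where y is
-- positive and negative.
weights-bound : ∀ {X} (M : Mean X) (y : X → ℚ) c → (∀ I → ∣ E M (λ x → y x * ⟦ I x ⟧) ∣ ≤ c) →
                (σ : X → ℚ) → (∀ x → ∣ σ x ∣ ≤ 1ℚ + 1ℚ) → ∣ E M (λ x → y x * σ x) ∣ ≤ fourfold c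
weights-bound {X} M y c subsets σ σ≤2 = begin
  ∣ E M (λ x → y x * σ x) ∣                        ≤⟨ ∣E∣≤ M (λ x → y x * σ x) (λ x → (1ℚ + 1ℚ) * (f⁺ x - f⁻ x)) ∣yσ∣≤ ⟩
  E M (λ x → (1ℚ + 1ℚ) * (f⁺ x - f⁻ x))            ≡⟨ E-* M (1ℚ + 1ℚ) (λ x → f⁺ x - f⁻ x) ⟩
  (1ℚ + 1ℚ) * E M (λ x → f⁺ x - f⁻ x)              ≡⟨ cong ((1ℚ + 1ℚ) *_) (E-minus M f⁺ f⁻) ⟩
  (1ℚ + 1ℚ) * (E M f⁺ - E M f⁻)                    ≤⟨ *-monoˡ (1ℚ + 1ℚ) (ℚ.<⇒≤ 0<2) (ℚ.+-mono-≤
      (ℚ.≤-trans (a≤∣a∣ (E M f⁺)) (subsets I⁺)) (ℚ.≤-trans (-a≤∣a∣ (E M f⁻)) (subsets (not ∘ I⁺)))) ⟩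
  (1ℚ + 1ℚ) * (c + c)                              ≡⟨ lemma c ⟩
  fourfold c                                       ∎
  where
  open ℚ.≤-Reasoning
  0<2 : 0ℚ < 1ℚ + 1ℚ
  0<2 = ℚ.positive⁻¹ (1ℚ + 1ℚ)
  I⁺ : X → Bool
  I⁺ x = proj₁ (sign (y x))
  f⁺ f⁻ : X → ℚ
  f⁺ x = y x * ⟦ I⁺ x ⟧
  f⁻ x = y x * ⟦ not (I⁺ x) ⟧
  lemma : ∀ c → (1ℚ + 1ℚ) * (c + c) ≡ c + c + (c + c)
  lemma = solve-∀ ring
  ∣yσ∣≤ : ∀ x → ∣ y x * σ x ∣ ≤ (1ℚ + 1ℚ) * (f⁺ x - f⁻ x)
  ∣yσ∣≤ x = begin
    ∣ y x * σ x ∣                   ≡⟨ ℚ.∣p*q∣≡∣p∣*∣q∣ (y x) (σ x) ⟩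
    ∣ y x ∣ * ∣ σ x ∣               ≡⟨ ℚ.*-comm ∣ y x ∣ ∣ σ x ∣ ⟩
    ∣ σ x ∣ * ∣ y x ∣               ≤⟨ *-mono (ℚ.0≤∣p∣ (y x)) (ℚ.<⇒≤ 0<2) (σ≤2 x) (ℚ.≤-reflexive (proj₂ (sign (y x)))) ⟩
    (1ℚ + 1ℚ) * (f⁺ x - f⁻ x)       ∎

⟦⟧-bound : ∀ a b q → ∣ q * (⟦ a ⟧ * ⟦ b ⟧) ∣ ≤ ∣ q ∣
⟦⟧-bound true  true  q = ℚ.≤-reflexive (cong ∣_∣ (ℚ.*-identityʳ q))
⟦⟧-bound true  false q = subst (_≤ ∣ q ∣) (cong ∣_∣ (sym (ℚ.*-zeroʳ q))) (ℚ.0≤∣p∣ q)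
⟦⟧-bound false b     q = subst (_≤ ∣ q ∣)
  (cong ∣_∣ (sym (trans (cong (q *_) (ℚ.*-zeroˡ ⟦ b ⟧)) (ℚ.*-zeroʳ q)))) (ℚ.0≤∣p∣ q)

module _ {X Y : Set} (M : Mean X) (M′ : Mean Y) where

  -- The integral of W - q over a product of two unions of cells. The number q is rational because a
  -- real density enters only through its approximations.
  discrepancy : (X → Y → Bool) → ℚ → (X → Bool) → (Y → Bool) → ℚ
  discrepancy b q I J = E M λ x → E M′ λ y → (⟦ b x y ⟧ - q) * (⟦ I x ⟧ * ⟦ J y ⟧)

  discrepancy-shift : ∀ b q q′ I J → ∣ discrepancy b q I J - discrepancy b q′ I J ∣ ≤ ∣ q′ - q ∣
  discrepancy-shift b q q′ I J = subst (λ d → ∣ d ∣ ≤ ∣ q′ - q ∣)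
    (trans (E-cong M λ x → trans (E-cong M′ λ y → lemma ⟦ b x y ⟧ q q′ (⟦ I x ⟧ * ⟦ J y ⟧)) (E-minus M′ _ _)) (E-minus M _ _))
    (ℚ.≤-trans (∣E∣≤ M (λ x → E M′ λ y → (q′ - q) * (⟦ I x ⟧ * ⟦ J y ⟧)) (λ _ → E M′ λ _ → ∣ q′ - q ∣)
        λ x → ∣E∣≤ M′ (λ y → (q′ - q) * (⟦ I x ⟧ * ⟦ J y ⟧)) (λ _ → ∣ q′ - q ∣) λ y → ⟦⟧-bound (I x) (J y) (q′ - q))
      (ℚ.≤-reflexive (trans (E-cong M λ _ → E-const M′ ∣ q′ - q ∣) (E-const M ∣ q′ - q ∣))))
    where
    lemma : ∀ b q q′ c → (q′ - q) * c ≡ (b - q) * c - (b - q′) * c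
    lemma = solve-∀ ring

  discrepancy-near : ∀ b {q q′ c δ} → ∣ q′ - q ∣ ≤ δ → ∀ I J →
                     ∣ discrepancy b q′ I J ∣ ≤ c → ∣ discrepancy b q I J ∣ ≤ c + δ
  discrepancy-near b {q} {q′} {c} {δ} near I J small = begin
    ∣ d ∣                   ≡⟨ cong ∣_∣ (lemma d d′) ⟩
    ∣ d′ + (d - d′) ∣       ≤⟨ ℚ.∣p+q∣≤∣p∣+∣q∣ d′ (d - d′) ⟩
    ∣ d′ ∣ + ∣ d - d′ ∣     ≤⟨ ℚ.+-mono-≤ small (ℚ.≤-trans (discrepancy-shift b q q′ I J) near) ⟩
    c + δ                   ∎
    where
    open ℚ.≤-Reasoning
    d  = discrepancy b q I J
    d′ = discrepancy b q′ I J
    lemma : ∀ d d′ → d ≡ d′ + (d - d′)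
    lemma = solve-∀ ring

  -- The form is bilinear, so `weights-bound` applies to one variable at a time while the other is
  -- averaged out; Fubini brings the variable in question to the outside.
  discrepancy-weights : ∀ b q c → (∀ I J → ∣ discrepancy b q I J ∣ ≤ c) →
    (σ : X → ℚ) (τ : Y → ℚ) → (∀ x → ∣ σ x ∣ ≤ 1ℚ + 1ℚ) → (∀ y → ∣ τ y ∣ ≤ 1ℚ + 1ℚ) →
    ∣ E M (λ x → E M′ λ y → (⟦ b x y ⟧ - q) * (σ x * τ y)) ∣ ≤ fourfold (fourfold c)
  discrepancy-weights b q c small σ τ σ≤2 τ≤2 = subst (λ d → ∣ d ∣ ≤ fourfold (fourfold c))
    (E-cong M λ x → trans (sym (E-*ʳ M′ (σ x) _)) (E-cong M′ λ y → lemma (⟦ b x y ⟧ - q) (τ y) (σ x)))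
    (weights-bound M (λ x → E M′ λ y → (⟦ b x y ⟧ - q) * τ y) (fourfold c) (λ I →
      subst (λ d → ∣ d ∣ ≤ fourfold c)
        (trans (E-cong M′ λ y → trans (sym (E-*ʳ M (τ y) _))
            (E-cong M λ x → lemma′ (⟦ b x y ⟧ - q) ⟦ I x ⟧ (τ y)))
          (trans (E-comm M′ (isLinear M) _) (E-cong M λ x → E-*ʳ M′ ⟦ I x ⟧ _)))
        (weights-bound M′ (λ y → E M λ x → (⟦ b x y ⟧ - q) * ⟦ I x ⟧) c (λ J →
          subst (λ d → ∣ d ∣ ≤ c)
            (trans (E-comm M (isLinear M′) _) (E-cong M′ λ y →
              trans (E-cong M λ x → sym (ℚ.*-assoc (⟦ b x y ⟧ - q) ⟦ I x ⟧ ⟦ J y ⟧)) (E-*ʳ M ⟦ J y ⟧ _)))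
            (small I J)) τ τ≤2)) σ σ≤2)
    where
    lemma : ∀ a t s → a * t * s ≡ a * (s * t)
    lemma = solve-∀ ring
    lemma′ : ∀ a i t → a * i * t ≡ a * t * i
    lemma′ = solve-∀ ring

Ev-∀ : ∀ {n} {P : Fin n → ℕ → Set} → (∀ i → Ev (P i)) → Ev λ k → ∀ i → P i k
Ev-∀ {zero}  p = 0 , λ _ _ ()
Ev-∀ {suc n} p = Ev-zip (λ k p₀ p₊ → λ { zero → p₀ ; (suc i) → p₊ i }) (p zero) (Ev-∀ (p ∘ suc))

seq-∑ : ∀ {n} (f : Fin n → ℝ) k → seq (∑ f) k ≡ sum (λ i → seq (f i) k)
seq-∑ {zero}  f k = refl
seq-∑ {suc n} f k = cong (seq (f zero) k +_) (seq-∑ (f ∘ suc) k)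

module Graphon (U : StepFunction) where
  open StepFunction U

  rowMean : Mean (Fin rows)
  rowMean = uniform rows

  colMean : Mean (Fin cols)
  colMean = uniform cols

  open Grid rows using () renaming (w to u)
  open Grid cols using () renaming (w to v)

  -- Expressing the measure inside each cell as a multiple of the cell width turns the integral into
  -- a mean.
  scaled : (x : Fin rows → Fin cols → ℚ) (s : Fin rows → ℚ) (t : Fin cols → ℚ) →
    sum (λ i → sum λ j → x i j * ((s i * u) * (t j * v))) ≡
    E rowMean λ i → E colMean λ j → x i j * (s i * t j)
  scaled x s t = trans (sum-cong-≗ λ i → trans (sum-cong-≗ λ j → lemma (x i j) (s i) (t j) u v)
      (trans (sym (*-distribˡ-sum u (λ j → v * (x i j * (s i * t j)))))
        (cong (u *_) (sym (*-distribˡ-sum v (λ j → x i j * (s i * t j)))))))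
    (sym (*-distribˡ-sum u (λ i → v * sum λ j → x i j * (s i * t j))))
    where
    lemma : ∀ x s t u v → x * ((s * u) * (t * v)) ≡ u * (v * (x * (s * t)))
    lemma = solve-∀ ring

  module _ (x : ℕ → Fin rows → Fin cols → ℚ) (value-seq : ∀ i j k → seq (value i j) k ≡ x k i j) where

    seq-integral : (s : Fin rows → ℝ) (t : Fin cols → ℝ) → ∀ k → seq (∑ λ i → ∑ λ j → value i j Real.* (s i Real.* t j)) k ≡
      sum λ i → sum λ j → x k i j * (seq (s i) k * seq (t j) k)
    seq-integral s t k =
      trans (seq-∑ (λ i → ∑ λ j → value i j Real.* (s i Real.* t j)) k)
        (sum-cong-≗ λ i → trans (seq-∑ (λ j → value i j Real.* (s i Real.* t j)) k)
          (sum-cong-≗ λ j → cong (_* (seq (s i) k * seq (t j) k)) (value-seq i j k)))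

    integral : ∀ S T (s : Fin rows → ℝ) (t : Fin cols → ℝ) → (∀ i → HasMeasure (S ∩ cell rows i) (s i)) → (∀ j → HasMeasure (T ∩ cell cols j) (t j)) →
      ∃ λ z → IsIntegral U S T z ×
        (∀ k → seq z k ≡ sum λ i → sum λ j → x k i j * (seq (s i) k * seq (t j) k))
    integral S T s t hs ht = (∑ λ i → ∑ λ j → value i j Real.* (s i Real.* t j)) ,
      (s , t , hs , ht ,
        refl-≤ (∑ λ i → ∑ λ j → value i j Real.* (s i Real.* t j)) ,
        refl-≤ (∑ λ i → ∑ λ j → value i j Real.* (s i Real.* t j))) ,
      seq-integral s t
      where
      refl-≤ : ∀ x → x Real.≤ x
      refl-≤ x ε 0<ε = 0 , λ n _ → ≤-byDifference (ℚ.<⇒≤ 0<ε) (lemma (seq x n) ε)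
        where
        lemma : ∀ a ε → ε - 0ℚ ≡ a + ε - a
        lemma = solve-∀ ring

    cutNorm⇒small : ∀ c → CutNorm≤ U (fromℚ c) → ∀ I J ε → 0ℚ < ε →
      Ev λ k → ∣ E rowMean (λ i → E colMean λ j → x k i j * (⟦ I i ⟧ * ⟦ J j ⟧)) ∣ ≤ c + ε
    cutNorm⇒small c small I J ε 0<ε =
      let z , isIntegral , seq-z = integral (R.cells I) (C.cells J) (λ i → fromℚ (⟦ I i ⟧ * u)) (λ j → fromℚ (⟦ J j ⟧ * v))
                                     (R.cells∩cell I) (C.cells∩cell J)
      in Ev-map
        (λ k → subst (λ d → ∣ d ∣ ≤ c + ε) (trans (seq-z k) (scaled (x k) (λ i → ⟦ I i ⟧) (λ j → ⟦ J j ⟧))))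
        (small (R.cells-measurable I) (C.cells-measurable J) {z} isIntegral ε 0<ε)
      where
      module R = CellMeasure rows
      module C = CellMeasure cols

    -- The weights are the measures of the traces of `S` and `T` on the cells, divided by the cell
    -- widths. They need not be exactly at most 1 at a finite stage of approximation; the bound 2
    -- holds eventually, by `cell-measure-bounded`, and for all of the finitely many cells at once.
    small⇒cutNorm : ∀ c →
      Ev (λ k → (s : Fin rows → ℚ) (t : Fin cols → ℚ) →
        (∀ i → ∣ s i ∣ ≤ 1ℚ + 1ℚ) → (∀ j → ∣ t j ∣ ≤ 1ℚ + 1ℚ) →
        ∣ E rowMean (λ i → E colMean λ j → x k i j * (s i * t j)) ∣ ≤ c) →
      CutNorm≤ U (fromℚ c)
    small⇒cutNorm c small {S} {T′} _ _ {z} (s , t , hs , ht , z≤ , ≤z) ε 0<ε = Ev-zip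
      (λ k bounded (p , p′) → ∣∣-≤
        (ℚ.≤-trans p (ℚ.+-monoˡ-≤ ε (ℚ.≤-trans (a≤∣a∣ (sumₖ k)) bounded)))
        (≤-byDifference (ℚ.+-mono-≤ p′ (ℚ.≤-trans (-a≤∣a∣ (sumₖ k)) bounded))
          (lemma (sumₖ k) (seq z k) c ε)))
      sum-bounded (Ev-zip (λ _ → _,_) upper lower)
      where
      module R = CellBound rows
      module C = CellBound cols
      sumₖ : ℕ → ℚ
      sumₖ k = sum λ i → sum λ j → x k i j * (seq (s i) k * seq (t j) k)
      upper : Ev λ k → seq z k ≤ sumₖ k + ε
      upper = Ev-map (λ k → subst (λ a → seq z k ≤ a + ε) (seq-integral s t k)) (z≤ ε 0<ε)
      lower : Ev λ k → sumₖ k ≤ seq z k + ε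
      lower = Ev-map (λ k → subst (_≤ seq z k + ε) (seq-integral s t k)) (≤z ε 0<ε)
      lemma : ∀ x z c ε → z + ε + c - (x + - x) ≡ c + ε - - z
      lemma = solve-∀ ring
      normalised : ∀ n .{{_ : NonZero n}} a → a ≡ a * ι n * 1/ι n
      normalised n a = sym (trans (ℚ.*-assoc a (ι n) (1/ι n))
        (trans (cong (a *_) (trans (ℚ.*-comm (ι n) (1/ι n)) (1/ι-* n))) (ℚ.*-identityʳ a)))
      weight : ∀ n .{{_ : NonZero n}} a → ∣ a ∣ ≤ 1/ι n + 1/ι n → ∣ a * ι n ∣ ≤ 1ℚ + 1ℚ
      weight n a p = ℚ.≤-trans (ℚ.≤-reflexive (trans (ℚ.∣p*q∣≡∣p∣*∣q∣ a (ι n))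
          (cong (∣ a ∣ *_) (ℚ.0≤p⇒∣p∣≡p (ι-nonNeg n)))))
        (ℚ.≤-trans (ℚ.*-monoʳ-≤-nonNeg (ι n) {{ℚ.nonNegative (ι-nonNeg n)}} p)
          (ℚ.≤-reflexive (trans (ℚ.*-distribʳ-+ (ι n) (1/ι n) (1/ι n)) (cong₂ _+_ (1/ι-* n) (1/ι-* n)))))
      bound : ∀ k → (∀ i → ∣ seq (s i) k ∣ ≤ u + u) → (∀ j → ∣ seq (t j) k ∣ ≤ v + v) →
        ((s : Fin rows → ℚ) (t : Fin cols → ℚ) →
          (∀ i → ∣ s i ∣ ≤ 1ℚ + 1ℚ) → (∀ j → ∣ t j ∣ ≤ 1ℚ + 1ℚ) →
          ∣ E rowMean (λ i → E colMean λ j → x k i j * (s i * t j)) ∣ ≤ c) →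
        ∣ sumₖ k ∣ ≤ c
      bound k sₖ tₖ smallₖ = subst (λ d → ∣ d ∣ ≤ c)
        (sym (trans
          (sum-cong-≗ λ i → sum-cong-≗ λ j → cong (x k i j *_)
            (cong₂ _*_ (normalised rows (seq (s i) k)) (normalised cols (seq (t j) k))))
          (scaled (x k) (λ i → seq (s i) k * ι rows) (λ j → seq (t j) k * ι cols))))
        (smallₖ (λ i → seq (s i) k * ι rows) (λ j → seq (t j) k * ι cols)
          (λ i → weight rows (seq (s i) k) (sₖ i)) (λ j → weight cols (seq (t j) k) (tₖ j)))
      sum-bounded : Ev λ k → ∣ sumₖ k ∣ ≤ c
      sum-bounded = Ev-zip (λ k sₖ (tₖ , smallₖ) → bound k sₖ tₖ smallₖ)
        (Ev-∀ λ i → R.cell-measure-bounded S i (s i) (hs i))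
        (Ev-zip (λ _ → _,_) (Ev-∀ λ j → C.cell-measure-bounded T′ j (t j) (ht j)) small)

open Graphon

-- Quasirandomness with the cut norm replaced by its discrete version, and the real `q` by its n-th
-- approximation in the n-th graph.
SmallDiscrepancy : {X Y : ℕ → Set} → (∀ n → Mean (X n)) → (∀ n → Mean (Y n)) →
                   (∀ n → X n → Y n → Bool) → ℝ → Set
SmallDiscrepancy M M′ b q = ∀ ε → 0ℚ < ε → Ev λ n → ∀ I J → ∣ discrepancy (M n) (M′ n) (b n) (seq q n) I J ∣ ≤ ε

module _ (W : StepFunction) (q : ℝ)
         (b : Fin (StepFunction.rows W) → Fin (StepFunction.cols W) → Bool)
         (represents : ∀ i j k → seq (StepFunction.value W i j) k ≡ ⟦ b i j ⟧) where

  private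
    x : ℕ → Fin (StepFunction.rows W) → Fin (StepFunction.cols W) → ℚ
    x k i j = ⟦ b i j ⟧ - seq q k

    value-seq : ∀ i j k → seq (StepFunction.value (W -const q) i j) k ≡ x k i j
    value-seq i j k = cong (_- seq q k) (represents i j k)

  cutNorm⇒discrepancy : ∀ c → CutNorm≤ (W -const q) (fromℚ c) → ∀ I J ε → 0ℚ < ε →
    Ev λ k → ∣ discrepancy (rowMean W) (colMean W) b (seq q k) I J ∣ ≤ c + ε
  cutNorm⇒discrepancy = cutNorm⇒small (W -const q) x value-seq

  discrepancy⇒cutNorm : ∀ c → Ev (λ k → ∀ I J → ∣ discrepancy (rowMean W) (colMean W) b (seq q k) I J ∣ ≤ c) →
    CutNorm≤ (W -const q) (fromℚ (fourfold (fourfold c)))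
  discrepancy⇒cutNorm c small = small⇒cutNorm (W -const q) x value-seq (fourfold (fourfold c))
    (Ev-map (λ k → discrepancy-weights (rowMean W) (colMean W) b (seq q k) c) small)

module _ (W : ℕ → StepFunction) (q : ℝ)
         (b : ∀ n → Fin (StepFunction.rows (W n)) → Fin (StepFunction.cols (W n)) → Bool)
         (represents : ∀ n i j k → seq (StepFunction.value (W n) i j) k ≡ ⟦ b n i j ⟧) where

  quasirandom⇒smallDiscrepancy : Quasirandom q W → SmallDiscrepancy (rowMean ∘ W) (colMean ∘ W) b q
  quasirandom⇒smallDiscrepancy qr ε 0<ε =
    -- One third each for the cut norm, for the slack in the inequality between reals, and for the
    -- change from `seq q k` to `seq q n`.
    let δ     = ⅓ * ε
        0<δ   = *-pos (ℚ.positive⁻¹ ⅓) 0<ε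
        M , cq = cauchy q δ 0<δ
        N , small = qr δ 0<δ
    in M ℕ.⊔ N , λ n MN≤n I J →
      let M≤n         = ℕ.m⊔n≤o⇒m≤o M N MN≤n
          k , M≤k , p = Ev-∃ (Ev-zip {λ k → M ℕ.≤ k} (λ k → _,_) (M , λ _ → id)
                          (cutNorm⇒discrepancy (W n) q (b n) (represents n) δ (small n (ℕ.m⊔n≤o⇒n≤o M N MN≤n)) I J δ 0<δ))
      in subst (∣ discrepancy (rowMean (W n)) (colMean (W n)) (b n) (seq q n) I J ∣ ≤_) (lemma ε)
           (discrepancy-near (rowMean (W n)) (colMean (W n)) (b n) (cq k n M≤k M≤n) I J p)
    where
    lemma : ∀ ε → ⅓ * ε + ⅓ * ε + ⅓ * ε ≡ ε
    lemma = solve-∀ ring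

  private
    cutNorm-cong : ∀ W {c c′} → c ≡ c′ → CutNorm≤ (W -const q) (fromℚ c) → CutNorm≤ (W -const q) (fromℚ c′)
    cutNorm-cong W refl p = p

  smallDiscrepancy⇒quasirandom : SmallDiscrepancy (rowMean ∘ W) (colMean ∘ W) b q → Quasirandom q W
  smallDiscrepancy⇒quasirandom small ε 0<ε =
    -- The discrepancy and the change of approximation cost δ each, and the two applications of
    -- `fourfold` multiply by 16.
    let δ     = ℤ.+ 1 / 32 * ε
        0<δ   = *-pos (ℚ.positive⁻¹ (ℤ.+ 1 / 32)) 0<ε
        M , cq = cauchy q δ 0<δ
        N , smallₙ = small δ 0<δ
    in M ℕ.⊔ N , λ n MN≤n → cutNorm-cong (W n) (lemma ε) (discrepancy⇒cutNorm (W n) q (b n) (represents n) (δ + δ)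
      (M , λ k M≤k I J → discrepancy-near (rowMean (W n)) (colMean (W n)) (b n)
        (cq n k (ℕ.m⊔n≤o⇒m≤o M N MN≤n) M≤k) I J (smallₙ n (ℕ.m⊔n≤o⇒n≤o M N MN≤n) I J)))
    where
    lemma : ∀ ε → (let a = ℤ.+ 1 / 32 * ε + ℤ.+ 1 / 32 * ε ; b = a + a + (a + a) in b + b + (b + b)) ≡ ε
    lemma = solve-∀ ring

-- Densities as means of products

⟦∧⟧ : ∀ a b → ⟦ a ∧ b ⟧ ≡ ⟦ a ⟧ * ⟦ b ⟧
⟦∧⟧ true  b = sym (ℚ.*-identityˡ ⟦ b ⟧)
⟦∧⟧ false b = sym (ℚ.*-zeroˡ ⟦ b ⟧)

prod : ∀ {n} → (Fin n → ℚ) → ℚ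
prod = Vector.foldr _*_ 1ℚ

prod-cong : ∀ {n} {f g : Fin n → ℚ} → (∀ i → f i ≡ g i) → prod f ≡ prod g
prod-cong {zero}  eq = refl
prod-cong {suc n} eq = cong₂ _*_ (eq zero) (prod-cong (eq ∘ suc))

prod-1 : ∀ n → prod {n} (λ _ → 1ℚ) ≡ 1ℚ
prod-1 zero    = refl
prod-1 (suc n) = trans (ℚ.*-identityˡ (prod {n} (λ _ → 1ℚ))) (prod-1 n)

prod-all : ∀ {n} {P : Fin n → Set} (P? : ∀ i → Dec (P i)) →
           ⟦ does (Fin.all? P?) ⟧ ≡ prod (λ i → ⟦ does (P? i) ⟧)
prod-all {zero}  P? = refl
prod-all {suc n} P? = trans (⟦∧⟧ (does (P? zero)) (does (Fin.all? (P? ∘ suc))))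
  (cong (⟦ does (P? zero) ⟧ *_) (prod-all (P? ∘ suc)))

sum-↑ : ∀ m {n} (f : Fin (m ℕ.+ n) → ℚ) → sum f ≡ sum (λ i → f (i ↑ˡ n)) + sum (λ j → f (m ↑ʳ j))
sum-↑ zero    f = sym (ℚ.+-identityˡ (sum f))
sum-↑ (suc m) f = trans (cong (f zero +_) (sum-↑ m (f ∘ suc))) (sym (ℚ.+-assoc (f zero) _ _))

sum-combine : ∀ m {n} (f : Fin (m ℕ.* n) → ℚ) → sum f ≡ sum (λ (i : Fin m) → sum λ (j : Fin n) → f (combine i j))
sum-combine zero        f = refl
sum-combine (suc m) {n} f = trans (sum-↑ n f) (cong (sum (λ j → f (j ↑ˡ (m ℕ.* n))) +_)
  (sum-combine m (λ i → f (n ↑ʳ i))))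

finToFun-combine : ∀ {m n} i (k : Fin (n ℕ.^ m)) v →
                   finToFun {n} {suc m} (combine i k) v ≡ (i Vector.∷ finToFun k) v
finToFun-combine {m} {n} i k zero    = cong proj₁ (Fin.remQuot-combine i k)
finToFun-combine {m} {n} i k (suc v) = cong (λ p → finToFun (proj₂ p) v) (Fin.remQuot-combine i k)

-- Induction on the number of vertices, splitting off the value at the first one. For bipartite
-- targets `c v` is the indicator of the part prescribed for `v` and `N v` the size of that part;
-- for oriented targets `c` is 1.
sum-finToFun : ∀ {m n} (c : Fin m → Fin n → ℚ) (N : Fin m → ℚ) (M : Fin m → Mean (Fin n)) →
  (∀ v g → sum (λ i → c v i * g i) ≡ N v * E (M v) g) → ∀ {F} → Extensional F →
  sum (λ k → prod (λ v → c v (finToFun k v)) * F (finToFun k)) ≡ prod N * E (Π M) F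
sum-finToFun {zero}      c N M eq {F} ext = trans (ℚ.+-identityʳ (1ℚ * F (finToFun zero)))
  (cong (1ℚ *_) (ext λ ()))
sum-finToFun {suc m} {n} c N M eq {F} ext = begin
  sum (λ k → G (finToFun k))
    ≡⟨ sum-combine n (λ k → G (finToFun k)) ⟩
  sum (λ (i : Fin n) → sum λ (k : Fin (n ℕ.^ m)) → G (finToFun (combine i k)))
    ≡⟨ (sum-cong-≗ λ i → trans (sum-cong-≗ λ k → trans (G-ext (finToFun-combine i k))
          (ℚ.*-assoc (c zero i) (rest k) (F (i Vector.∷ finToFun k))))
        (sym (*-distribˡ-sum (c zero i) (λ k → rest k * F (i Vector.∷ finToFun k))))) ⟩
  sum (λ i → c zero i * sum λ k → rest k * F (i Vector.∷ finToFun k))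
    ≡⟨ (sum-cong-≗ λ i → cong (c zero i *_)
         (sum-finToFun (c ∘ suc) (N ∘ suc) (M ∘ suc) (eq ∘ suc) (ext ∘ ∷-cong i))) ⟩
  sum (λ i → c zero i * (prod (N ∘ suc) * E (Π (M ∘ suc)) λ f → F (i Vector.∷ f)))
    ≡⟨ eq zero (λ i → prod (N ∘ suc) * E (Π (M ∘ suc)) λ f → F (i Vector.∷ f)) ⟩
  N zero * E (M zero) (λ i → prod (N ∘ suc) * E (Π (M ∘ suc)) λ f → F (i Vector.∷ f))
    ≡⟨ cong (N zero *_) (E-* (M zero) (prod (N ∘ suc)) λ i → E (Π (M ∘ suc)) λ f → F (i Vector.∷ f)) ⟩
  N zero * (prod (N ∘ suc) * E (Π M) F)
    ≡⟨ ℚ.*-assoc (N zero) (prod (N ∘ suc)) (E (Π M) F) ⟨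
  prod N * E (Π M) F ∎
  where
  open ≡-Reasoning
  G : (Fin (suc m) → Fin n) → ℚ
  G f = prod (λ v → c v (f v)) * F f
  rest : Fin (n ℕ.^ m) → ℚ
  rest k = prod (λ v → c (suc v) (finToFun k v))
  G-ext : Extensional G
  G-ext f≗g = cong₂ _*_ (prod-cong λ v → cong (c v) (f≗g v)) (ext f≗g)

sum-uniform : ∀ n .{{_ : NonZero n}} f → sum f ≡ ι n * E (uniform n) f
sum-uniform n f = sym (begin
  ι n * (1/ι n * sum f)    ≡⟨ ℚ.*-assoc (ι n) (1/ι n) (sum f) ⟨
  ι n * 1/ι n * sum f      ≡⟨ cong (_* sum f) (trans (ℚ.*-comm (ι n) (1/ι n)) (1/ι-* n)) ⟩
  1ℚ * sum f               ≡⟨ ℚ.*-identityˡ (sum f) ⟩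
  sum f                    ∎)
  where open ≡-Reasoning

uniform-combine : ∀ m n .{{_ : NonZero m}} .{{_ : NonZero n}} .{{_ : NonZero (m ℕ.* n)}} →
                  uniform (m ℕ.* n) ≋ push (uncurry combine) (uniform m ⊗ uniform n)
uniform-combine m n f = *-cancelʳ (ι (m ℕ.* n)) (ι-pos (m ℕ.* n)) (begin
  E (uniform (m ℕ.* n)) f * ι (m ℕ.* n)          ≡⟨ ℚ.*-comm _ (ι (m ℕ.* n)) ⟩
  ι (m ℕ.* n) * E (uniform (m ℕ.* n)) f          ≡⟨ sum-uniform (m ℕ.* n) f ⟨
  sum f                                          ≡⟨ sum-combine m f ⟩
  sum (λ (i : Fin m) → sum λ (j : Fin n) → f (combine i j))          ≡⟨ sum-uniform m (λ (i : Fin m) → sum λ (j : Fin n) → f (combine i j)) ⟩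
  ι m * E (uniform m) (λ (i : Fin m) → sum λ (j : Fin n) → f (combine i j))
    ≡⟨ cong (ι m *_) (E-cong (uniform m) λ i → sum-uniform n (λ (j : Fin n) → f (combine i j))) ⟩
  ι m * E (uniform m) (λ i → ι n * E (uniform n) λ j → f (combine i j))
    ≡⟨ cong (ι m *_) (E-* (uniform m) (ι n) λ (i : Fin m) → E (uniform n) λ (j : Fin n) → f (combine i j)) ⟩
  ι m * (ι n * e)                                ≡⟨ lemma (ι m) (ι n) e ⟩
  e * (ι m * ι n)                                ≡⟨ cong (e *_) (ι-* m n) ⟨
  e * ι (m ℕ.* n)                                ∎)
  where
  open ≡-Reasoning
  e = E (push (uncurry combine) (uniform m ⊗ uniform n)) f
  lemma : ∀ a b c → a * (b * c) ≡ c * (a * b)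
  lemma = solve-∀ ring

prod-ι : ∀ m n .{{_ : NonZero n}} → prod {m} (λ _ → ι n) ≡ ι (n ℕ.^ m)
prod-ι zero    n = sym ι-1
prod-ι (suc m) n = trans (cong (ι n *_) (prod-ι m n)) (sym (ι-* n (n ℕ.^ m)))

sum-functions : ∀ m n .{{_ : NonZero n}} {F} → Extensional F →
                sum (λ k → F (finToFun {n} {m} k)) ≡ ι (n ℕ.^ m) * E (Π {m} (λ _ → uniform n)) F
sum-functions m n {F} ext = begin
  sum (λ k → F (finToFun {n} {m} k))
    ≡⟨ (sum-cong-≗ λ k → sym (trans (cong (_* F (finToFun {n} {m} k)) (prod-1 m)) (ℚ.*-identityˡ _))) ⟩
  sum (λ k → prod {m} (λ _ → 1ℚ) * F (finToFun {n} {m} k))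
    ≡⟨ sum-finToFun (λ _ _ → 1ℚ) (λ _ → ι n) (λ _ → uniform n)
         (λ _ g → trans (sum-cong-≗ λ i → ℚ.*-identityˡ (g i)) (sum-uniform n g)) ext ⟩
  prod {m} (λ _ → ι n) * E (Π {m} (λ _ → uniform n)) F
    ≡⟨ cong (_* E (Π {m} (λ _ → uniform n)) F) (prod-ι m n) ⟩
  ι (n ℕ.^ m) * E (Π {m} (λ _ → uniform n)) F ∎
  where open ≡-Reasoning

uniform-functions : ∀ m n .{{_ : NonZero n}} .{{_ : NonZero (n ℕ.^ m)}} {F} → Extensional F →
                    E (uniform (n ℕ.^ m)) (λ k → F (finToFun {n} {m} k)) ≡ E (Π {m} (λ _ → uniform n)) F
uniform-functions m n {F} ext = *-cancelʳ (ι (n ℕ.^ m)) (ι-pos (n ℕ.^ m))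
  (trans (ℚ.*-comm _ (ι (n ℕ.^ m))) (trans (sym (sum-uniform (n ℕ.^ m) (λ k → F (finToFun {n} {m} k))))
    (trans (sum-functions m n ext) (ℚ.*-comm (ι (n ℕ.^ m)) _))))

ι-length-filter : ∀ {n} {A : Set} {P : A → Set} (P? : ∀ x → Dec (P x)) (f : Fin n → A) →
                  ι (List.length (List.filter P? (List.tabulate f))) ≡ sum (λ i → ⟦ does (P? (f i)) ⟧)
ι-length-filter {zero}  P? f = ι-0
ι-length-filter {suc n} P? f with does (P? (f zero))
... | true  = trans (ι-suc _) (cong (1ℚ +_) (ι-length-filter P? (f ∘ suc)))
... | false = trans (ι-length-filter P? (f ∘ suc)) (sym (ℚ.+-identityˡ _))

ι-#maps : ∀ {m n} {P : (Fin m → Fin n) → Set} (P? : ∀ f → Dec (P f)) →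
          ι (#maps P?) ≡ sum (λ k → ⟦ does (P? (finToFun k)) ⟧)
ι-#maps P? = ι-length-filter (λ k → P? (finToFun k)) id

sum-filter : ∀ {n} {A : Set} {P : A → Set} (P? : ∀ x → Dec (P x)) (f : Fin n → A) (g : A → ℚ) →
  sum (λ i → ⟦ does (P? (f i)) ⟧ * g (f i)) ≡
  sum (λ j → g (List.lookup (List.filter P? (List.tabulate f)) j))
sum-filter {zero}  P? f g = refl
sum-filter {suc n} P? f g with does (P? (f zero))
... | true  = cong₂ _+_ (ℚ.*-identityˡ (g (f zero))) (sum-filter P? (f ∘ suc) g)
... | false = trans (cong₂ _+_ (ℚ.*-zeroˡ (g (f zero))) (sum-filter P? (f ∘ suc) g)) (ℚ.+-identityˡ _)

/-unique : ∀ a b .{{_ : NonZero b}} {x} → ι a ≡ ι b * x → ℤ.+ a / b ≡ x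
/-unique a b {x} eq = *-cancelʳ (ι b) (ι-pos b) (begin
  (ℤ.+ a / b) * ι b        ≡⟨ cong (_* ι b) (/≡ a b) ⟩
  ι a * 1/ι b * ι b        ≡⟨ ℚ.*-assoc (ι a) (1/ι b) (ι b) ⟩
  ι a * (1/ι b * ι b)      ≡⟨ cong (ι a *_) (1/ι-* b) ⟩
  ι a * 1ℚ                 ≡⟨ ℚ.*-identityʳ (ι a) ⟩
  ι a                      ≡⟨ eq ⟩
  ι b * x                  ≡⟨ ℚ.*-comm (ι b) x ⟩
  x * ι b                  ∎)
  where open ≡-Reasoning

productOf : ∀ {A : Set} → (A → ℚ) → List A → ℚ
productOf f = List.foldr (λ x → f x *_) 1ℚ

productOf-cong : ∀ {A : Set} {f g : A → ℚ} → (∀ x → f x ≡ g x) → ∀ xs → productOf f xs ≡ productOf g xs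
productOf-cong eq []       = refl
productOf-cong eq (x ∷ xs) = cong₂ _*_ (eq x) (productOf-cong eq xs)

productOf-* : ∀ {A : Set} (f g : A → ℚ) xs → productOf (λ x → f x * g x) xs ≡ productOf f xs * productOf g xs
productOf-* f g []       = refl
productOf-* f g (x ∷ xs) = trans (cong (f x * g x *_) (productOf-* f g xs))
  (lemma (f x) (g x) (productOf f xs) (productOf g xs))
  where
  lemma : ∀ a b c d → a * b * (c * d) ≡ a * c * (b * d)
  lemma = solve-∀ ring

productOf-all : ∀ {A : Set} (p : A → Bool) xs → productOf (λ x → ⟦ p x ⟧) xs ≡ ⟦ Bool.all p xs ⟧
productOf-all p []       = refl
productOf-all p (x ∷ xs) = trans (cong (⟦ p x ⟧ *_) (productOf-all p xs)) (sym (⟦∧⟧ (p x) (Bool.all p xs)))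

edges : ∀ {m} → Relation m → List (Fin m × Fin m)
edges {m} R = List.filter (λ (x , y) → T? (R x y)) (List.cartesianProduct (List.allFin m) (List.allFin m))

∈-edges⁺ : ∀ {m} (R : Relation m) {x y} → T (R x y) → (x , y) ∈ edges R
∈-edges⁺ R {x} {y} xy = ∈.∈-filter⁺ (λ (x , y) → T? (R x y)) (∈.∈-cartesianProduct⁺ (∈.∈-allFin x) (∈.∈-allFin y)) xy

∈-edges⁻ : ∀ {m} (R : Relation m) {e} → e ∈ edges R → T (uncurry R e)
∈-edges⁻ R e∈ = proj₂ (∈.∈-filter⁻ (λ (x , y) → T? (R x y)) {xs = List.cartesianProduct (List.allFin _) (List.allFin _)} e∈)

-- A product over the list of edges, so that means can be evaluated edge by edge and the exponent
-- `e⃗ B` appears as the length of the list. The target is any type, so that vertices can be decoded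
-- into tuples.
hom : ∀ {m} {X : Set} → Relation m → (X → X → Bool) → (Fin m → X) → ℚ
hom R S f = productOf (λ (x , y) → ⟦ S (f x) (f y) ⟧) (edges R)

hom-ext : ∀ {m} {X : Set} (R : Relation m) (S : X → X → Bool) → Extensional (hom R S)
hom-ext R S f≗g = productOf-cong (λ (x , y) → cong₂ (λ a b → ⟦ S a b ⟧) (f≗g x) (f≗g y)) (edges R)

hom-does : ∀ {m n} (R : Relation m) (S : Relation n) f {P : Set} (P? : Dec P) →
           (P ⇔ IsHom R S f) → ⟦ does P? ⟧ ≡ hom R S f
hom-does R S f P? P⇔hom = trans
  (cong ⟦_⟧ (does-⇔ (mk⇔
    (λ p → All.all⁻ q (All.tabulate λ e∈ → Equivalence.to P⇔hom p _ _ (∈-edges⁻ R e∈)))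
    (λ h → Equivalence.from P⇔hom λ x y xy → All.lookup (All.all⁺ q (edges R) h) (∈-edges⁺ R xy)))
    P? (T? (Bool.all q (edges R)))))
  (sym (productOf-all q (edges R)))
  where
  q : Fin _ × Fin _ → Bool
  q (x , y) = S (f x) (f y)

module _ (B G : OrientedGraph) where
  private
    module B = OrientedGraph B
    module G = OrientedGraph G

  t-mean : t B G ≡ E (Π {B.size} (λ _ → uniform G.size)) (hom B.edge G.edge)
  t-mean = /-unique (#maps (isHom? B.edge G.edge)) (G.size ℕ.^ B.size) (begin
    ι (#maps (isHom? B.edge G.edge))
      ≡⟨ ι-#maps (isHom? B.edge G.edge) ⟩
    sum (λ k → ⟦ does (isHom? B.edge G.edge (finToFun k)) ⟧)
      ≡⟨ (sum-cong-≗ λ k → hom-does B.edge G.edge (finToFun k) (isHom? B.edge G.edge (finToFun k)) (mk⇔ id id)) ⟩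
    sum (λ k → hom B.edge G.edge (finToFun {G.size} {B.size} k))
      ≡⟨ sum-functions B.size G.size (hom-ext B.edge G.edge) ⟩
    ι (G.size ℕ.^ B.size) * E (Π {B.size} (λ _ → uniform G.size)) (hom B.edge G.edge) ∎)
    where
    open ≡-Reasoning
    instance _ = ℕ.m^n≢0 G.size B.size

module _ (H : BipartiteGraph) (ne : BipartiteGraph.NonEmptyParts H) where
  open BipartiteGraph H

  private
    ∈⇒length≢0 : ∀ {A : Set} {x : A} {xs} → x ∈ xs → NonZero (List.length xs)
    ∈⇒length≢0 {xs = _ ∷ _} _ = _

  part-nonZero : ∀ s → NonZero (List.length (vertices s))
  part-nonZero s = ∈⇒length≢0 (∈.∈-filter⁺ (λ v → part v Fin.≟ s) (∈.∈-allFin (proj₁ (ne s))) (proj₂ (ne s)))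

  partMean : Fin 2 → Mean (Fin size)
  partMean s = push (List.lookup (vertices s)) (uniform (List.length (vertices s)))
    where instance _ = part-nonZero s

  sum-part : ∀ s g → sum (λ i → ⟦ does (part i Fin.≟ s) ⟧ * g i) ≡ ι (List.length (vertices s)) * E (partMean s) g
  sum-part s g = trans (sum-filter (λ v → part v Fin.≟ s) id g)
    (sum-uniform (List.length (vertices s)) (λ i → g (List.lookup (vertices s) i)))
    where instance _ = part-nonZero s

  module _ (B : OrientedGraph) (h : ∃ (Hom-K⃗₂ B)) where
    private
      module B = OrientedGraph B
      A = underlying B h
      c : Fin B.size → Fin size → ℚ
      c v i = ⟦ does (part i Fin.≟ proj₁ h v) ⟧
      N : Fin B.size → ℚ
      N v = ι (List.length (vertices (proj₁ h v)))

      -- The underlying graph contains each edge of B in both directions; the reversed pair adds no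
      -- condition because `adj` is symmetric.
      hom⇔ : ∀ f → IsHom (BipartiteGraph.adj A) adj f ⇔ IsHom B.edge adj f
      hom⇔ f = mk⇔
        (λ p x y xy → p x y (Equivalence.from Bool.T-∨ (inj₁ xy)))
        (λ p x y xy → [ p x y , (λ yx → subst T (symmetric (f y) (f x)) (p y x yx)) ]′ (Equivalence.to Bool.T-∨ xy))

    ι-#respectsParts : ι (#maps (respectsParts? A H)) ≡ prod N
    ι-#respectsParts = begin
      ι (#maps (respectsParts? A H))                        ≡⟨ ι-#maps (respectsParts? A H) ⟩
      sum (λ k → ⟦ does (respectsParts? A H (finToFun k)) ⟧)
        ≡⟨ (sum-cong-≗ λ k → trans (prod-all (λ v → part (finToFun k v) Fin.≟ proj₁ h v)) (sym (ℚ.*-identityʳ _))) ⟩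
      sum (λ k → prod (λ v → c v (finToFun k v)) * 1ℚ)
        ≡⟨ sum-finToFun c N (partMean ∘ proj₁ h) (sum-part ∘ proj₁ h) (λ _ → refl) ⟩
      prod N * E (Π (partMean ∘ proj₁ h)) (λ _ → 1ℚ)        ≡⟨ cong (prod N *_) (E-1 (Π (partMean ∘ proj₁ h))) ⟩
      prod N * 1ℚ                                           ≡⟨ ℚ.*-identityʳ (prod N) ⟩
      prod N                                                ∎
      where open ≡-Reasoning

    t-bip-mean : t-bip A H ne ≡ E (Π (partMean ∘ proj₁ h)) (hom B.edge adj)
    t-bip-mean = /-unique (#maps P?) (#maps (respectsParts? A H)) (begin
      ι (#maps P?)                                          ≡⟨ ι-#maps P? ⟩
      sum (λ k → ⟦ does (P? (finToFun k)) ⟧)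
        ≡⟨ (sum-cong-≗ λ k → trans (⟦∧⟧ (does (respectsParts? A H (finToFun k))) (does (isHom? (BipartiteGraph.adj A) adj (finToFun k))))
             (cong₂ _*_ (prod-all (λ v → part (finToFun k v) Fin.≟ proj₁ h v))
               (hom-does B.edge adj (finToFun k) (isHom? (BipartiteGraph.adj A) adj (finToFun k)) (hom⇔ (finToFun k))))) ⟩
      sum (λ k → prod (λ v → c v (finToFun k v)) * hom B.edge adj (finToFun k))
        ≡⟨ sum-finToFun c N (partMean ∘ proj₁ h) (sum-part ∘ proj₁ h) (hom-ext B.edge adj) ⟩
      prod N * E (Π (partMean ∘ proj₁ h)) (hom B.edge adj)
        ≡⟨ cong (_* E (Π (partMean ∘ proj₁ h)) (hom B.edge adj)) ι-#respectsParts ⟨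
      ι (#maps (respectsParts? A H)) * E (Π (partMean ∘ proj₁ h)) (hom B.edge adj) ∎)
      where
      open ≡-Reasoning
      instance _ = #respectsParts-nonZero A H ne
      P? : ∀ f → Dec (RespectsParts A H f × IsHom (BipartiteGraph.adj A) adj f)
      P? f = respectsParts? A H f ×-dec isHom? (BipartiteGraph.adj A) adj f

ι-injective : ∀ {m n} → ι m ≡ ι n → m ≡ n
ι-injective {m} {n} eq = ℕ.≤-antisym (le eq) (le (sym eq))
  where
  le : ∀ {m n} → ι m ≡ ι n → m ℕ.≤ n
  le {m} {n} eq = ℕ.≮⇒≥ λ n<m → ℚ.<-irrefl refl (ℚ.<-≤-trans
    (subst₂ _<_ (ℚ.+-identityˡ (ι n)) (sym (ι-suc n)) (ℚ.+-monoˡ-< (ι n) 0<1))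
    (subst (ι (suc n) ≤_) eq (ι-mono n<m)))

ι-#pairs : ∀ {n} {P : Fin n × Fin n → Set} (P? : ∀ e → Dec (P e)) →
           ι (#pairs P?) ≡ sum (λ x → sum λ y → ⟦ does (P? (x , y)) ⟧)
ι-#pairs {n} P? = go id
  where
  go : ∀ {k} (f : Fin k → Fin n) →
       ι (List.length (List.filter P? (List.cartesianProduct (List.tabulate f) (List.allFin n)))) ≡
       sum (λ x → sum λ y → ⟦ does (P? (f x , y)) ⟧)
  go {zero}  f = ι-0
  go {suc k} f = begin
    ι (List.length (List.filter P? (row List.++ rest)))
      ≡⟨ cong (ι ∘ List.length) (List.filter-++ P? row rest) ⟩
    ι (List.length (List.filter P? row List.++ List.filter P? rest))
      ≡⟨ cong ι (List.length-++ (List.filter P? row)) ⟩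
    ι (List.length (List.filter P? row) ℕ.+ List.length (List.filter P? rest))
      ≡⟨ ι-+ (List.length (List.filter P? row)) _ ⟩
    ι (List.length (List.filter P? row)) + ι (List.length (List.filter P? rest))
      ≡⟨ cong₂ _+_ (trans (cong (ι ∘ List.length ∘ List.filter P?) (List.map-tabulate id (f zero ,_)))
           (ι-length-filter P? (f zero ,_))) (go (f ∘ suc)) ⟩
    sum (λ x → sum λ y → ⟦ does (P? (f x , y)) ⟧) ∎
    where
    open ≡-Reasoning
    row  = List.map (f zero ,_) (List.allFin n)
    rest = List.cartesianProduct (List.tabulate (f ∘ suc)) (List.allFin n)

-- An undirected edge with x < y is an edge of B in one direction or the other, but not both by
-- asymmetry. Exchanging the names of the variables in the second of the resulting sums collects all
-- directed edges again.
e-underlying : ∀ B h → BipartiteGraph.e (underlying B h) ≡ e⃗ B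
e-underlying B h = ι-injective (begin
  ι (BipartiteGraph.e (underlying B h))
    ≡⟨ ι-#pairs {size} (λ (x , y) → (x Fin.<? y) ×-dec T? (edge x y ∨ edge y x)) ⟩
  sum (λ x → sum λ y → ⟦ x <ᵇ y ∧ (edge x y ∨ edge y x) ⟧)
    ≡⟨ (sum-cong-≗ λ x → trans (sum-cong-≗ λ y → split x y)
         (∑-distrib-+ (λ y → ⟦ x <ᵇ y ⟧ * ⟦ edge x y ⟧) (λ y → ⟦ x <ᵇ y ⟧ * ⟦ edge y x ⟧))) ⟩
  sum (λ x → sum (λ y → ⟦ x <ᵇ y ⟧ * ⟦ edge x y ⟧) + sum (λ y → ⟦ x <ᵇ y ⟧ * ⟦ edge y x ⟧))
    ≡⟨ ∑-distrib-+ (λ x → sum (λ y → ⟦ x <ᵇ y ⟧ * ⟦ edge x y ⟧)) (λ x → sum λ y → ⟦ x <ᵇ y ⟧ * ⟦ edge y x ⟧) ⟩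
  sum (λ x → sum λ y → ⟦ x <ᵇ y ⟧ * ⟦ edge x y ⟧) + sum (λ x → sum λ y → ⟦ x <ᵇ y ⟧ * ⟦ edge y x ⟧)
    ≡⟨ cong (sum (λ x → sum λ y → ⟦ x <ᵇ y ⟧ * ⟦ edge x y ⟧) +_) (∑-comm (λ x y → ⟦ x <ᵇ y ⟧ * ⟦ edge y x ⟧)) ⟩
  sum (λ x → sum λ y → ⟦ x <ᵇ y ⟧ * ⟦ edge x y ⟧) + sum (λ x → sum λ y → ⟦ y <ᵇ x ⟧ * ⟦ edge x y ⟧)
    ≡⟨ ∑-distrib-+ (λ x → sum (λ y → ⟦ x <ᵇ y ⟧ * ⟦ edge x y ⟧)) (λ x → sum λ y → ⟦ y <ᵇ x ⟧ * ⟦ edge x y ⟧) ⟨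
  sum (λ x → sum (λ y → ⟦ x <ᵇ y ⟧ * ⟦ edge x y ⟧) + sum (λ y → ⟦ y <ᵇ x ⟧ * ⟦ edge x y ⟧))
    ≡⟨ (sum-cong-≗ λ x → trans
         (sym (∑-distrib-+ (λ y → ⟦ x <ᵇ y ⟧ * ⟦ edge x y ⟧) (λ y → ⟦ y <ᵇ x ⟧ * ⟦ edge x y ⟧)))
         (sum-cong-≗ λ y → merge x y)) ⟩
  sum (λ x → sum λ y → ⟦ edge x y ⟧)
    ≡⟨ ι-#pairs {size} (λ (x , y) → T? (edge x y)) ⟨
  ι (e⃗ B) ∎)
  where
  open ≡-Reasoning
  open OrientedGraph B
  _<ᵇ_ : Fin size → Fin size → Bool
  x <ᵇ y = does (x Fin.<? y)

  disjoint : ∀ a b c → (T b → T c → ⊥) → ⟦ a ∧ (b ∨ c) ⟧ ≡ ⟦ a ⟧ * ⟦ b ⟧ + ⟦ a ⟧ * ⟦ c ⟧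
  disjoint true  true  true  p = contradiction tt (p tt)
  disjoint true  true  false p = refl
  disjoint true  false true  p = refl
  disjoint true  false false p = refl
  disjoint false true  true  p = refl
  disjoint false true  false p = refl
  disjoint false false true  p = refl
  disjoint false false false p = refl

  split : ∀ x y → ⟦ x <ᵇ y ∧ (edge x y ∨ edge y x) ⟧ ≡ ⟦ x <ᵇ y ⟧ * ⟦ edge x y ⟧ + ⟦ x <ᵇ y ⟧ * ⟦ edge y x ⟧
  split x y = disjoint (x <ᵇ y) (edge x y) (edge y x) (asymmetric x y)

  edge-irrefl : ∀ x y → x ≡ y → edge x y ≡ false
  edge-irrefl x .x refl with edge x x in eq
  ... | true  = contradiction (subst T (sym eq) tt) (asymmetric x x (subst T (sym eq) tt))
  ... | false = refl

  merge : ∀ x y → ⟦ x <ᵇ y ⟧ * ⟦ edge x y ⟧ + ⟦ y <ᵇ x ⟧ * ⟦ edge x y ⟧ ≡ ⟦ edge x y ⟧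
  merge x y with Fin.<-cmp x y
  ... | tri< x<y _ y≮x = trans (cong₂ (λ a b → ⟦ a ⟧ * e + ⟦ b ⟧ * e) (dec-true (x Fin.<? y) x<y) (dec-false (y Fin.<? x) y≮x)) (lemma e)
    where
    e = ⟦ edge x y ⟧
    lemma : ∀ e → 1ℚ * e + 0ℚ * e ≡ e
    lemma = solve-∀ ring
  ... | tri> x≮y _ y<x = trans (cong₂ (λ a b → ⟦ a ⟧ * e + ⟦ b ⟧ * e) (dec-false (x Fin.<? y) x≮y) (dec-true (y Fin.<? x) y<x)) (lemma e)
    where
    e = ⟦ edge x y ⟧
    lemma : ∀ e → 0ℚ * e + 1ℚ * e ≡ e
    lemma = solve-∀ ring
  ... | tri≈ _ x≡y _ = trans (cong (λ b → ⟦ x <ᵇ y ⟧ * ⟦ b ⟧ + ⟦ y <ᵇ x ⟧ * ⟦ b ⟧) (edge-irrefl x y x≡y))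
                         (trans (lemma ⟦ x <ᵇ y ⟧ ⟦ y <ᵇ x ⟧) (cong ⟦_⟧ (sym (edge-irrefl x y x≡y))))
    where
    lemma : ∀ a b → a * 0ℚ + b * 0ℚ ≡ 0ℚ
    lemma = solve-∀ ring

-- A quasirandom tournament

isOne : Fin 2 → Bool
isOne zero    = false
isOne (suc _) = true

isOne-opposite : ∀ b → isOne (opposite b) ≡ not (isOne b)
isOne-opposite zero       = refl
isOne-opposite (suc zero) = refl

bit-symmetric : ∀ f → E (uniform 2) f ≡ E (uniform 2) (f ∘ opposite)
bit-symmetric f = cong (1/ι 2 *_) (lemma (f zero) (f (suc zero)))
  where
  lemma : ∀ a b → a + (b + 0ℚ) ≡ b + (a + 0ℚ)
  lemma = solve-∀ ring

updateAt-∷-zero : ∀ {A : Set} {n} (x : A) (xs : Fin n → A) (f : A → A) j →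
                  (f x Vector.∷ xs) j ≡ Vector.updateAt (x Vector.∷ xs) zero f j
updateAt-∷-zero x xs f zero    = refl
updateAt-∷-zero x xs f (suc j) = refl

updateAt-∷-suc : ∀ {A : Set} {n} (x : A) (xs : Fin n → A) i (f : A → A) j →
                 (x Vector.∷ Vector.updateAt xs i f) j ≡ Vector.updateAt (x Vector.∷ xs) (suc i) f j
updateAt-∷-suc x xs i f zero    = refl
updateAt-∷-suc x xs i f (suc j) = refl

flip-symmetric : ∀ {M} i {F} → Extensional F →
  E (Π {M} (λ _ → uniform 2)) F ≡ E (Π {M} (λ _ → uniform 2)) (λ φ → F (Vector.updateAt φ i opposite))
flip-symmetric {suc M} zero {F} ext = trans
  (bit-symmetric λ b → E (Π {M} (λ _ → uniform 2)) λ φ → F (b Vector.∷ φ))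
  (E-cong (uniform 2) λ b → E-cong (Π {M} (λ _ → uniform 2)) λ φ → ext (updateAt-∷-zero b φ opposite))
flip-symmetric {suc M} (suc i) {F} ext = E-cong (uniform 2) λ b →
  trans (flip-symmetric i (ext ∘ ∷-cong b))
    (E-cong (Π {M} (λ _ → uniform 2)) λ φ → ext (updateAt-∷-suc b φ i opposite))

Bits : ℕ → Set
Bits M = Fin M → Fin 2

-- Carried over from the numbering of bit vectors, because the vertices of the tournament have to be
-- numbered; `uniform-functions` identifies it with the mean over independent bits.
bitsMean : ∀ M → Mean (Bits M)
bitsMean M = push finToFun (uniform (2 ℕ.^ M))
  where instance _ = ℕ.m^n≢0 2 M

module _ {M : ℕ} where

  flipAt : ∀ {m} → Fin m × Fin M → (Fin m → Bits M) → Fin m → Bits M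
  flipAt (v , i) φs = Vector.updateAt φs v (λ φ → Vector.updateAt φ i opposite)

  flipAt-flips : ∀ {m} v i (φs : Fin m → Bits M) → flipAt (v , i) φs v i ≡ opposite (φs v i)
  flipAt-flips v i φs = trans
    (cong (λ φ → φ i) (Vector.updateAt-updates v {f = λ φ → Vector.updateAt φ i opposite} φs))
    (Vector.updateAt-updates i (φs v))

  flipAt-minimal : ∀ {m} e e′ (φs : Fin m → Bits M) → e ≢ e′ → uncurry (flipAt e φs) e′ ≡ uncurry φs e′
  flipAt-minimal (v , i) (v′ , i′) φs e≢e′ with v′ Fin.≟ v
  ... | no  v′≢v = cong (λ φ → φ i′) (Vector.updateAt-minimal v′ v {f = λ φ → Vector.updateAt φ i opposite} φs v′≢v)
  ... | yes refl = trans
    (cong (λ φ → φ i′) (Vector.updateAt-updates v {f = λ φ → Vector.updateAt φ i opposite} φs))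
    (Vector.updateAt-minimal i′ i (φs v) λ i′≡i → e≢e′ (cong (v ,_) (sym i′≡i)))

  -- Equality is pointwise at both levels, since a bit vector is itself a function.
  Extensional₂ : ∀ {m} → ((Fin m → Bits M) → ℚ) → Set
  Extensional₂ F = ∀ {f g} → (∀ v i → f v i ≡ g v i) → F f ≡ F g

  ∷-cong₂ : ∀ {m} (φ : Bits M) {f g : Fin m → Bits M} → (∀ v i → f v i ≡ g v i) →
            ∀ v i → (φ Vector.∷ f) v i ≡ (φ Vector.∷ g) v i
  ∷-cong₂ φ eq zero    i = refl
  ∷-cong₂ φ eq (suc v) i = eq v i

  bitsMean-symmetric : ∀ i {F} → Extensional F →
    E (bitsMean M) F ≡ E (bitsMean M) (λ φ → F (Vector.updateAt φ i opposite))
  bitsMean-symmetric i {F} ext = begin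
    E (bitsMean M) F
      ≡⟨ uniform-functions M 2 ext ⟩
    E (Π {M} (λ _ → uniform 2)) F
      ≡⟨ flip-symmetric i ext ⟩
    E (Π {M} (λ _ → uniform 2)) (λ φ → F (Vector.updateAt φ i opposite))
      ≡⟨ uniform-functions M 2 (λ f≗g → ext (updateAt-cong i f≗g)) ⟨
    E (bitsMean M) (λ φ → F (Vector.updateAt φ i opposite)) ∎
    where
    open ≡-Reasoning
    instance _ = ℕ.m^n≢0 2 M
    updateAt-cong : ∀ {n} (i : Fin n) {f g : Bits n} → (∀ j → f j ≡ g j) →
                    ∀ j → Vector.updateAt f i opposite j ≡ Vector.updateAt g i opposite j
    updateAt-cong zero    eq zero    = cong opposite (eq zero)
    updateAt-cong zero    eq (suc j) = eq (suc j)
    updateAt-cong (suc i) eq zero    = eq zero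
    updateAt-cong (suc i) eq (suc j) = updateAt-cong i (eq ∘ suc) j

  flipAt-symmetric : ∀ {m} (e : Fin m × Fin M) {F} → Extensional₂ F →
    E (Π {m} (λ _ → bitsMean M)) F ≡ E (Π {m} (λ _ → bitsMean M)) (F ∘ flipAt e)
  flipAt-symmetric {suc m} (zero , i) {F} ext = trans
    (bitsMean-symmetric i {λ φ → E (Π {m} (λ _ → bitsMean M)) λ φs → F (φ Vector.∷ φs)}
      (λ f≗g → E-cong (Π {m} (λ _ → bitsMean M)) λ φs → ext λ { zero i → f≗g i ; (suc v) i → refl }))
    (E-cong (bitsMean M) λ φ → E-cong (Π {m} (λ _ → bitsMean M)) λ φs →
      ext λ v j → cong (λ ψ → ψ j) (updateAt-∷-zero φ φs (λ φ → Vector.updateAt φ i opposite) v))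
  flipAt-symmetric {suc m} (suc v , i) {F} ext = E-cong (bitsMean M) λ φ →
    trans (flipAt-symmetric (v , i) (ext ∘ ∷-cong₂ φ))
      (E-cong (Π {m} (λ _ → bitsMean M)) λ φs →
        ext λ u j → cong (λ ψ → ψ j) (updateAt-∷-suc φ φs v (λ φ → Vector.updateAt φ i opposite) u))

  _≺_ : Fin M → Fin M → Bool
  a ≺ b = toℕ a ℕ.<ᵇ toℕ b

  ≺⇒< : ∀ a b → (a ≺ b) ≡ true → toℕ a ℕ.< toℕ b
  ≺⇒< a b eq = ℕ.<ᵇ⇒< (toℕ a) (toℕ b) (subst T (sym eq) tt)

  ≺-connex : ∀ a b → (a ≺ b) ≡ false → (b ≺ a) ≡ false → a ≡ b
  ≺-connex a b p q = Fin.toℕ-injective (ℕ.≤-antisym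
    (ℕ.≮⇒≥ λ b<a → subst T q (ℕ.<⇒<ᵇ b<a)) (ℕ.≮⇒≥ λ a<b → subst T p (ℕ.<⇒<ᵇ a<b)))

  -- The edge between different positions a < b is oriented by bit a of the
  -- vertex at b, so distinct pairs of positions use distinct bits.
  beats : Fin M × Bits M → Fin M × Bits M → Bool
  beats (a , φ) (b , ψ) =
    if a ≺ b then isOne (ψ a) else if b ≺ a then not (isOne (φ b)) else false

  beats-asymmetric : ∀ x y → T (beats x y) → ¬ T (beats y x)
  beats-asymmetric (a , φ) (b , ψ) with a ≺ b in p | b ≺ a in q
  ... | true  | true  = contradiction (≺⇒< b a q) (ℕ.<-asym (≺⇒< a b p))
  ... | true  | false = T-not (isOne (ψ a))
    where
    T-not : ∀ b → T b → ¬ T (not b)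
    T-not true _ ()
  ... | false | true  = T-not (isOne (φ b))
    where
    T-not : ∀ b → T (not b) → ¬ T b
    T-not false _ ()
  ... | false | false = λ ()

  module _ {m : ℕ} (a : Fin m → Fin M) where

    -- The coordinate that decides the edge between `x` and `y`, as a vertex of B and an index into
    -- its bit vector: the endpoint with the later position holds the bit, the earlier position is
    -- the index.
    bitOf : Fin m × Fin m → Fin m × Fin M
    bitOf (x , y) = if a x ≺ a y then (y , a x) else (x , a y)

    reading : Fin m × Fin m → Fin 2 → Bool
    reading (x , y) b = if a x ≺ a y then isOne b else not (isOne b)

    reading-opposite : ∀ e b → ⟦ reading e (opposite b) ⟧ ≡ 1ℚ - ⟦ reading e b ⟧
    reading-opposite (x , y) b with (a x ≺ a y)
    ... | true  = trans (cong ⟦_⟧ (isOne-opposite b)) (⟦not⟧ (isOne b))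
    ... | false = trans (cong (λ b → ⟦ not b ⟧) (isOne-opposite b)) (⟦not⟧ (not (isOne b)))

    beats-reading : ∀ x y (φs : Fin m → Bits M) → a x ≢ a y →
      beats (a x , φs x) (a y , φs y) ≡ reading (x , y) (uncurry φs (bitOf (x , y)))
    beats-reading x y φs ax≢ay with a x ≺ a y in p | a y ≺ a x in q
    ... | true  | _     = refl
    ... | false | true  = refl
    ... | false | false = contradiction (≺-connex (a x) (a y) p q) ax≢ay

    -- A coordinate names one endpoint and the position of the other; as positions are distinct, it
    -- determines the unordered pair. Only the reversed pair shares it.
    bitOf-injective : Injective _≡_ _≡_ a → ∀ x y x′ y′ → (x′ , y′) ≢ (y , x) →
                      bitOf (x , y) ≡ bitOf (x′ , y′) → (x , y) ≡ (x′ , y′)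
    bitOf-injective inj x y x′ y′ ≢swap eq with (a x ≺ a y) | (a x′ ≺ a y′)
    ... | true  | true  = let p , q = Product.,-injective eq in cong₂ _,_ (inj q) p
    ... | true  | false = let p , q = Product.,-injective eq in
                          contradiction (cong₂ _,_ (sym p) (sym (inj q))) ≢swap
    ... | false | true  = let p , q = Product.,-injective eq in
                          contradiction (cong₂ _,_ (sym (inj q)) (sym p)) ≢swap
    ... | false | false = let p , q = Product.,-injective eq in cong₂ _,_ p (inj q)

    homWithBits : List (Fin m × Fin m) → (Fin m → Bits M) → ℚ
    homWithBits es φs = productOf (λ (x , y) → ⟦ beats (a x , φs x) (a y , φs y) ⟧) es

    homWithBits-ext : ∀ es → Extensional₂ (homWithBits es)
    homWithBits-ext es {f} {g} eq = productOf-cong (λ (x , y) → cong ⟦_⟧ (beats-cong (a x) (a y) (eq x) (eq y))) es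
      where
      beats-cong : ∀ a b {φ φ′ ψ ψ′ : Bits M} → (∀ i → φ i ≡ φ′ i) → (∀ i → ψ i ≡ ψ′ i) →
                   beats (a , φ) (b , ψ) ≡ beats (a , φ′) (b , ψ′)
      beats-cong a b p q rewrite p b | q a = refl

    module _ (R : Relation m) (asym : ∀ x y → T (R x y) → ¬ T (R y x)) (inj : Injective _≡_ _≡_ a) where

      loopless : ∀ x y → T (R x y) → a x ≢ a y
      loopless x y xy ax≡ay with inj ax≡ay
      ... | refl = asym x x xy xy

      -- Flipping the bit of the first edge negates its indicator and leaves the
      -- indicators of the other edges unchanged.
      homWithBits-mean : ∀ es → All (T ∘ uncurry R) es → Unique es →
        E (Π {m} (λ _ → bitsMean M)) (homWithBits es) ≡ ½ ^ List.length es
      homWithBits-mean [] _ _ = E-1 (Π {m} (λ _ → bitsMean M))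
      homWithBits-mean (e@(x , y) ∷ es) (xy ∷ edgesₑₛ) (e∉es AllPairs.∷ unique) = begin
        𝔼 (λ φs → b φs * G φs)                     ≡⟨ halve (𝔼 λ φs → b φs * G φs) (𝔼 G) flipped ⟩
        ½ * 𝔼 G                                    ≡⟨ cong (½ *_) (homWithBits-mean es edgesₑₛ unique) ⟩
        ½ * ½ ^ List.length es                     ∎
        where
        open ≡-Reasoning
        𝔼 : ((Fin m → Bits M) → ℚ) → ℚ
        𝔼 = E (Π {m} (λ _ → bitsMean M))
        b G : (Fin m → Bits M) → ℚ
        b φs = ⟦ beats (a x , φs x) (a y , φs y) ⟧
        G = homWithBits es
        flip′ : (Fin m → Bits M) → Fin m → Bits M
        flip′ = flipAt (bitOf e)

        flipAt-flips′ : ∀ e φs → uncurry (flipAt e φs) e ≡ opposite (uncurry φs e)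
        flipAt-flips′ (v , i) = flipAt-flips v i

        b-flip : ∀ φs → b (flip′ φs) ≡ 1ℚ - b φs
        b-flip φs = begin
          b (flip′ φs)
            ≡⟨ cong ⟦_⟧ (beats-reading x y (flip′ φs) (loopless x y xy)) ⟩
          ⟦ reading e (uncurry (flip′ φs) (bitOf e)) ⟧
            ≡⟨ cong (λ c → ⟦ reading e c ⟧) (flipAt-flips′ (bitOf e) φs) ⟩
          ⟦ reading e (opposite (uncurry φs (bitOf e))) ⟧
            ≡⟨ reading-opposite e (uncurry φs (bitOf e)) ⟩
          1ℚ - ⟦ reading e (uncurry φs (bitOf e)) ⟧
            ≡⟨ cong (λ c → 1ℚ - ⟦ c ⟧) (beats-reading x y φs (loopless x y xy)) ⟨
          1ℚ - b φs ∎

        G-flip : ∀ φs → G (flip′ φs) ≡ G φs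
        G-flip φs = go es edgesₑₛ e∉es
          where
          go : ∀ es → All (T ∘ uncurry R) es → All (e ≢_) es → homWithBits es (flip′ φs) ≡ homWithBits es φs
          go []               _             _           = refl
          go ((x′ , y′) ∷ es) (x′y′ ∷ Res) (≢e ∷ e∉es) = cong₂ _*_ (cong ⟦_⟧ (begin
            beats (a x′ , flip′ φs x′) (a y′ , flip′ φs y′)
              ≡⟨ beats-reading x′ y′ (flip′ φs) (loopless x′ y′ x′y′) ⟩
            reading (x′ , y′) (uncurry (flip′ φs) (bitOf (x′ , y′)))
              ≡⟨ cong (reading (x′ , y′)) (flipAt-minimal (bitOf e) (bitOf (x′ , y′)) φs
                   -- The reverse of the edge `e` is not an edge, by asymmetry of `R`.
                   λ eq → ≢e (bitOf-injective inj x y x′ y′ (λ { refl → asym x y xy x′y′ }) eq)) ⟩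
            reading (x′ , y′) (uncurry φs (bitOf (x′ , y′)))
              ≡⟨ beats-reading x′ y′ φs (loopless x′ y′ x′y′) ⟨
            beats (a x′ , φs x′) (a y′ , φs y′) ∎)) (go es Res e∉es)

        flipped : 𝔼 (λ φs → b φs * G φs) ≡ 𝔼 G - 𝔼 (λ φs → b φs * G φs)
        flipped = begin
          𝔼 (λ φs → b φs * G φs)
            ≡⟨ flipAt-symmetric (bitOf e) (homWithBits-ext (e ∷ es)) ⟩
          𝔼 (λ φs → b (flip′ φs) * G (flip′ φs))
            ≡⟨ E-cong (Π {m} (λ _ → bitsMean M)) (λ φs → trans (cong₂ _*_ (b-flip φs) (G-flip φs)) (lemma (b φs) (G φs))) ⟩
          𝔼 (λ φs → G φs - b φs * G φs)
            ≡⟨ E-minus (Π {m} (λ _ → bitsMean M)) G (λ φs → b φs * G φs) ⟩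
          𝔼 G - 𝔼 (λ φs → b φs * G φs) ∎
          where
          lemma : ∀ b g → (1ℚ - b) * g ≡ g - b * g
          lemma = solve-∀ ring

        halve : ∀ p q → p ≡ q - p → p ≡ ½ * q
        halve p q eq = trans (lemma₁ p) (trans (cong (λ r → ½ * (p + r)) eq) (lemma₂ p q))
          where
          lemma₁ : ∀ p → p ≡ ½ * (p + p)
          lemma₁ = solve-∀ ring
          lemma₂ : ∀ p q → ½ * (p + (q - p)) ≡ ½ * q
          lemma₂ = solve-∀ ring

-- The number of pairs of vertices with equal positions, as a rational, so that its mean bounds the
-- probability that positions are not distinct.
collisions : ∀ {m M} → (Fin m → Fin M) → ℚ
collisions {zero}  a = 0ℚ
collisions {suc m} a = sum (λ y → ⟦ does (a zero Fin.≟ a (suc y)) ⟧) + collisions (a ∘ suc)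

⟦⟧-nonNeg : ∀ b → 0ℚ ≤ ⟦ b ⟧
⟦⟧-nonNeg true  = 0≤1
⟦⟧-nonNeg false = ℚ.≤-refl

⟦⟧≤1 : ∀ b → ⟦ b ⟧ ≤ 1ℚ
⟦⟧≤1 true  = ℚ.≤-refl
⟦⟧≤1 false = 0≤1

≤-+ˡ : ∀ {a b c} → 0ℚ ≤ c → a ≤ b → a ≤ b + c
≤-+ˡ {a} {b} {c} 0≤c a≤b = subst (_≤ b + c) (ℚ.+-identityʳ a) (ℚ.+-mono-≤ a≤b 0≤c)

≤-+ʳ : ∀ {a b c} → 0ℚ ≤ c → a ≤ b → a ≤ c + b
≤-+ʳ {a} {b} {c} 0≤c a≤b = subst (_≤ c + b) (ℚ.+-identityˡ a) (ℚ.+-mono-≤ 0≤c a≤b)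

sum-nonNeg : ∀ {n} (f : Fin n → ℚ) → (∀ i → 0ℚ ≤ f i) → 0ℚ ≤ sum f
sum-nonNeg {zero}  f p = ℚ.≤-refl
sum-nonNeg {suc n} f p = +-nonNeg (p zero) (sum-nonNeg (f ∘ suc) (p ∘ suc))

term≤sum : ∀ {n} (f : Fin n → ℚ) → (∀ i → 0ℚ ≤ f i) → ∀ i → f i ≤ sum f
term≤sum f p zero    = ≤-+ˡ (sum-nonNeg (f ∘ suc) (p ∘ suc)) ℚ.≤-refl
term≤sum f p (suc i) = ≤-+ʳ (p zero) (term≤sum (f ∘ suc) (p ∘ suc) i)

collisions-nonNeg : ∀ {m M} (a : Fin m → Fin M) → 0ℚ ≤ collisions a
collisions-nonNeg {zero}  a = ℚ.≤-refl
collisions-nonNeg {suc m} a = +-nonNeg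
  (sum-nonNeg (λ y → ⟦ does (a zero Fin.≟ a (suc y)) ⟧) (λ y → ⟦⟧-nonNeg (does (a zero Fin.≟ a (suc y)))))
  (collisions-nonNeg (a ∘ suc))

injective-or-collision : ∀ {m M} (a : Fin m → Fin M) → Injective _≡_ _≡_ a ⊎ 1ℚ ≤ collisions a
injective-or-collision {zero}  a = inj₁ λ { {()} }
injective-or-collision {suc m} a with Fin.any? (λ y → a zero Fin.≟ a (suc y)) | injective-or-collision (a ∘ suc)
... | yes (y , eq) | _          = inj₂ (≤-+ˡ (collisions-nonNeg (a ∘ suc))
  (subst (_≤ sum c) (cong ⟦_⟧ (dec-true (a zero Fin.≟ a (suc y)) eq))
    (term≤sum c (λ y → ⟦⟧-nonNeg (does (a zero Fin.≟ a (suc y)))) y)))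
  where
  c : Fin m → ℚ
  c y = ⟦ does (a zero Fin.≟ a (suc y)) ⟧
... | no  _        | inj₂ 1≤    = inj₂ (≤-+ʳ
  (sum-nonNeg (λ y → ⟦ does (a zero Fin.≟ a (suc y)) ⟧) (λ y → ⟦⟧-nonNeg (does (a zero Fin.≟ a (suc y))))) 1≤)
... | no  a₀≢      | inj₁ inj   = inj₁ λ
  { {zero}  {zero}  _  → refl
  ; {zero}  {suc y} eq → contradiction (y , eq) a₀≢
  ; {suc x} {zero}  eq → contradiction (x , sym eq) a₀≢
  ; {suc x} {suc y} eq → cong suc (inj eq)
  }

-- The binomial coefficient `m` choose 2.
pairs : ℕ → ℕ
pairs zero    = 0
pairs (suc m) = m ℕ.+ pairs m

E-sum : ∀ {X n} (M : Mean X) (f : Fin n → X → ℚ) → E M (λ x → sum λ y → f y x) ≡ sum λ y → E M (f y)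
E-sum {n = zero}  M f = E-const M 0ℚ
E-sum {n = suc n} M f = trans (E-+ M (f zero) (λ x → sum λ y → f (suc y) x)) (cong (E M (f zero) +_) (E-sum M (f ∘ suc)))

-- By linearity each of the `pairs m` pairs of vertices contributes the probability 1/M that their
-- positions coincide.
E-collisions : ∀ m M .{{_ : NonZero M}} → E (Π {m} (λ _ → uniform M)) collisions ≡ ι (pairs m) * 1/ι M
E-collisions zero    M = sym (trans (cong (_* 1/ι M) ι-0) (ℚ.*-zeroˡ (1/ι M)))
E-collisions (suc m) M = begin
  E (uniform M) (λ x → E P λ a → sum (λ y → ⟦ does (x Fin.≟ a y) ⟧) + collisions a)
    ≡⟨ E-cong (uniform M) (λ x → trans (E-+ P (λ a → sum λ y → ⟦ does (x Fin.≟ a y) ⟧) collisions)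
         (cong₂ _+_ (trans (E-sum P λ y a → ⟦ does (x Fin.≟ a y) ⟧)
             (trans (sum-cong-≗ {m} λ y → trans (Π-marginal (λ _ → uniform M) y λ i → ⟦ does (x Fin.≟ i) ⟧) (point x))
               (sum-const m (1/ι M))))
           (E-collisions m M))) ⟩
  E (uniform M) (λ _ → ι m * 1/ι M + ι (pairs m) * 1/ι M)
    ≡⟨ E-const (uniform M) (ι m * 1/ι M + ι (pairs m) * 1/ι M) ⟩
  ι m * 1/ι M + ι (pairs m) * 1/ι M
    ≡⟨ ℚ.*-distribʳ-+ (1/ι M) (ι m) (ι (pairs m)) ⟨
  (ι m + ι (pairs m)) * 1/ι M
    ≡⟨ cong (_* 1/ι M) (ι-+ m (pairs m)) ⟨
  ι (m ℕ.+ pairs m) * 1/ι M ∎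
  where
  open ≡-Reasoning
  P = Π {m} (λ _ → uniform M)
  point : ∀ x → E (uniform M) (λ i → ⟦ does (x Fin.≟ i) ⟧) ≡ 1/ι M
  point x = trans (cong (1/ι M *_) (trans
      (sum-single (λ i → ⟦ does (x Fin.≟ i) ⟧) x λ j j≢x → cong ⟦_⟧ (dec-false (x Fin.≟ j) (j≢x ∘ sym)))
      (cong ⟦_⟧ (dec-true (x Fin.≟ x) refl))))
    (ℚ.*-identityʳ (1/ι M))

module _ (M : ℕ) .{{_ : NonZero M}} where
  private
    instance
      2^M≢0 : NonZero (2 ℕ.^ M)
      2^M≢0 = ℕ.m^n≢0 2 M
      M*2^M≢0 : NonZero (M ℕ.* 2 ℕ.^ M)
      M*2^M≢0 = ℕ.m*n≢0 M (2 ℕ.^ M)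

  decode : Fin (M ℕ.* 2 ℕ.^ M) → Fin M × Bits M
  decode k = let a , φ = remQuot (2 ℕ.^ M) k in a , finToFun φ

  tournament : OrientedGraph
  tournament = record
    { size       = M ℕ.* 2 ℕ.^ M
    ; edge       = λ x y → beats (decode x) (decode y)
    ; asymmetric = λ x y → beats-asymmetric (decode x) (decode y)
    }

  decode-mean : push decode (uniform (M ℕ.* 2 ℕ.^ M)) ≋ uniform M ⊗ bitsMean M
  decode-mean f = trans (uniform-combine M (2 ℕ.^ M) (f ∘ decode))
    (E-cong (uniform M) λ a → E-cong (uniform (2 ℕ.^ M)) λ k →
      cong (λ (a , φ) → f (a , finToFun φ)) (Fin.remQuot-combine a k))

  module _ (B : OrientedGraph) where
    open OrientedGraph B

    private
      𝔼ₐ : ((Fin size → Fin M) → ℚ) → ℚ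
      𝔼ₐ = E (Π {size} (λ _ → uniform M))

      conditional : (Fin size → Fin M) → ℚ
      conditional a = E (Π {size} (λ _ → bitsMean M)) (homWithBits a (edges edge))

    t-tournament : t B tournament ≡ 𝔼ₐ conditional
    t-tournament = begin
      t B tournament
        ≡⟨ t-mean B tournament ⟩
      E (Π {size} (λ _ → uniform (M ℕ.* 2 ℕ.^ M))) (hom edge λ x y → beats (decode x) (decode y))
        ≡⟨ Π-push (λ _ → decode) (λ _ → uniform (M ℕ.* 2 ℕ.^ M)) (hom-ext edge beats) ⟨
      E (Π {size} (λ _ → push decode (uniform (M ℕ.* 2 ℕ.^ M)))) (hom edge beats)
        ≡⟨ Π-cong {size} (λ _ → decode-mean) (hom edge beats) ⟩
      E (Π {size} (λ _ → uniform M ⊗ bitsMean M)) (hom edge beats)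
        ≡⟨ Π-⊗ (λ _ → uniform M) (λ _ → bitsMean M) (hom-ext edge beats) ⟩
      𝔼ₐ conditional ∎
      where open ≡-Reasoning

    private
      edges-unique : Unique (edges edge)
      edges-unique = Unique.filter⁺ (λ (x , y) → T? (edge x y))
        (Unique.cartesianProduct⁺ (Unique.allFin⁺ size) (Unique.allFin⁺ size))

      -- With distinct positions the two numbers agree. Otherwise `collisions a` is at least 1, and
      -- both numbers lie between 0 and 1.
      conditional-close : ∀ a → ∣ conditional a - ½ ^ e⃗ B ∣ ≤ collisions a
      conditional-close a with injective-or-collision a
      ... | inj₁ inj = subst (_≤ collisions a) (sym (cong ∣_∣ (trans
              (cong (_- ½ ^ e⃗ B) (homWithBits-mean a edge asymmetric inj (edges edge)
                (All.tabulate λ e∈ → ∈-edges⁻ edge e∈) edges-unique))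
              (ℚ.+-inverseʳ (½ ^ e⃗ B))))) (collisions-nonNeg a)
      ... | inj₂ 1≤ = ℚ.≤-trans (∣∣-≤ (≤-byDifference (ℚ.+-mono-≤ conditional≤1 (ℚ.<⇒≤ (½^-pos (e⃗ B))))
                (lemma₁ (conditional a) (½ ^ e⃗ B)))
              (≤-byDifference (ℚ.+-mono-≤ (½^≤1 (e⃗ B)) 0≤conditional) (lemma₂ (conditional a) (½ ^ e⃗ B)))) 1≤
        where
        bounds : ∀ φs → 0ℚ ≤ homWithBits a (edges edge) φs × homWithBits a (edges edge) φs ≤ 1ℚ
        bounds φs = subst (λ p → 0ℚ ≤ p × p ≤ 1ℚ) (sym (productOf-all p (edges edge)))
          (⟦⟧-nonNeg (Bool.all p (edges edge)) , ⟦⟧≤1 (Bool.all p (edges edge)))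
          where
          p : Fin size × Fin size → Bool
          p (x , y) = beats (a x , φs x) (a y , φs y)
        conditional≤1 : conditional a ≤ 1ℚ
        conditional≤1 = E-≤ (Π {size} (λ _ → bitsMean M)) 1ℚ (proj₂ ∘ bounds)
        0≤conditional : 0ℚ ≤ conditional a
        0≤conditional = E-nonNeg (Π {size} (λ _ → bitsMean M)) (proj₁ ∘ bounds)
        ½^≤1 : ∀ n → ½ ^ n ≤ 1ℚ
        ½^≤1 zero    = ℚ.≤-refl
        ½^≤1 (suc n) = ≤-byDifference (ℚ.+-mono-≤ (½^≤1 n) (ℚ.<⇒≤ (½^-pos (suc n)))) (lemma (½ ^ n))
          where
          lemma : ∀ h → 1ℚ + ½ * h - (h + 0ℚ) ≡ 1ℚ - ½ * h
          lemma = solve-∀ ring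
        lemma₁ : ∀ c h → 1ℚ + h - (c + 0ℚ) ≡ 1ℚ - (c - h)
        lemma₁ = solve-∀ ring
        lemma₂ : ∀ c h → 1ℚ + c - (h + 0ℚ) ≡ 1ℚ - - (c - h)
        lemma₂ = solve-∀ ring

    t-tournament-close : ∣ t B tournament - ½ ^ e⃗ B ∣ ≤ ι (pairs size) * 1/ι M
    t-tournament-close = begin
      ∣ t B tournament - ½ ^ e⃗ B ∣
        ≡⟨ cong (λ p → ∣ p - ½ ^ e⃗ B ∣) t-tournament ⟩
      ∣ 𝔼ₐ conditional - ½ ^ e⃗ B ∣
        ≡⟨ cong (λ h → ∣ 𝔼ₐ conditional - h ∣) (E-const P (½ ^ e⃗ B)) ⟨
      ∣ 𝔼ₐ conditional - 𝔼ₐ (λ _ → ½ ^ e⃗ B) ∣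
        ≡⟨ cong ∣_∣ (E-minus P conditional (λ _ → ½ ^ e⃗ B)) ⟨
      ∣ 𝔼ₐ (λ a → conditional a - ½ ^ e⃗ B) ∣
        ≤⟨ ∣E∣≤ P (λ a → conditional a - ½ ^ e⃗ B) collisions conditional-close ⟩
      𝔼ₐ collisions
        ≡⟨ E-collisions size M ⟩
      ι (pairs size) * 1/ι M ∎
      where
      open ℚ.≤-Reasoning
      P = Π {size} (λ _ → uniform M)

t-tournament-limit : ∀ B → Null λ n → t B (tournament (suc n)) - ½ ^ e⃗ B
t-tournament-limit B = Null-≤
  (λ n → ℚ.≤-trans (t-tournament-close (suc n) B) (a≤∣a∣ _))
  (Null-scale (ι (pairs (OrientedGraph.size B))) 1/ι-Null)

-- ab - αβ = (a - α)(b - β) + α(b - β) + β(a - α), where a - α is bounded because it is null.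
Null-*-limit : ∀ {a α b β : ℕ → ℚ} → Bounded α → Bounded β →
  Null (λ n → a n - α n) → Null (λ n → b n - β n) → Null λ n → a n * b n - α n * β n
Null-*-limit {a} {α} {b} {β} α-bounded β-bounded a→α b→β = Null-cong
  (λ n → lemma (a n) (α n) (b n) (β n))
  (Null-+ (Null-* a-α-bounded b→β) (Null-+ (Null-* α-bounded b→β) (Null-* β-bounded a→α)))
  where
  a-α-bounded : Bounded λ n → a n - α n
  a-α-bounded = 1ℚ , 0<1 , a→α 1ℚ 0<1
  lemma : ∀ a α b β → (a - α) * (b - β) + (α * (b - β) + β * (a - α)) ≡ a * b - α * β
  lemma = solve-∀ ring

const-bounded : ∀ c → Bounded λ _ → c
const-bounded c = constBounded (∣ c ∣ + 1ℚ) (ℚ.+-mono-≤-< (ℚ.0≤∣p∣ c) 0<1) λ _ → ≤-+ˡ 0≤1 ℚ.≤-refl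

*-^ : ∀ a b e → (a * b) ^ e ≡ b ^ e * a ^ e
*-^ a b zero    = refl
*-^ a b (suc e) = trans (cong (a * b *_) (*-^ a b e)) (lemma a b (b ^ e) (a ^ e))
  where
  lemma : ∀ a b c d → a * b * (c * d) ≡ b * c * (a * d)
  lemma = solve-∀ ring

⟶-cong : ∀ {a b} x → (∀ n → a n ≡ b n) → a ⟶ x → b ⟶ x
⟶-cong x eq a⟶x ε 0<ε = Ev-map (λ n → subst (λ c → Real.∣ fromℚ c Real.- x ∣ Real.≤ fromℚ ε) (eq n)) (a⟶x ε 0<ε)

seq-indicator : ∀ b k → seq (if b then 1ℝ else 0ℝ) k ≡ ⟦ b ⟧
seq-indicator true  k = refl
seq-indicator false k = refl

K⃗₂-edge : ∀ a b → T (OrientedGraph.edge K⃗₂ a b) → a ≡ zero × b ≡ suc zero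
K⃗₂-edge zero       (suc zero) _ = refl , refl
K⃗₂-edge zero       zero       ()
K⃗₂-edge (suc zero) zero       ()
K⃗₂-edge (suc zero) (suc zero) ()

hom-cong : ∀ {m} {X Y : Set} (R : Relation m) (S : X → X → Bool) (S′ : Y → Y → Bool) f g →
  (∀ x y → T (R x y) → S (f x) (f y) ≡ S′ (g x) (g y)) → hom R S f ≡ hom R S′ g
hom-cong R S S′ f g eq = go (edges R) λ (x , y) e∈ → eq x y (∈-edges⁻ R e∈)
  where
  go : ∀ es → (∀ e → e ∈ es → S (f (proj₁ e)) (f (proj₂ e)) ≡ S′ (g (proj₁ e)) (g (proj₂ e))) →
       productOf (λ (x , y) → ⟦ S (f x) (f y) ⟧) es ≡ productOf (λ (x , y) → ⟦ S′ (g x) (g y) ⟧) es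
  go []       eq = refl
  go (e ∷ es) eq = cong₂ _*_ (cong ⟦_⟧ (eq e (here refl))) (go es λ e′ e′∈ → eq e′ (there e′∈))

module _ (B : OrientedGraph) (h : ∃ (Hom-K⃗₂ B)) where
  private module B = OrientedGraph B

  -- All edges go from the first part to the second, so S matters only there.
  hom-parts : ∀ {X Y : Set} (S : X → X → Bool) (S′ : Y → Y → Bool) (φ : Fin 2 → Y → X) →
    (∀ y y′ → S (φ zero y) (φ (suc zero) y′) ≡ S′ y y′) → ∀ f →
    hom B.edge S (λ v → φ (proj₁ h v) (f v)) ≡ hom B.edge S′ f
  hom-parts S S′ φ eq f = hom-cong B.edge S S′ (λ v → φ (proj₁ h v) (f v)) f λ x y xy →
    let hx≡0 , hy≡1 = K⃗₂-edge (proj₁ h x) (proj₁ h y) (proj₂ h x y xy)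
    in trans (cong₂ (λ s s′ → S (φ s (f x)) (φ s′ (f y))) hx≡0 hy≡1) (eq (f x) (f y))

  -- Both constructions present the two parts of H as images of one space: the vertices of G for the
  -- double cover, the pairs in U₁ × U₂ for the blow-up. All vertices of B can then be drawn from
  -- the same mean, as in a density of oriented graphs.
  t-bip-push : ∀ (H : BipartiteGraph) ne {Y : Set} (M : Mean Y) (φ : Fin 2 → Y → Fin (BipartiteGraph.size H)) →
    (∀ s → partMean H ne s ≋ push (φ s) M) → (S : Y → Y → Bool) →
    (∀ y y′ → BipartiteGraph.adj H (φ zero y) (φ (suc zero) y′) ≡ S y y′) →
    t-bip (underlying B h) H ne ≡ E (Π {B.size} (λ _ → M)) (hom B.edge S)
  t-bip-push H ne M φ parts S eq = begin
    t-bip (underlying B h) H ne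
      ≡⟨ t-bip-mean H ne B h ⟩
    E (Π (partMean H ne ∘ proj₁ h)) (hom B.edge adj)
      ≡⟨ Π-cong (parts ∘ proj₁ h) (hom B.edge adj) ⟩
    E (Π (λ v → push (φ (proj₁ h v)) M)) (hom B.edge adj)
      ≡⟨ Π-push (φ ∘ proj₁ h) (λ _ → M) (hom-ext B.edge adj) ⟩
    E (Π {B.size} (λ _ → M)) (λ f → hom B.edge adj (λ v → φ (proj₁ h v) (f v)))
      ≡⟨ E-cong (Π {B.size} (λ _ → M)) (hom-parts adj S φ eq) ⟩
    E (Π {B.size} (λ _ → M)) (hom B.edge S) ∎
    where
    open ≡-Reasoning
    open BipartiteGraph H using (adj)

-- Double covers

module DoubleCover (G : OrientedGraph) where
  open OrientedGraph G

  side : Fin size ⊎ Fin size → Fin 2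
  side (inj₁ _) = zero
  side (inj₂ _) = suc zero

  linked : Fin size ⊎ Fin size → Fin size ⊎ Fin size → Bool
  linked (inj₁ i) (inj₂ j) = edge i j
  linked (inj₂ j) (inj₁ i) = edge i j
  linked (inj₁ _) (inj₁ _) = false
  linked (inj₂ _) (inj₂ _) = false

  linked-symmetric : ∀ x y → linked x y ≡ linked y x
  linked-symmetric (inj₁ _) (inj₁ _) = refl
  linked-symmetric (inj₁ _) (inj₂ _) = refl
  linked-symmetric (inj₂ _) (inj₁ _) = refl
  linked-symmetric (inj₂ _) (inj₂ _) = refl

  linked-crossing : ∀ x y → T (linked x y) → side x ≢ side y
  linked-crossing (inj₁ _) (inj₂ _) _ ()
  linked-crossing (inj₂ _) (inj₁ _) _ ()

  split : Fin (size ℕ.+ size) → Fin size ⊎ Fin size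
  split = Fin.splitAt size

  private
    positive : ∀ n .{{_ : NonZero n}} → NonZero (n ℕ.+ n)
    positive (suc n) = _
    element : ∀ n .{{_ : NonZero n}} → Fin n
    element (suc n) = zero

  cover : BipartiteGraph
  cover = record
    { size      = size ℕ.+ size
    ; nonEmpty  = positive size
    ; adj       = λ x y → linked (split x) (split y)
    ; symmetric = λ x y → linked-symmetric (split x) (split y)
    ; part      = side ∘ split
    ; crossing  = λ x y → linked-crossing (split x) (split y)
    }

  copy : Fin 2 → Fin size → Fin (size ℕ.+ size)
  copy zero    i = i ↑ˡ size
  copy (suc _) i = size ↑ʳ i

  split-copy₁ : ∀ i → split (copy zero i) ≡ inj₁ i
  split-copy₁ i = Fin.splitAt-↑ˡ size i size

  split-copy₂ : ∀ i → split (copy (suc zero) i) ≡ inj₂ i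
  split-copy₂ i = Fin.splitAt-↑ʳ size size i

  part-copy : ∀ s i → side (split (copy s i)) ≡ s
  part-copy zero       i = cong side (split-copy₁ i)
  part-copy (suc zero) i = cong side (split-copy₂ i)

  nonEmptyParts : BipartiteGraph.NonEmptyParts cover
  nonEmptyParts s = copy s (element size) , part-copy s (element size)

  adj-copy : ∀ i j → BipartiteGraph.adj cover (copy zero i) (copy (suc zero) j) ≡ edge i j
  adj-copy i j = cong₂ linked (split-copy₁ i) (split-copy₂ j)

  sum-copy : ∀ s (g : Fin (size ℕ.+ size) → ℚ) → sum (λ x → ⟦ does (side (split x) Fin.≟ s) ⟧ * g x) ≡ sum (λ i → g (copy s i))
  sum-copy s g = trans (sum-↑ size (λ x → ⟦ does (side (split x) Fin.≟ s) ⟧ * g x)) (select s)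
    where
    term : ∀ s s′ → (Fin size → ℚ)
    term s s′ i = ⟦ does (side (split (copy s′ i)) Fin.≟ s) ⟧ * g (copy s′ i)
    same : ∀ s → sum (term s s) ≡ sum (λ i → g (copy s i))
    same s = sum-cong-≗ λ i → trans
      (cong (λ b → ⟦ b ⟧ * g (copy s i)) (dec-true (side (split (copy s i)) Fin.≟ s) (part-copy s i)))
      (ℚ.*-identityˡ (g (copy s i)))
    other : ∀ s s′ → s′ ≢ s → sum (term s s′) ≡ 0ℚ
    other s s′ s′≢s = sum-zero (term s s′) λ i → trans
      (cong (λ b → ⟦ b ⟧ * g (copy s′ i)) (dec-false (side (split (copy s′ i)) Fin.≟ s) (s′≢s ∘ trans (sym (part-copy s′ i)))))
      (ℚ.*-zeroˡ (g (copy s′ i)))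
    select : ∀ s → sum (term s zero) + sum (term s (suc zero)) ≡ sum (λ i → g (copy s i))
    select zero       = trans (cong₂ _+_ (same zero) (other zero (suc zero) λ ())) (ℚ.+-identityʳ _)
    select (suc zero) = trans (cong₂ _+_ (other (suc zero) zero λ ()) (same (suc zero))) (ℚ.+-identityˡ _)

  partMean-copy : ∀ s → partMean cover nonEmptyParts s ≋ push (copy s) (uniform size)
  partMean-copy s g = *-cancelʳ (ι size) (ι-pos size) (begin
    E M g * ι size      ≡⟨ ℚ.*-comm (E M g) (ι size) ⟩
    ι size * E M g      ≡⟨ cong (_* E M g) length≡size ⟨
    ι len * E M g       ≡⟨ weighted g ⟩
    ι size * E (uniform size) (g ∘ copy s)    ≡⟨ ℚ.*-comm (ι size) _ ⟩
    E (uniform size) (g ∘ copy s) * ι size    ∎)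
    where
    open ≡-Reasoning
    M = partMean cover nonEmptyParts s
    len = List.length (BipartiteGraph.vertices cover s)
    weighted : ∀ g → ι len * E M g ≡ ι size * E (uniform size) (g ∘ copy s)
    weighted g = trans (sym (sum-part cover nonEmptyParts s g)) (trans (sum-copy s g) (sum-uniform size (g ∘ copy s)))
    -- Evaluating `weighted` at the constant 1 yields the size of the part without computing the
    -- list of its vertices.
    length≡size : ι len ≡ ι size
    length≡size = begin
      ι len                                      ≡⟨ ℚ.*-identityʳ (ι len) ⟨
      ι len * 1ℚ                                 ≡⟨ cong (ι len *_) (E-1 M) ⟨
      ι len * E M (λ _ → 1ℚ)                     ≡⟨ weighted (λ _ → 1ℚ) ⟩
      ι size * E (uniform size) (λ _ → 1ℚ)       ≡⟨ cong (ι size *_) (E-1 (uniform size)) ⟩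
      ι size * 1ℚ                                ≡⟨ ℚ.*-identityʳ (ι size) ⟩
      ι size                                     ∎

  t-cover : ∀ B h → t-bip (underlying B h) cover nonEmptyParts ≡ t B G
  t-cover B h = trans
    (t-bip-push B h cover nonEmptyParts (uniform size) copy partMean-copy edge adj-copy)
    (sym (t-mean B G))

  original : Fin (size ℕ.+ size) → Fin size
  original x = [ id , id ]′ (split x)

  original-copy : ∀ s i → original (copy s i) ≡ i
  original-copy zero       i = cong [ id , id ]′ (split-copy₁ i)
  original-copy (suc zero) i = cong [ id , id ]′ (split-copy₂ i)

  -- Test sets on G are pulled back along `original`, which undoes `copy` on either part, so every
  -- pair of test sets on G arises.
  discrepancy-cover : ∀ q I J →
    discrepancy (partMean cover nonEmptyParts zero) (partMean cover nonEmptyParts (suc zero))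
      (BipartiteGraph.adj cover) q (I ∘ original) (J ∘ original) ≡
    discrepancy (uniform size) (uniform size) edge q I J
  discrepancy-cover q I J = begin
    E M₁ (λ x → E M₂ λ y → D (adj x y) (I (original x)) (J (original y)))
      ≡⟨ partMean-copy zero (λ x → E M₂ λ y → D (adj x y) (I (original x)) (J (original y))) ⟩
    E (uniform size) (λ i → E M₂ λ y → D (adj (copy zero i) y) (I (original (copy zero i))) (J (original y)))
      ≡⟨ E-cong (uniform size) (λ i → trans
           (partMean-copy (suc zero) (λ y → D (adj (copy zero i) y) (I (original (copy zero i))) (J (original y))))
           (E-cong (uniform size) λ j → trans
             (cong (λ b → D b (I (original (copy zero i))) (J (original (copy (suc zero) j)))) (adj-copy i j))
             (cong₂ (λ i′ j′ → D (edge i j) (I i′) (J j′)) (original-copy zero i) (original-copy (suc zero) j)))) ⟩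
    E (uniform size) (λ i → E (uniform size) λ j → D (edge i j) (I i) (J j)) ∎
    where
    open ≡-Reasoning
    open BipartiteGraph cover using (adj)
    M₁ = partMean cover nonEmptyParts zero
    M₂ = partMean cover nonEmptyParts (suc zero)
    D : Bool → Bool → Bool → ℚ
    D a b c = (⟦ a ⟧ - q) * (⟦ b ⟧ * ⟦ c ⟧)

-- Blow-ups

module BlowUp (H : BipartiteGraph) (ne : BipartiteGraph.NonEmptyParts H) (𝕋 : OrientedGraph) where
  open BipartiteGraph H using (adj; vertices; size)
  private module 𝕋 = OrientedGraph 𝕋

  r c : ℕ
  r = List.length (vertices zero)
  c = List.length (vertices (suc zero))

  private
    instance
      r≢0 : NonZero r
      r≢0 = part-nonZero H ne zero
      c≢0 : NonZero c
      c≢0 = part-nonZero H ne (suc zero)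
      rc≢0 : NonZero (r ℕ.* c)
      rc≢0 = ℕ.m*n≢0 r c
      rcτ≢0 : NonZero (r ℕ.* c ℕ.* 𝕋.size)
      rcτ≢0 = ℕ.m*n≢0 (r ℕ.* c) 𝕋.size

  R : Fin r → Fin c → Bool
  R i j = adj (List.lookup (vertices zero) i) (List.lookup (vertices (suc zero)) j)

  -- This relation may have loops and edges in both directions, which the factor from `𝕋` removes in
  -- `_⟿_`.
  _⇝_ : Fin r × Fin c → Fin r × Fin c → Bool
  (i , _) ⇝ (_ , j) = R i j

  Triple : Set
  Triple = (Fin r × Fin c) × Fin 𝕋.size

  tripleMean : Mean Triple
  tripleMean = (uniform r ⊗ uniform c) ⊗ uniform 𝕋.size

  _⟿_ : Triple → Triple → Bool
  (u , a) ⟿ (v , b) = u ⇝ v ∧ 𝕋.edge a b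

  ⟿-asymmetric : ∀ x y → T (x ⟿ y) → ¬ T (y ⟿ x)
  ⟿-asymmetric (u , a) (v , b) xy yx = 𝕋.asymmetric a b
    (proj₂ (Equivalence.to (Bool.T-∧ {u ⇝ v} {𝕋.edge a b}) xy))
    (proj₂ (Equivalence.to (Bool.T-∧ {v ⇝ u} {𝕋.edge b a}) yx))

  triple : Fin (r ℕ.* c ℕ.* 𝕋.size) → Triple
  triple k = let u , a = remQuot 𝕋.size k in remQuot c u , a

  blowUp : OrientedGraph
  blowUp = record
    { size       = r ℕ.* c ℕ.* 𝕋.size
    ; nonEmpty   = rcτ≢0
    ; edge       = λ x y → triple x ⟿ triple y
    ; asymmetric = λ x y xy yx → ⟿-asymmetric (triple x) (triple y) xy yx
    }

  triple-mean : push triple (uniform (r ℕ.* c ℕ.* 𝕋.size)) ≋ tripleMean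
  triple-mean f = begin
    E (uniform (r ℕ.* c ℕ.* 𝕋.size)) (f ∘ triple)
      ≡⟨ uniform-combine (r ℕ.* c) 𝕋.size (f ∘ triple) ⟩
    E (uniform (r ℕ.* c)) (λ u → E (uniform 𝕋.size) λ a → f (triple (combine u a)))
      ≡⟨ E-cong (uniform (r ℕ.* c)) (λ u → E-cong (uniform 𝕋.size) λ a →
           cong (λ (u , a) → f (remQuot c u , a)) (Fin.remQuot-combine u a)) ⟩
    E (uniform (r ℕ.* c)) (λ u → E (uniform 𝕋.size) λ a → f (remQuot c u , a))
      ≡⟨ uniform-combine r c (λ u → E (uniform 𝕋.size) λ a → f (remQuot c u , a)) ⟩
    E (uniform r) (λ i → E (uniform c) λ j → E (uniform 𝕋.size) λ a → f (remQuot c (combine i j) , a))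
      ≡⟨ E-cong (uniform r) (λ i → E-cong (uniform c) λ j → E-cong (uniform 𝕋.size) λ a →
           cong (λ p → f (p , a)) (Fin.remQuot-combine i j)) ⟩
    E tripleMean f ∎
    where open ≡-Reasoning

  vertexOf : Fin 2 → Fin r × Fin c → Fin size
  vertexOf zero    (i , j) = List.lookup (vertices zero) i
  vertexOf (suc _) (i , j) = List.lookup (vertices (suc zero)) j

  partMean-vertexOf : ∀ s → partMean H ne s ≋ push (vertexOf s) (uniform r ⊗ uniform c)
  partMean-vertexOf zero       f = E-cong (uniform r) λ i → sym (E-const (uniform c) _)
  partMean-vertexOf (suc zero) f = sym (E-const (uniform r) _)

  module _ (B : OrientedGraph) (h : ∃ (Hom-K⃗₂ B)) where
    private module B = OrientedGraph B

    hom-⟿ : ∀ f g → hom B.edge _⟿_ (λ v → f v , g v) ≡ hom B.edge _⇝_ f * hom B.edge 𝕋.edge g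
    hom-⟿ f g = trans
      (productOf-cong (λ (x , y) → ⟦∧⟧ (f x ⇝ f y) (𝕋.edge (g x) (g y))) (edges B.edge))
      (productOf-* (λ (x , y) → ⟦ f x ⇝ f y ⟧) (λ (x , y) → ⟦ 𝕋.edge (g x) (g y) ⟧) (edges B.edge))

    -- Each edge indicator is a product of two factors that depend on independent coordinates, hence
    -- the mean of the product over all edges splits.
    t-blowUp : t B blowUp ≡ t-bip (underlying B h) H ne * t B 𝕋
    t-blowUp = begin
      t B blowUp
        ≡⟨ t-mean B blowUp ⟩
      E (Π {B.size} (λ _ → uniform (r ℕ.* c ℕ.* 𝕋.size))) (hom B.edge λ x y → triple x ⟿ triple y)
        ≡⟨ Π-push (λ _ → triple) (λ _ → uniform (r ℕ.* c ℕ.* 𝕋.size)) (hom-ext B.edge _⟿_) ⟨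
      E (Π {B.size} (λ _ → push triple (uniform (r ℕ.* c ℕ.* 𝕋.size)))) (hom B.edge _⟿_)
        ≡⟨ Π-cong {B.size} (λ _ → triple-mean) (hom B.edge _⟿_) ⟩
      E (Π {B.size} (λ _ → tripleMean)) (hom B.edge _⟿_)
        ≡⟨ Π-⊗ (λ _ → uniform r ⊗ uniform c) (λ _ → uniform 𝕋.size) (hom-ext B.edge _⟿_) ⟩
      E P (λ f → E Q λ g → hom B.edge _⟿_ (λ v → f v , g v))
        ≡⟨ E-cong P (λ f → trans (E-cong Q (hom-⟿ f)) (E-* Q (hom B.edge _⇝_ f) (hom B.edge 𝕋.edge))) ⟩
      E P (λ f → hom B.edge _⇝_ f * E Q (hom B.edge 𝕋.edge))
        ≡⟨ E-*ʳ P (E Q (hom B.edge 𝕋.edge)) (hom B.edge _⇝_) ⟩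
      E P (hom B.edge _⇝_) * E Q (hom B.edge 𝕋.edge)
        ≡⟨ cong₂ _*_ (t-bip-push B h H ne (uniform r ⊗ uniform c) vertexOf partMean-vertexOf _⇝_ (λ _ _ → refl)) (t-mean B 𝕋) ⟨
      t-bip (underlying B h) H ne * t B 𝕋 ∎
      where
      open ≡-Reasoning
      P = Π {B.size} (λ _ → uniform r ⊗ uniform c)
      Q = Π {B.size} (λ _ → uniform 𝕋.size)

  τ : ℚ
  τ = E (uniform 𝕋.size) λ a → E (uniform 𝕋.size) λ b → ⟦ 𝕋.edge a b ⟧

  t-K⃗₂ : t K⃗₂ 𝕋 ≡ τ
  t-K⃗₂ = trans (t-mean K⃗₂ 𝕋)
    (E-cong (uniform 𝕋.size) λ a → E-cong (uniform 𝕋.size) λ b → ℚ.*-identityʳ ⟦ 𝕋.edge a b ⟧)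

  module _ (I : Fin r → Bool) (J : Fin c → Bool) (q : ℚ) where
    private
      W : Fin r → Fin c → ℚ
      W i j = ⟦ I i ⟧ * ⟦ J j ⟧

    -- The test sets see only `i` at the tail and `j` at the head. The other coordinate of either
    -- pair averages out, and the edge indicator of `𝕋` becomes its density `τ`.
    discrepancy-blowUp :
      discrepancy (uniform (r ℕ.* c ℕ.* 𝕋.size)) (uniform (r ℕ.* c ℕ.* 𝕋.size)) (OrientedGraph.edge blowUp) q
        (λ x → I (proj₁ (proj₁ (triple x)))) (λ y → J (proj₂ (proj₁ (triple y)))) ≡
      E (uniform r) λ i → E (uniform c) λ j → (⟦ R i j ⟧ * τ - q) * W i j
    discrepancy-blowUp = begin
      E N (λ x → E N λ y → F (triple x) (triple y))
        ≡⟨ E-cong N (λ x → triple-mean (F (triple x))) ⟩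
      E N (λ x → E tripleMean λ y → F (triple x) y)
        ≡⟨ triple-mean (λ x → E tripleMean (F x)) ⟩
      E tripleMean (λ x → E tripleMean λ y → F x y)
        ≡⟨ E-cong (uniform r) (λ i → trans (E-const (uniform c) _) (trans
             (E-cong (uniform 𝕋.size) λ a → trans (E-const (uniform r) _)
               (E-cong (uniform c) λ j → inner i j a))
             (trans (E-comm (uniform 𝕋.size) (isLinear (uniform c)) _)
               (E-cong (uniform c) λ j → outer i j)))) ⟩
      E (uniform r) (λ i → E (uniform c) λ j → (⟦ R i j ⟧ * τ - q) * W i j) ∎
      where
      open ≡-Reasoning
      N = uniform (r ℕ.* c ℕ.* 𝕋.size)
      F : Triple → Triple → ℚ
      F x@((i , _) , _) y@((_ , j) , _) = (⟦ x ⟿ y ⟧ - q) * W i j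
      affine : ∀ (k : Fin 𝕋.size → ℚ) ρ w →
        E (uniform 𝕋.size) (λ a → (ρ * k a - q) * w) ≡ (ρ * E (uniform 𝕋.size) k - q) * w
      affine k ρ w = trans (E-*ʳ (uniform 𝕋.size) w (λ a → ρ * k a - q)) (cong (_* w)
        (trans (E-minus (uniform 𝕋.size) (λ a → ρ * k a) (λ _ → q))
          (cong₂ _-_ (E-* (uniform 𝕋.size) ρ k) (E-const (uniform 𝕋.size) q))))
      inner : ∀ i j a → E (uniform 𝕋.size) (λ b → (⟦ R i j ∧ 𝕋.edge a b ⟧ - q) * W i j) ≡
                        (⟦ R i j ⟧ * E (uniform 𝕋.size) (λ b → ⟦ 𝕋.edge a b ⟧) - q) * W i j
      inner i j a = trans
        (E-cong (uniform 𝕋.size) λ b → cong (λ p → (p - q) * W i j) (⟦∧⟧ (R i j) (𝕋.edge a b)))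
        (affine (λ b → ⟦ 𝕋.edge a b ⟧) ⟦ R i j ⟧ (W i j))
      outer : ∀ i j → E (uniform 𝕋.size) (λ a → (⟦ R i j ⟧ * E (uniform 𝕋.size) (λ b → ⟦ 𝕋.edge a b ⟧) - q) * W i j) ≡
                      (⟦ R i j ⟧ * τ - q) * W i j
      outer i j = affine (λ a → E (uniform 𝕋.size) λ b → ⟦ 𝕋.edge a b ⟧) ⟦ R i j ⟧ (W i j)

    -- An entry ρ of `R` satisfies ρ - p = 2(ρτ - p/2) - 2(τ - 1/2)ρ. The first term gives twice the
    -- discrepancy of the blow-up, the second, with coefficient `κ`, the error of τ against 1/2;
    -- each is at most 2δ.
    discrepancy-base-≤ : ∀ p → ½ * p ≡ q → ∀ {δ} →
      ∣ discrepancy (uniform (r ℕ.* c ℕ.* 𝕋.size)) (uniform (r ℕ.* c ℕ.* 𝕋.size)) (OrientedGraph.edge blowUp) q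
          (λ x → I (proj₁ (proj₁ (triple x)))) (λ y → J (proj₂ (proj₁ (triple y)))) ∣ ≤ δ →
      ∣ t K⃗₂ 𝕋 - ½ ∣ ≤ δ →
      ∣ discrepancy (uniform r) (uniform c) R p I J ∣ ≤ δ + δ + (δ + δ)
    discrepancy-base-≤ p refl {δ} small close = begin
      ∣ discrepancy (uniform r) (uniform c) R p I J ∣
        ≡⟨ cong ∣_∣ decompose ⟩
      ∣ X - Y ∣
        ≤⟨ ℚ.∣p-q∣≤∣p∣+∣q∣ X Y ⟩
      ∣ X ∣ + ∣ Y ∣
        ≤⟨ ℚ.+-mono-≤ X≤ Y≤ ⟩
      δ + δ + (δ + δ) ∎
      where
      open ℚ.≤-Reasoning
      κ = τ - ½ + (τ - ½)
      D = E (uniform r) λ i → E (uniform c) λ j → (⟦ R i j ⟧ * τ - q) * W i j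
      X = D + D
      Y = E (uniform r) λ i → E (uniform c) λ j → κ * (⟦ R i j ⟧ * W i j)
      lemma : ∀ ρ p τ w → (ρ - p) * w ≡
        (ρ * τ - ½ * p) * w + (ρ * τ - ½ * p) * w - (τ - ½ + (τ - ½)) * (ρ * w)
      lemma = solve-∀ ring
      decompose : discrepancy (uniform r) (uniform c) R p I J ≡ X - Y
      decompose = trans
        (E-cong (uniform r) λ i → trans
          (E-cong (uniform c) λ j → lemma ⟦ R i j ⟧ p τ (W i j))
          (trans (E-minus (uniform c) _ _) (cong (_- _) (E-+ (uniform c) _ _))))
        (trans (E-minus (uniform r) _ _) (cong (_- Y) (E-+ (uniform r) _ _)))
      D≤ : ∣ D ∣ ≤ δ
      D≤ = subst (λ d → ∣ d ∣ ≤ δ) discrepancy-blowUp small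
      X≤ : ∣ X ∣ ≤ δ + δ
      X≤ = ℚ.≤-trans (ℚ.∣p+q∣≤∣p∣+∣q∣ D D) (ℚ.+-mono-≤ D≤ D≤)
      τ≤ : ∣ τ - ½ ∣ ≤ δ
      τ≤ = subst (λ t → ∣ t - ½ ∣ ≤ δ) t-K⃗₂ close
      Y≤ : ∣ Y ∣ ≤ δ + δ
      Y≤ = begin
        ∣ Y ∣
          ≤⟨ ∣E∣≤ (uniform r) (λ i → E (uniform c) λ j → κ * (⟦ R i j ⟧ * W i j)) (λ _ → ∣ κ ∣) (λ i → ℚ.≤-trans
               (∣E∣≤ (uniform c) (λ j → κ * (⟦ R i j ⟧ * W i j)) (λ _ → ∣ κ ∣) λ j →
                 subst (λ w → ∣ κ * (⟦ R i j ⟧ * w) ∣ ≤ ∣ κ ∣) (⟦∧⟧ (I i) (J j)) (⟦⟧-bound (R i j) (I i ∧ J j) κ))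
               (ℚ.≤-reflexive (E-const (uniform c) ∣ κ ∣))) ⟩
        E (uniform r) (λ _ → ∣ κ ∣)          ≡⟨ E-const (uniform r) ∣ κ ∣ ⟩
        ∣ κ ∣                                ≤⟨ ℚ.∣p+q∣≤∣p∣+∣q∣ (τ - ½) (τ - ½) ⟩
        ∣ τ - ½ ∣ + ∣ τ - ½ ∣                ≤⟨ ℚ.+-mono-≤ τ≤ τ≤ ⟩
        δ + δ                                ∎

-- The two implications

half-≥0 : ∀ p → 0ℝ Real.≤ p → 0ℝ Real.≤ half p
half-≥0 p 0≤p ε 0<ε = Ev-map
  (λ n q → ≤-byDifference (ℚ.+-mono-≤ (*-monoˡ ½ (ℚ.<⇒≤ (ℚ.positive⁻¹ ½)) q) (ℚ.<⇒≤ (½*-pos 0<ε))) (lemma (seq p n) ε)) (0≤p ε 0<ε)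
  where
  lemma : ∀ p ε → ½ * (p + ε) + ½ * ε - (½ * 0ℚ + 0ℚ) ≡ ½ * p + ε - 0ℚ
  lemma = solve-∀ ring

half-≤1 : ∀ p → p Real.≤ 1ℝ → half p Real.≤ 1ℝ
half-≤1 p p≤1 ε 0<ε = Ev-map
  (λ n q → ≤-byDifference (ℚ.+-mono-≤ (*-monoˡ ½ (ℚ.<⇒≤ (ℚ.positive⁻¹ ½)) q) (+-nonNeg (ℚ.<⇒≤ (½*-pos 0<ε)) (ℚ.<⇒≤ (ℚ.positive⁻¹ ½))))
    (lemma (seq p n) ε)) (p≤1 ε 0<ε)
  where
  lemma : ∀ p ε → ½ * (1ℚ + ε) + (½ * ε + ½) - (½ * p + 0ℚ) ≡ 1ℚ + ε - ½ * p
  lemma = solve-∀ ring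

⟶-seq : ∀ {a} x y → (∀ n → seq x n ≡ seq y n) → a ⟶ x → a ⟶ y
⟶-seq {a} x y eq a⟶x = Null⇒⟶ {a} {y} (Null-cong (λ n → cong (λ s → a n - s) (eq n)) (⟶⇒Null {a} {x} a⟶x))

module _ (B : OrientedGraph) (h : ∃ (Hom-K⃗₂ B)) where

  -- Asymmetric forcing is applied at the density p/2, which again lies in [0,1]. Since `K₂` is the
  -- underlying graph of `K⃗₂`, `t-cover` transfers the edge density as well as the density of B.
  asymmetric⇒directed : AsymmetricForcing (underlying B h) → DirectedForcing B
  asymmetric⇒directed forcing p 0≤p p≤1 G K⃗₂-limit B-limit =
    smallDiscrepancy⇒quasirandom (λ n → directedGraphon (G n)) (half p) (λ n → OrientedGraph.edge (G n))
      (λ n i j → seq-indicator (OrientedGraph.edge (G n) i j)) small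
    where
    open DoubleCover
    vertex : ∀ G s → Fin (List.length (BipartiteGraph.vertices (cover G) s)) → Fin (BipartiteGraph.size (cover G))
    vertex G s = List.lookup (BipartiteGraph.vertices (cover G) s)

    quasirandom : Quasirandom (half p) (λ n → bipartiteGraphon (cover (G n)) (nonEmptyParts (G n)))
    quasirandom = forcing (half p) (half-≥0 p 0≤p) (half-≤1 p p≤1) (cover ∘ G) (nonEmptyParts ∘ G)
      (⟶-cong (half p) (λ n → sym (t-cover (G n) K⃗₂ (id , λ _ _ → id))) K⃗₂-limit)
      (subst (λ e → (λ n → t-bip (underlying B h) (cover (G n)) (nonEmptyParts (G n))) ⟶ half p Real.^ e)
        (sym (e-underlying B h))
        (⟶-cong (half p Real.^ e⃗ B) (λ n → sym (t-cover (G n) B h)) B-limit))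

    adj : ∀ n → Fin _ → Fin _ → Bool
    adj n i j = BipartiteGraph.adj (cover (G n)) (vertex (G n) zero i) (vertex (G n) (suc zero) j)

    cover-small : SmallDiscrepancy
      (λ n → rowMean (bipartiteGraphon (cover (G n)) (nonEmptyParts (G n))))
      (λ n → colMean (bipartiteGraphon (cover (G n)) (nonEmptyParts (G n)))) adj (half p)
    cover-small = quasirandom⇒smallDiscrepancy (λ n → bipartiteGraphon (cover (G n)) (nonEmptyParts (G n))) (half p)
      adj (λ n i j → seq-indicator (adj n i j)) quasirandom

    small : SmallDiscrepancy (λ n → rowMean (directedGraphon (G n))) (λ n → colMean (directedGraphon (G n)))
      (λ n → OrientedGraph.edge (G n)) (half p)
    small ε 0<ε = Ev-map
      (λ n smallₙ I J → subst (λ d → ∣ d ∣ ≤ ε) (discrepancy-cover (G n) (seq (half p) n) I J)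
        (smallₙ (I ∘ original (G n) ∘ vertex (G n) zero) (J ∘ original (G n) ∘ vertex (G n) (suc zero))))
      (cover-small ε 0<ε)

  directed⇒asymmetric : DirectedForcing B → AsymmetricForcing (underlying B h)
  directed⇒asymmetric forcing p 0≤p p≤1 H ne K₂-limit A-limit =
    smallDiscrepancy⇒quasirandom (λ n → bipartiteGraphon (H n) (ne n)) p R
      (λ n i j → seq-indicator (R n i j)) small
    where
    lemma : ∀ ε → ℤ.+ 1 / 4 * ε + ℤ.+ 1 / 4 * ε + (ℤ.+ 1 / 4 * ε + ℤ.+ 1 / 4 * ε) ≡ ε
    lemma = solve-∀ ring

    𝕋 : ℕ → OrientedGraph
    -- The tournaments grow with `n`, so that their densities tend to the powers of 1/2; `suc` keeps
    -- the number of positions positive.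
    𝕋 n = tournament (suc n)

    G : ℕ → OrientedGraph
    G n = BlowUp.blowUp (H n) (ne n) (𝕋 n)

    -- The limits p^e of the bipartite density and (1/2)^e of the tournament multiply to (p/2)^e. It
    -- is stated for every oriented graph because the edge density is the case of `K⃗₂`.
    t-limit : ∀ B h → (λ n → t-bip (underlying B h) (H n) (ne n)) ⟶ p Real.^ e⃗ B →
              (λ n → t B (G n)) ⟶ half p Real.^ e⃗ B
    t-limit B h limit = Null⇒⟶ {λ n → t B (G n)} {half p Real.^ e⃗ B}
      (Null-cong {λ n → a n * b n - α n * β n} {λ n → t B (G n) - seq (half p Real.^ e⃗ B) n}
        (λ n → cong₂ _-_ (sym (BlowUp.t-blowUp (H n) (ne n) (𝕋 n) B h)) (limits n))
        (Null-*-limit {a} {α} {b} {β} (cauchy-bounded (p Real.^ e⃗ B)) (const-bounded (½ ^ e⃗ B))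
          (⟶⇒Null {λ n → t-bip (underlying B h) (H n) (ne n)} {p Real.^ e⃗ B} limit) (t-tournament-limit B)))
      where
      a α b β : ℕ → ℚ
      a n = t-bip (underlying B h) (H n) (ne n)
      α n = seq (p Real.^ e⃗ B) n
      b n = t B (𝕋 n)
      β _ = ½ ^ e⃗ B
      limits : ∀ n → α n * β n ≡ seq (half p Real.^ e⃗ B) n
      limits n = begin
        seq (p Real.^ e⃗ B) n * ½ ^ e⃗ B      ≡⟨ cong (_* ½ ^ e⃗ B) (seq-^ p (e⃗ B) n) ⟩
        seq p n ^ e⃗ B * ½ ^ e⃗ B             ≡⟨ *-^ ½ (seq p n) (e⃗ B) ⟨
        (½ * seq p n) ^ e⃗ B                 ≡⟨ seq-^ (half p) (e⃗ B) n ⟨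
        seq (half p Real.^ e⃗ B) n           ∎
        where open ≡-Reasoning

    e⃗-K⃗₂ : e⃗ K⃗₂ ≡ 1
    e⃗-K⃗₂ = refl

    ^-e⃗-K⃗₂ : ∀ x n → seq (x Real.^ e⃗ K⃗₂) n ≡ seq x n
    ^-e⃗-K⃗₂ x n = trans (seq-^ x (e⃗ K⃗₂) n) (trans (cong (seq x n ^_) e⃗-K⃗₂) (ℚ.*-identityʳ (seq x n)))

    K⃗₂-limit : (λ n → t K⃗₂ (G n)) ⟶ half p
    K⃗₂-limit = ⟶-seq {λ n → t K⃗₂ (G n)} (half p Real.^ e⃗ K⃗₂) (half p) (^-e⃗-K⃗₂ (half p))
      (t-limit K⃗₂ (id , λ _ _ → id)
        (⟶-seq {λ n → t-bip (underlying K⃗₂ (id , λ _ _ → id)) (H n) (ne n)} p (p Real.^ e⃗ K⃗₂) (λ n → sym (^-e⃗-K⃗₂ p n))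
          (⟶-cong {λ n → t-bip K₂ (H n) (ne n)} {λ n → t-bip (underlying K⃗₂ (id , λ _ _ → id)) (H n) (ne n)} p (λ _ → refl) K₂-limit)))

    B-limit : (λ n → t B (G n)) ⟶ half p Real.^ e⃗ B
    B-limit = t-limit B h
      (subst (λ e → (λ n → t-bip (underlying B h) (H n) (ne n)) ⟶ p Real.^ e) (e-underlying B h) A-limit)

    quasirandom : Quasirandom (half p) (λ n → directedGraphon (G n))
    quasirandom = forcing p 0≤p p≤1 G K⃗₂-limit B-limit

    R : ∀ n → Fin (BlowUp.r (H n) (ne n) (𝕋 n)) → Fin (BlowUp.c (H n) (ne n) (𝕋 n)) → Bool
    R n = BlowUp.R (H n) (ne n) (𝕋 n)

    blowUp-small : SmallDiscrepancy (λ n → rowMean (directedGraphon (G n))) (λ n → colMean (directedGraphon (G n)))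
      (λ n → OrientedGraph.edge (G n)) (half p)
    blowUp-small = quasirandom⇒smallDiscrepancy (λ n → directedGraphon (G n)) (half p) (λ n → OrientedGraph.edge (G n))
      (λ n i j → seq-indicator (OrientedGraph.edge (G n) i j)) quasirandom

    small : SmallDiscrepancy (λ n → rowMean (bipartiteGraphon (H n) (ne n))) (λ n → colMean (bipartiteGraphon (H n) (ne n))) R p
    small ε 0<ε = Ev-zip
      (λ n smallₙ close I J → subst (∣ discrepancy (rowMean (bipartiteGraphon (H n) (ne n)))
          (colMean (bipartiteGraphon (H n) (ne n))) (R n) (seq p n) I J ∣ ≤_) (lemma ε)
        (BlowUp.discrepancy-base-≤ (H n) (ne n) (𝕋 n) I J (seq (half p) n) (seq p n) refl {δ}
          (smallₙ (λ x → I (proj₁ (proj₁ (BlowUp.triple (H n) (ne n) (𝕋 n) x))))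
                  (λ y → J (proj₂ (proj₁ (BlowUp.triple (H n) (ne n) (𝕋 n) y)))))
          close))
      (blowUp-small δ 0<δ) (t-tournament-limit K⃗₂ δ 0<δ)
      where
      δ : ℚ
      -- `discrepancy-base-≤` loses a factor 4.
      δ = ℤ.+ 1 / 4 * ε
      0<δ : 0ℚ < δ
      0<δ = *-pos (ℚ.positive⁻¹ (ℤ.+ 1 / 4)) 0<ε

theorem1p8 : (B : OrientedGraph) (h : ∃ (Hom-K⃗₂ B)) →
    AsymmetricForcing (underlying B h) ⇔ DirectedForcing B
theorem1p8 B h = mk⇔ (asymmetric⇒directed B h) (directed⇒asymmetric B h)
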